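{- There exists a positive integer $q'$ such that for each integer $q\ge q'$, any graph that is cospectral with the Hamming graph $H(3,q)$ is the intersection graph of some linear $3$-uniform hypergraph.
   Context: All graphs are finite, undirected and simple. Two graphs are cospectral if their adjacency matrices have the same spectrum (as multisets of eigenvalues). For a set $X$ of size $q\geq 2$, the Hamming graph $H(3,q)$ has vertex set $X^3$, two vertices being adjacent iff they differ in precisely one coordinate. A hypergraph $H$ is a pair $(X,E)$ with $X$ a finite set (vertices) and $E$ a set of non-empty subsets of $X$ (edges). It is $h$-uniform ($h\ge 2$) if every edge has cardinality $h$; it is linear if every pair of distinct vertices is contained in at most one edge. The intersection graph of $H=(X,E)$ is the graph with vertex set $E$ in which two distinct edges $e,e'\in E$ are adjacent iff $e\cap e'\ne\emptyset$. Graphs are identified up to isomorphism. -}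

module Defs where

open import Algebra.Bundles.Raw using (RawRing)
import Algebra.Definitions.RawSemiring as RawSemiringDefs
open import Data.Bool.Base using (if_then_else_)
open import Data.Fin.Base using (Fin; zero; suc; toℕ; punchIn; finToFun)
open import Data.Fin.Properties using (_≟_; any?; all?)
open import Data.Fin.Subset using (Subset; _∈_; _∩_; Nonempty; ∣_∣)
open import Data.Fin.Subset.Properties using (nonempty?; ∩-comm)
open import Data.List.Base using (List; length; foldr)
open import Data.Nat.Base as ℕ using (ℕ)
import Data.Nat.Properties as ℕ
open import Data.Product.Base using (Σ-syntax; ∃-syntax; _×_; _,_)
open import Data.Product using (∃!)
open import Data.Rational.Base as ℚ using (ℚ; 0ℚ; 1ℚ; ½)
import Data.Rational.Properties as ℚ
open import Data.Rational.Solver using (module +-*-Solver)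
open import Data.Vec.Functional using (Vector)
open import Function.Bundles using (_↔_; _⇔_; Inverse)
open import Function.Definitions using (Injective)
open import Level using (0ℓ; _⊔_)
open import Relation.Binary.Core using (Rel)
open import Relation.Binary.Definitions using (Decidable; Symmetric; Irreflexive)
open import Relation.Binary.PropositionalEquality
  using (_≡_; _≢_; refl; sym; trans; cong; subst; ≢-sym)
open import Relation.Nullary.Decidable using (does; map′; ¬?; _×-dec_; _→-dec_)

------------------------------------------------------------------------
-- Real numbers: Cauchy sequences of rationals with a modulus, compared by
-- the setoid equality "the difference tends to 0".

record ℝ : Set where
  constructor mkℝ
  field
    seq    : ℕ → ℚ
    cauchy : ∀ ε → 0ℚ ℚ.< ε → ∃[ N ] (∀ m n → N ℕ.≤ m → N ℕ.≤ n →
               ℚ.∣ seq m ℚ.- seq n ∣ ℚ.< ε)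

open ℝ public

infix 4 _≈ʳ_

_≈ʳ_ : Rel ℝ 0ℓ
x ≈ʳ y = ∀ ε → 0ℚ ℚ.< ε → ∃[ N ] (∀ n → N ℕ.≤ n → ℚ.∣ seq x n ℚ.- seq y n ∣ ℚ.< ε)

module ℝ-Lemmas where
  0<½*ε : ∀ {ε} → 0ℚ ℚ.< ε → 0ℚ ℚ.< ½ ℚ.* ε
  0<½*ε {ε} ε>0 = ℚ.positive⁻¹ (½ ℚ.* ε) ⦃ ℚ.pos*pos⇒pos ½ ε ⦃ ℚ.positive ε>0 ⦄ ⦄

  ½*ε+½*ε : ∀ ε → ½ ℚ.* ε ℚ.+ ½ ℚ.* ε ≡ ε
  ½*ε+½*ε = solve 1 (λ e → con ½ :* e :+ con ½ :* e := e) refl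
    where open +-*-Solver

  +-diff : ∀ a b c d → (a ℚ.+ b) ℚ.- (c ℚ.+ d) ≡ (a ℚ.- c) ℚ.+ (b ℚ.- d)
  +-diff = solve 4 (λ a b c d → (a :+ b) :- (c :+ d) := (a :- c) :+ (b :- d)) refl
    where open +-*-Solver

  *-diff : ∀ a b c d → (a ℚ.* b) ℚ.- (c ℚ.* d) ≡ a ℚ.* (b ℚ.- d) ℚ.+ d ℚ.* (a ℚ.- c)
  *-diff = solve 4 (λ a b c d → (a :* b) :- (c :* d) := a :* (b :- d) :+ d :* (a :- c)) refl
    where open +-*-Solver

  neg-diff : ∀ a b → (ℚ.- a) ℚ.- (ℚ.- b) ≡ ℚ.- (a ℚ.- b)
  neg-diff = solve 2 (λ a b → (:- a) :- (:- b) := :- (a :- b)) refl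
    where open +-*-Solver

  split : ∀ a b → a ≡ b ℚ.+ (a ℚ.- b)
  split = solve 2 (λ a b → a := b :+ (a :- b)) refl
    where open +-*-Solver

  Bounded : ℝ → ℚ → ℕ → Set
  Bounded x B N = 0ℚ ℚ.< B × (∀ n → N ℕ.≤ n → ℚ.∣ seq x n ∣ ℚ.≤ B)

  bounded : ∀ x → ∃[ B ] ∃[ N ] Bounded x B N
  bounded x with cauchy x 1ℚ (ℚ.positive⁻¹ 1ℚ)
  ... | N , close = ℚ.∣ seq x N ∣ ℚ.+ 1ℚ , N , pos , bound
    where
    open ℚ.≤-Reasoning
    pos : 0ℚ ℚ.< ℚ.∣ seq x N ∣ ℚ.+ 1ℚ
    pos = ℚ.+-mono-≤-< (ℚ.0≤∣p∣ (seq x N)) (ℚ.positive⁻¹ 1ℚ)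
    bound : ∀ n → N ℕ.≤ n → ℚ.∣ seq x n ∣ ℚ.≤ ℚ.∣ seq x N ∣ ℚ.+ 1ℚ
    bound n N≤n = begin
      ℚ.∣ seq x n ∣
        ≡⟨ cong ℚ.∣_∣ (split (seq x n) (seq x N)) ⟩
      ℚ.∣ seq x N ℚ.+ (seq x n ℚ.- seq x N) ∣
        ≤⟨ ℚ.∣p+q∣≤∣p∣+∣q∣ (seq x N) (seq x n ℚ.- seq x N) ⟩
      ℚ.∣ seq x N ∣ ℚ.+ ℚ.∣ seq x n ℚ.- seq x N ∣
        ≤⟨ ℚ.+-monoʳ-≤ ℚ.∣ seq x N ∣ (ℚ.<⇒≤ (close n N N≤n ℕ.≤-refl)) ⟩
      ℚ.∣ seq x N ∣ ℚ.+ 1ℚ ∎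

  *-bound : ∀ {a b B δ} → 0ℚ ℚ.< B → ℚ.∣ a ∣ ℚ.≤ B → ℚ.∣ b ∣ ℚ.< δ →
            ℚ.∣ a ℚ.* b ∣ ℚ.< B ℚ.* δ
  *-bound {a} {b} {B} {δ} B>0 a≤B b<δ = begin-strict
    ℚ.∣ a ℚ.* b ∣            ≡⟨ ℚ.∣p*q∣≡∣p∣*∣q∣ a b ⟩
    ℚ.∣ a ∣ ℚ.* ℚ.∣ b ∣      ≤⟨ ℚ.*-monoʳ-≤-nonNeg ℚ.∣ b ∣ ⦃ ℚ.nonNegative (ℚ.0≤∣p∣ b) ⦄ a≤B ⟩
    B ℚ.* ℚ.∣ b ∣            <⟨ ℚ.*-monoʳ-<-pos B ⦃ ℚ.positive B>0 ⦄ b<δ ⟩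
    B ℚ.* δ                  ∎
    where open ℚ.≤-Reasoning

  quotient : ∀ {B ε} → 0ℚ ℚ.< B → 0ℚ ℚ.< ε → ∃[ δ ] (0ℚ ℚ.< δ × B ℚ.* δ ≡ ε)
  quotient {B} {ε} B>0 ε>0 =
      B⁻¹ ℚ.* ε
    , ℚ.positive⁻¹ (B⁻¹ ℚ.* ε)
        ⦃ ℚ.pos*pos⇒pos B⁻¹ ⦃ ℚ.1/pos⇒pos B ⦄ ε ⦃ ℚ.positive ε>0 ⦄ ⦄
    , trans (sym (ℚ.*-assoc B B⁻¹ ε))
        (trans (cong (ℚ._* ε) (ℚ.*-inverseʳ B)) (ℚ.*-identityˡ ε))
    where
    instance
      B-pos : ℚ.Positive B
      B-pos = ℚ.positive B>0
      B-nz : ℚ.NonZero B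
      B-nz = ℚ.pos⇒nonZero B
    B⁻¹ : ℚ
    B⁻¹ = ℚ.1/ B

open ℝ-Lemmas

fromℚ : ℚ → ℝ
fromℚ p = mkℝ (λ _ → p) λ ε ε>0 →
  0 , λ _ _ _ _ → subst (ℚ._< ε) (cong ℚ.∣_∣ (sym (ℚ.+-inverseʳ p))) ε>0

infixl 6 _+ʳ_
infixl 7 _*ʳ_

_+ʳ_ : ℝ → ℝ → ℝ
x +ʳ y = mkℝ (λ n → seq x n ℚ.+ seq y n) λ ε ε>0 →
  let (M , xc) = cauchy x (½ ℚ.* ε) (0<½*ε ε>0)
      (N , yc) = cauchy y (½ ℚ.* ε) (0<½*ε ε>0)
      open ℚ.≤-Reasoning
  in M ℕ.⊔ N , λ m n m≥ n≥ → begin-strict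
    ℚ.∣ (seq x m ℚ.+ seq y m) ℚ.- (seq x n ℚ.+ seq y n) ∣
      ≡⟨ cong ℚ.∣_∣ (+-diff (seq x m) (seq y m) (seq x n) (seq y n)) ⟩
    ℚ.∣ (seq x m ℚ.- seq x n) ℚ.+ (seq y m ℚ.- seq y n) ∣
      ≤⟨ ℚ.∣p+q∣≤∣p∣+∣q∣ (seq x m ℚ.- seq x n) (seq y m ℚ.- seq y n) ⟩
    ℚ.∣ seq x m ℚ.- seq x n ∣ ℚ.+ ℚ.∣ seq y m ℚ.- seq y n ∣
      <⟨ ℚ.+-mono-< (xc m n (ℕ.m⊔n≤o⇒m≤o M N m≥) (ℕ.m⊔n≤o⇒m≤o M N n≥))
                    (yc m n (ℕ.m⊔n≤o⇒n≤o M N m≥) (ℕ.m⊔n≤o⇒n≤o M N n≥)) ⟩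
    ½ ℚ.* ε ℚ.+ ½ ℚ.* ε
      ≡⟨ ½*ε+½*ε ε ⟩
    ε ∎

_*ʳ_ : ℝ → ℝ → ℝ
x *ʳ y = mkℝ (λ n → seq x n ℚ.* seq y n) λ ε ε>0 →
  let (A , K , A>0 , x≤A) = bounded x
      (B , L , B>0 , y≤B) = bounded y
      (δ , δ>0 , eq)      = quotient (ℚ.+-mono-< A>0 B>0) ε>0
      (M , xc)            = cauchy x δ δ>0
      (N , yc)            = cauchy y δ δ>0
      open ℚ.≤-Reasoning
  in (K ℕ.⊔ L) ℕ.⊔ (M ℕ.⊔ N) , λ m n m≥ n≥ →
    let mM⊔N = ℕ.m⊔n≤o⇒n≤o (K ℕ.⊔ L) (M ℕ.⊔ N) m≥
        nM⊔N = ℕ.m⊔n≤o⇒n≤o (K ℕ.⊔ L) (M ℕ.⊔ N) n≥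
        m≥K  = ℕ.m⊔n≤o⇒m≤o K L (ℕ.m⊔n≤o⇒m≤o (K ℕ.⊔ L) (M ℕ.⊔ N) m≥)
        n≥L  = ℕ.m⊔n≤o⇒n≤o K L (ℕ.m⊔n≤o⇒m≤o (K ℕ.⊔ L) (M ℕ.⊔ N) n≥)
        dx   = xc m n (ℕ.m⊔n≤o⇒m≤o M N mM⊔N) (ℕ.m⊔n≤o⇒m≤o M N nM⊔N)
        dy   = yc m n (ℕ.m⊔n≤o⇒n≤o M N mM⊔N) (ℕ.m⊔n≤o⇒n≤o M N nM⊔N)
    in begin-strict
    ℚ.∣ (seq x m ℚ.* seq y m) ℚ.- (seq x n ℚ.* seq y n) ∣
      ≡⟨ cong ℚ.∣_∣ (*-diff (seq x m) (seq y m) (seq x n) (seq y n)) ⟩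
    ℚ.∣ seq x m ℚ.* (seq y m ℚ.- seq y n) ℚ.+ seq y n ℚ.* (seq x m ℚ.- seq x n) ∣
      ≤⟨ ℚ.∣p+q∣≤∣p∣+∣q∣ (seq x m ℚ.* (seq y m ℚ.- seq y n))
                          (seq y n ℚ.* (seq x m ℚ.- seq x n)) ⟩
    ℚ.∣ seq x m ℚ.* (seq y m ℚ.- seq y n) ∣ ℚ.+ ℚ.∣ seq y n ℚ.* (seq x m ℚ.- seq x n) ∣
      <⟨ ℚ.+-mono-< (*-bound {a = seq x m} {seq y m ℚ.- seq y n} A>0 (x≤A m m≥K) dy)
                    (*-bound {a = seq y n} {seq x m ℚ.- seq x n} B>0 (y≤B n n≥L) dx) ⟩
    A ℚ.* δ ℚ.+ B ℚ.* δ
      ≡⟨ ℚ.*-distribʳ-+ δ A B ⟨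
    (A ℚ.+ B) ℚ.* δ
      ≡⟨ eq ⟩
    ε ∎

-ʳ_ : ℝ → ℝ
-ʳ x = mkℝ (λ n → ℚ.- seq x n) λ ε ε>0 →
  let (N , xc) = cauchy x ε ε>0
  in N , λ m n m≥ n≥ → subst (ℚ._< ε)
       (sym (trans (cong ℚ.∣_∣ (neg-diff (seq x m) (seq x n)))
                   (ℚ.∣-p∣≡∣p∣ (seq x m ℚ.- seq x n))))
       (xc m n m≥ n≥)

ℝ-rawRing : RawRing 0ℓ 0ℓ
ℝ-rawRing = record
  { Carrier = ℝ
  ; _≈_     = _≈ʳ_
  ; _+_     = _+ʳ_
  ; _*_     = _*ʳ_
  ; -_      = -ʳ_
  ; 0#      = fromℚ 0ℚ
  ; 1#      = fromℚ 1ℚ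
  }

------------------------------------------------------------------------
-- Square matrices and their spectra

module Matrices {c ℓ} (R : RawRing c ℓ) where
  open RawRing R
  open RawSemiringDefs rawSemiring using (sum; _^_)

  Matrix : ℕ → Set c
  Matrix n = Fin n → Fin n → Carrier

  det : ∀ {n} → Matrix n → Carrier
  det {ℕ.zero}  M = 1#
  det {ℕ.suc n} M = sum λ j →
    (- 1#) ^ toℕ j * M zero j * det (λ i k → M (suc i) (punchIn j k))

  scalar : ∀ {n} → Carrier → Matrix n
  scalar x i j = if does (i ≟ j) then x else 0#

  charPoly : ∀ {n} → Matrix n → Carrier → Carrier
  charPoly M x = det λ i j → scalar x i j + - M i j

  rootProduct : List Carrier → Carrier → Carrier
  rootProduct Λ x = foldr (λ θ p → (x + - θ) * p) 1# Λ

  -- Λ lists, in some order, the eigenvalues of the n × n matrix M, each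
  -- repeated according to its multiplicity as a root of the characteristic
  -- polynomial: det (x I - M) = ∏ (x - θ) for all x.  Over an infinite field
  -- such as ℝ this is the same as equality of polynomials.
  IsSpectrum : ∀ {n} → Matrix n → List Carrier → Set (c ⊔ ℓ)
  IsSpectrum {n} M Λ = length Λ ≡ n × (∀ x → charPoly M x ≈ rootProduct Λ x)

open Matrices ℝ-rawRing public using (IsSpectrum) renaming (Matrix to ℝMatrix)

------------------------------------------------------------------------
-- Graphs

record Graph (n : ℕ) : Set₁ where
  field
    _~_    : Rel (Fin n) 0ℓ
    _~?_   : Decidable _~_
    sym~   : Symmetric _~_
    irrefl : Irreflexive _≡_ _~_

adjacency : ∀ {n} → Graph n → ℝMatrix n
adjacency G i j = if does (i ~? j) then fromℚ 1ℚ else fromℚ 0ℚ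
  where open Graph G

-- IsSpectrum does not depend on the order of Λ, so a common list is a common
-- multiset.
Cospectral : ∀ {m n} → Graph m → Graph n → Set
Cospectral G H = Σ[ Λ ∈ List ℝ ] IsSpectrum (adjacency G) Λ × IsSpectrum (adjacency H) Λ

infix 4 _≅_

_≅_ : ∀ {m n} → Graph m → Graph n → Set
_≅_ {m} {n} G H = Σ[ f ∈ Fin m ↔ Fin n ]
  (∀ i j → Graph._~_ G i j ⇔ Graph._~_ H (Inverse.to f i) (Inverse.to f j))

DifferInOneCoordinate : ∀ {d q} → Rel (Vector (Fin q) d) 0ℓ
DifferInOneCoordinate u v = ∃! _≡_ λ k → u k ≢ v k

differInOneCoordinate? : ∀ {d q} → Decidable (DifferInOneCoordinate {d} {q})
differInOneCoordinate? u v =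
  map′ (λ (k , ne , uniq) → k , ne , λ {l} → uniq l)
       (λ (k , ne , uniq) → k , ne , λ l → uniq {l})
       (any? λ k → ¬? (u k ≟ v k) ×-dec all? λ l → ¬? (u l ≟ v l) →-dec (k ≟ l))

-- finToFun : Fin (q ^ d) → (Fin d → Fin q) is the standard bijection between
-- Fin (q ^ d) and the d-tuples over a set of q elements.
Hamming : (d q : ℕ) → Graph (q ℕ.^ d)
Hamming d q = record
  { _~_    = λ i j → DifferInOneCoordinate (tuple i) (tuple j)
  ; _~?_   = λ i j → differInOneCoordinate? (tuple i) (tuple j)
  ; sym~   = λ (k , ne , uniq) → k , ≢-sym ne , λ ne′ → uniq (≢-sym ne′)
  ; irrefl = λ { refl (_ , ne , _) → ne refl }
  }
  where
  tuple : Fin (q ℕ.^ d) → Vector (Fin q) d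
  tuple = finToFun

------------------------------------------------------------------------
-- Hypergraphs

-- The edge set is the image of the injective enumeration edge, so that
-- Fin size stands for the edge set itself.
record Hypergraph : Set where
  field
    order    : ℕ
    size     : ℕ
    edge     : Fin size → Subset order
    distinct : Injective _≡_ _≡_ edge
    nonempty : ∀ e → Nonempty (edge e)

module _ (H : Hypergraph) where
  open Hypergraph H

  Uniform : ℕ → Set
  Uniform h = ∀ e → ∣ edge e ∣ ≡ h

  Linear : Set
  Linear = ∀ x y → x ≢ y → ∀ e e′ →
    x ∈ edge e → y ∈ edge e → x ∈ edge e′ → y ∈ edge e′ → e ≡ e′

  intersectionGraph : Graph size
  intersectionGraph = record
    { _~_    = λ e e′ → e ≢ e′ × Nonempty (edge e ∩ edge e′)
    ; _~?_   = λ e e′ → ¬? (e ≟ e′) ×-dec nonempty? (edge e ∩ edge e′)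
    ; sym~   = λ {e} {e′} (ne , meet) →
                 ≢-sym ne , subst Nonempty (∩-comm (edge e) (edge e′)) meet
    ; irrefl = λ eq (ne , _) → ne eq
    }

{-# OPTIONS --safe #-}

-- Put S = A + 3I, so that H(3,q) has S-eigenvalues 3q, 2q, q, 0.  Equal
-- characteristic polynomials give equal traces of all powers of S: by Jacobi's
-- formula t·d/dt log det(I - tS) = -Σ tr(Sᵐ) tᵐ.  As S is symmetric, the
-- Frobenius norm of a polynomial in S is a combination of these traces, so
-- polynomial identities pass from H(3,q) to the cospectral graph, and one gets
-- regularity and S(S - q)(S - 2q) = 6J.  Then P = S² - qS satisfies
-- P² = 2q²P + 24qJ and has diagonal 6, which bounds its entries: adjacent
-- vertices have q + O(1) common neighbours and non-adjacent ones at most 6.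
-- For large q the neighbourhood of a vertex contains no 4-coclique and splits
-- into three cliques; since it has exactly 3(q-1) vertices and 3(q-1)(q-2)/2
-- edges, convexity leaves no edges between the cliques.  The resulting lines,
-- three through each vertex, are the vertices of the hypergraph.
module Submission where

open import Defs
open import Algebra.Bundles using (CommutativeRing)
open import Algebra.Bundles.Raw using (RawRing)
import Algebra.Definitions.RawSemiring as RawSemiringDefinitions
import Algebra.Properties.Semiring.Sum as SemiringSum
import Algebra.Solver.Ring.NaturalCoefficients.Default as SemiringSolver
open import Data.Bool.Base using (Bool; true; false; if_then_else_)
open import Data.Fin.Base using (Fin; zero; suc; toℕ; punchIn; finToFun; funToFin; combine; _↑ˡ_; _↑ʳ_)
open import Data.Fin.Patterns using (0F; 1F; 2F; 3F; 4F)
import Data.Fin.Properties as Fin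
open import Data.Fin.Subset using (Subset; _∈_; _∉_; _∪_; ⁅_⁆; ∣_∣; inside; outside)
import Data.Fin.Subset.Properties as Subset
open import Data.Integer.Base as ℤ using (ℤ; +_; -[1+_]; 0ℤ; 1ℤ; -1ℤ; +≤+)
import Data.Integer.Properties as ℤ
open import Data.Integer.Tactic.RingSolver using (solve-∀)
open import Data.Nat.Base using (ℕ; _≤_; _<_)
open import Data.Nat.Base as ℕ using (zero; suc; z≤n; s≤s)
import Data.Nat.Divisibility as ℕ
import Data.Nat.Properties as ℕ
open import Data.Product.Base using (Σ-syntax; ∃-syntax; _×_; _,_; proj₁; proj₂)
open import Data.Rational.Base as ℚ using (ℚ; 0ℚ; 1ℚ; ½)
import Data.Rational.Properties as ℚ
open import Data.Rational.Solver using (module +-*-Solver)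
open import Data.Rational.Unnormalised.Base as ℚᵘ using (mkℚᵘ; *≡*)
import Data.Rational.Unnormalised.Properties as ℚᵘ
open import Data.Sum.Base using (_⊎_; inj₁; inj₂; [_,_]′)
open import Data.Vec.Base using (_∷_; here; there)
open import Data.Vec.Functional using (Vector)
open import Function.Base using (_∘_; id)
open import Function.Bundles using (mk⇔)
open import Function.Construct.Identity using (↔-id)
open import Level using (0ℓ; _⊔_)
import Relation.Binary.Reasoning.Setoid as SetoidReasoning
open import Relation.Binary.PropositionalEquality as ≡ using (_≡_; _≢_; cong; cong₂; subst; ≢-sym; module ≡-Reasoning)
open import Relation.Nullary.Decidable using (Dec; yes; no; does; dec-true; dec-false; toWitness; _×-dec_; _⊎-dec_; _→-dec_; ¬?; decidable-stable)
open import Relation.Nullary.Negation using (contradiction; ¬_)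


-- Determinants

-- The eigenvalues enter only as a common list that equates the two characteristic polynomials up to
-- equality of reals. At an integer both values are constant sequences, so they agree as integers,
-- and the rest of the argument takes place over ℤ. This shapes the later steps. The traces come
-- from a logarithmic derivative of series with constant term 1, where nothing is divided.
-- Diagonalisability is replaced by the fact that a matrix whose squared entries sum to 0 is itself
-- 0. Positive semidefiniteness appears only as nonnegativity of a sum of squares, such as |P_x ±
-- P_y|² for two rows of P. The entry sums of powers of S are not spectral invariants in general.
-- Here they are pinned down because A is a 0-1 matrix: tr S² counts the edges, so the average
-- degree equals that of H(3,q), which is also the largest eigenvalue, and this equality forces
-- regularity. Determinants are needed both over ℤ and over its power series, hence the general
-- commutative ring.

module Determinant {c ℓ} (R : CommutativeRing c ℓ) where
  open CommutativeRing R hiding (zero)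
  open Matrices rawRing
  open SemiringSum semiring
  open SemiringSolver commutativeSemiring using (solve; _:=_; _:+_; _:*_; con)
  open RawSemiringDefinitions (RawRing.rawSemiring rawRing) using (_^_)
  open SetoidReasoning setoid

  sign : ℕ → Carrier
  sign j = (- 1#) ^ j

  minor : ∀ {n} → Matrix (suc n) → Fin (suc n) → Matrix n
  minor M j i k = M (suc i) (punchIn j k)

  det-cong : ∀ {n} {M N : Matrix n} → (∀ i j → M i j ≈ N i j) → det M ≈ det N
  det-cong {zero}  eq = refl
  det-cong {suc n} eq = sum-cong-≋ λ j →
    *-cong (*-congˡ {sign (toℕ j)} (eq zero j)) (det-cong λ i k → eq (suc i) (punchIn j k))

  sum-zero : ∀ {n} {f : Vector Carrier n} → (∀ i → f i ≈ 0#) → sum f ≈ 0#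
  sum-zero {n} eq = trans (sum-cong-≋ eq) (sum-replicate-zero n)

  sum-single : ∀ {n} {f : Vector Carrier n} i → (∀ j → j ≢ i → f j ≈ 0#) → sum f ≈ f i
  sum-single zero    off = trans (+-congˡ (sum-zero λ j → off (suc j) λ ())) (+-identityʳ _)
  sum-single (suc i) off = trans (+-cong (off zero λ ())
    (sum-single i λ j j≢i → off (suc j) λ { ≡.refl → j≢i ≡.refl })) (+-identityˡ _)

  infixl 9 _[_≔_]

  -- Row replacement by recursion on the index, not by a test for equality: replacing row `suc i`
  -- leaves row `zero` definitionally unchanged, and replacing row `zero` leaves all minors of the
  -- expansion unchanged.
  _[_≔_] : ∀ {a} {A : Set a} {m} → Vector A m → Fin m → A → Vector A m
  (M [ zero  ≔ r ]) zero    = r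
  (M [ zero  ≔ r ]) (suc j) = M (suc j)
  (M [ suc i ≔ r ]) zero    = M zero
  (M [ suc i ≔ r ]) (suc j) = ((M ∘ suc) [ i ≔ r ]) j

  ≔-map : ∀ {a b} {A : Set a} {B : Set b} (f : A → B) {m} (M : Vector A m) i r j →
          f ((M [ i ≔ r ]) j) ≡ ((f ∘ M) [ i ≔ f r ]) j
  ≔-map f M zero    r zero    = ≡.refl
  ≔-map f M zero    r (suc j) = ≡.refl
  ≔-map f M (suc i) r zero    = ≡.refl
  ≔-map f M (suc i) r (suc j) = ≔-map f (M ∘ suc) i r j

  ≔-same : ∀ {a} {A : Set a} {m} (M : Vector A m) i r → (M [ i ≔ r ]) i ≡ r
  ≔-same M zero    r = ≡.refl
  ≔-same M (suc i) r = ≔-same (M ∘ suc) i r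

  ≔-other : ∀ {a} {A : Set a} {m} (M : Vector A m) {i j} r → j ≢ i → (M [ i ≔ r ]) j ≡ M j
  ≔-other M {zero}  {zero}  r j≢i = contradiction ≡.refl j≢i
  ≔-other M {zero}  {suc j} r j≢i = ≡.refl
  ≔-other M {suc i} {zero}  r j≢i = ≡.refl
  ≔-other M {suc i} {suc j} r j≢i = ≔-other (M ∘ suc) r (j≢i ∘ ≡.cong suc)

  ≔-id : ∀ {a} {A : Set a} {m} (M : Vector A m) i j → (M [ i ≔ M i ]) j ≡ M j
  ≔-id M zero    zero    = ≡.refl
  ≔-id M zero    (suc j) = ≡.refl
  ≔-id M (suc i) zero    = ≡.refl
  ≔-id M (suc i) (suc j) = ≔-id (M ∘ suc) i j

  ≔-cong : ∀ {m n} (M : Fin m → Vector Carrier n) i {r r′ : Vector Carrier n} →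
           (∀ k → r k ≈ r′ k) → ∀ j k → (M [ i ≔ r ]) j k ≈ (M [ i ≔ r′ ]) j k
  ≔-cong M zero    eq zero    k = eq k
  ≔-cong M zero    eq (suc j) k = refl
  ≔-cong M (suc i) eq zero    k = refl
  ≔-cong M (suc i) eq (suc j) k = ≔-cong (M ∘ suc) i eq j k

  minor-≔ : ∀ {n} (M : Matrix (suc n)) i r j →
            det (minor (M [ suc i ≔ r ]) j) ≈ det (minor M j [ i ≔ r ∘ punchIn j ])
  minor-≔ M i r j = det-cong λ x k →
    reflexive (≡.cong (λ row → row k) (≔-map (_∘ punchIn j) (M ∘ suc) i r x))

  -- Linearity in one row, for arbitrary finite combinations because that is how `jacobi` meets it:
  -- row i of a product N·M is a combination of the rows of M.
  det-row-sum : ∀ {n m} (M : Matrix n) i (a : Vector Carrier m) (N : Fin m → Vector Carrier n) →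
                det (M [ i ≔ (λ k → sum λ l → a l * N l k) ]) ≈ sum (λ l → a l * det (M [ i ≔ N l ]))
  det-row-sum {suc n} {m} M zero a N = begin
    sum (λ j → sign (toℕ j) * sum (λ l → a l * N l j) * D j)
      ≈⟨ sum-cong-≋ (λ j → trans (*-congʳ (*-distribˡ-sum (sign (toℕ j)) (λ l → a l * N l j)))
           (trans (*-distribʳ-sum (D j) (λ l → sign (toℕ j) * (a l * N l j))) (sum-cong-≋ λ l →
             solve 4 (λ s x y d → s :* (x :* y) :* d := x :* (s :* y :* d)) refl
               (sign (toℕ j)) (a l) (N l j) (D j)))) ⟩
    sum (λ j → sum λ l → a l * (sign (toℕ j) * N l j * D j))
      ≈⟨ ∑-comm (λ j l → a l * (sign (toℕ j) * N l j * D j)) ⟩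
    sum (λ l → sum λ j → a l * (sign (toℕ j) * N l j * D j))
      ≈⟨ sum-cong-≋ (λ l → *-distribˡ-sum (a l) (λ j → sign (toℕ j) * N l j * D j)) ⟨
    sum (λ l → a l * sum λ j → sign (toℕ j) * N l j * D j) ∎
    where
    D : Fin (suc n) → Carrier
    D j = det (minor M j)
  det-row-sum {suc n} {m} M (suc i) a N = begin
    sum (λ j → w j * det (minor (M [ suc i ≔ r ]) j))
      ≈⟨ sum-cong-≋ (λ j → *-congˡ {w j} (trans (minor-≔ M i r j)
           (det-row-sum (minor M j) i a (λ l → N l ∘ punchIn j)))) ⟩
    sum (λ j → w j * sum λ l → a l * D l j)
      ≈⟨ sum-cong-≋ (λ j → trans (*-distribˡ-sum (w j) (λ l → a l * D l j)) (sum-cong-≋ λ l →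
           solve 3 (λ s x d → s :* (x :* d) := x :* (s :* d)) refl (w j) (a l) (D l j))) ⟩
    sum (λ j → sum λ l → a l * (w j * D l j))
      ≈⟨ ∑-comm (λ j l → a l * (w j * D l j)) ⟩
    sum (λ l → sum λ j → a l * (w j * D l j))
      ≈⟨ sum-cong-≋ (λ l → trans (sum-cong-≋ λ j → *-congˡ {a l} (*-congˡ {w j} (sym (minor-≔ M i (N l) j))))
           (sym (*-distribˡ-sum (a l) (λ j → w j * det (minor (M [ suc i ≔ N l ]) j))))) ⟩
    sum (λ l → a l * sum λ j → w j * det (minor (M [ suc i ≔ N l ]) j)) ∎
    where
    r : Vector Carrier (suc n)
    r k = sum λ l → a l * N l k
    w : Fin (suc n) → Carrier
    w j = sign (toℕ j) * M zero j
    D : Fin m → Fin (suc n) → Carrier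
    D l j = det (minor M j [ i ≔ N l ∘ punchIn j ])

  det-row-+ : ∀ {n} (M : Matrix n) i (r r′ : Vector Carrier n) →
              det (M [ i ≔ (λ k → r k + r′ k) ]) ≈ det (M [ i ≔ r ]) + det (M [ i ≔ r′ ])
  det-row-+ {n} M i r r′ = begin
    det (M [ i ≔ (λ k → r k + r′ k) ])
      ≈⟨ det-cong (≔-cong M i λ k → unit (r k) (r′ k)) ⟩
    det (M [ i ≔ (λ k → sum λ l → 1# * N l k) ])
      ≈⟨ det-row-sum M i (λ _ → 1#) N ⟩
    sum (λ l → 1# * det (M [ i ≔ N l ]))
      ≈⟨ unit (det (M [ i ≔ r ])) (det (M [ i ≔ r′ ])) ⟨
    det (M [ i ≔ r ]) + det (M [ i ≔ r′ ]) ∎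
    where
    N : Fin 2 → Vector Carrier n
    N zero    = r
    N (suc _) = r′
    unit : ∀ x y → x + y ≈ 1# * x + (1# * y + 0#)
    unit = solve 2 (λ x y → x :+ y := con 1 :* x :+ (con 1 :* y :+ con 0)) refl

  -- In the double expansion along two equal rows a, the columns {j, k} occur
  -- twice, with opposite signs; D stands for the minor on the other columns.
  doubleExpansion : ∀ m (a : Vector Carrier (suc (suc m))) (D : (Fin m → Fin (suc (suc m))) → Carrier) →
                    (∀ {e e′} → (∀ x → e x ≡ e′ x) → D e ≈ D e′) →
                    sum (λ j → sum λ k → (sign (toℕ j) * a j) *
                      ((sign (toℕ k) * a (punchIn j k)) * D (punchIn j ∘ punchIn k))) ≈ 0#
  doubleExpansion m a D resp = begin
    sum (λ k → 1# * a zero * (sign (toℕ k) * a (suc k) * D (suc ∘ punchIn k)))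
      + sum (λ j → corner j + rest j)
      ≈⟨ trans (+-congˡ (∑-distrib-+ corner rest)) (sym (+-assoc _ _ _)) ⟩
    sum (λ k → 1# * a zero * (sign (toℕ k) * a (suc k) * D (suc ∘ punchIn k))) + sum corner + sum rest
      ≈⟨ +-congʳ (∑-distrib-+ (λ k → 1# * a zero * (sign (toℕ k) * a (suc k) * D (suc ∘ punchIn k))) corner) ⟨
    sum (λ k → 1# * a zero * (sign (toℕ k) * a (suc k) * D (suc ∘ punchIn k)) + corner k) + sum rest
      ≈⟨ +-cong (sum-zero cancel) (tail m a D resp) ⟩
    0# + 0# ≈⟨ +-identityʳ 0# ⟩
    0# ∎
    where
    -- `corner` takes column `suc j` from the first row and column `zero` from the second, so its
    -- terms cancel the first sum one by one. `rest` avoids column `zero` in both rows and is a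
    -- double expansion on one column fewer.
    corner rest : Fin (suc m) → Carrier
    corner j = sign (suc (toℕ j)) * a (suc j) * (1# * a zero * D (suc ∘ punchIn j))
    rest j = sum λ k → sign (suc (toℕ j)) * a (suc j) *
      (sign (suc (toℕ k)) * a (suc (punchIn j k)) * D (punchIn (suc j) ∘ punchIn (suc k)))
    cancel : ∀ k → 1# * a zero * (sign (toℕ k) * a (suc k) * D (suc ∘ punchIn k)) + corner k ≈ 0#
    cancel k = begin
      1# * a zero * (sign (toℕ k) * a (suc k) * d) + (- 1#) * sign (toℕ k) * a (suc k) * (1# * a zero * d)
        ≈⟨ solve 5 (λ m x s y d → con 1 :* x :* (s :* y :* d) :+ m :* s :* y :* (con 1 :* x :* d)
                     := (con 1 :+ m) :* (x :* s :* y :* d)) refl (- 1#) (a zero) (sign (toℕ k)) (a (suc k)) d ⟩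
      (1# + - 1#) * (a zero * sign (toℕ k) * a (suc k) * d) ≈⟨ *-congʳ (-‿inverseʳ 1#) ⟩
      0# * (a zero * sign (toℕ k) * a (suc k) * d)          ≈⟨ zeroˡ _ ⟩
      0# ∎
      where d = D (suc ∘ punchIn k)
    tail : ∀ m (a : Vector Carrier (suc (suc m))) (D : (Fin m → Fin (suc (suc m))) → Carrier) →
           (∀ {e e′} → (∀ x → e x ≡ e′ x) → D e ≈ D e′) →
           sum {suc m} (λ j → sum λ k → sign (suc (toℕ j)) * a (suc j) *
             (sign (suc (toℕ k)) * a (suc (punchIn j k)) * D (punchIn (suc j) ∘ punchIn (suc k)))) ≈ 0#
    tail zero    a D resp = sum-zero {1} λ _ → refl
    tail (suc m) a D resp = begin
      sum (λ j → sum λ k → sign (suc (toℕ j)) * a (suc j) *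
        (sign (suc (toℕ k)) * a (suc (punchIn j k)) * D (punchIn (suc j) ∘ punchIn (suc k))))
        ≈⟨ sum-cong-≋ (λ j → sum-cong-≋ λ k → trans
             (solve 6 (λ m s x t y d → m :* s :* x :* (m :* t :* y :* d) := m :* m :* (s :* x :* (t :* y :* d)))
               refl (- 1#) (sign (toℕ j)) (a (suc j)) (sign (toℕ k)) (a (suc (punchIn j k))) _)
             (*-congˡ (*-congˡ (*-congˡ (resp {punchIn (suc j) ∘ punchIn (suc k)} {lift (punchIn j ∘ punchIn k)}
               λ { zero → ≡.refl ; (suc x) → ≡.refl }))))) ⟩
      sum (λ j → sum λ k → u * F j k) ≈⟨ sum-cong-≋ (λ j → *-distribˡ-sum u (F j)) ⟨
      sum (λ j → u * sum (F j))       ≈⟨ *-distribˡ-sum u (λ j → sum (F j)) ⟨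
      u * sum (λ j → sum (F j))
        ≈⟨ *-congˡ (doubleExpansion m (a ∘ suc) (D ∘ lift) λ eq → resp λ
             { zero → ≡.refl ; (suc x) → ≡.cong suc (eq x) }) ⟩
      u * 0#                          ≈⟨ zeroʳ u ⟩
      0# ∎
      where
      -- Both signs shift by one, whence the factor `u`. Column `zero` survives in every remaining
      -- minor, and `lift` puts it back.
      u = (- 1#) * (- 1#)
      lift : (Fin m → Fin (suc (suc m))) → Fin (suc m) → Fin (suc (suc (suc m)))
      lift e zero    = zero
      lift e (suc x) = suc (e x)
      F : Fin (suc (suc m)) → Fin (suc m) → Carrier
      F j k = sign (toℕ j) * a (suc j) * (sign (toℕ k) * a (suc (punchIn j k)) * D (lift (punchIn j ∘ punchIn k)))

  det-rows01 : ∀ {n} (M : Matrix (suc (suc n))) → (∀ k → M zero k ≈ M (suc zero) k) → det M ≈ 0#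
  det-rows01 {n} M eq = begin
    det M
      ≈⟨ sum-cong-≋ (λ j → *-distribˡ-sum (sign (toℕ j) * M zero j) (λ k →
           sign (toℕ k) * M (suc zero) (punchIn j k) * D (punchIn j ∘ punchIn k))) ⟩
    sum (λ j → sum λ k → sign (toℕ j) * M zero j *
      (sign (toℕ k) * M (suc zero) (punchIn j k) * D (punchIn j ∘ punchIn k)))
      ≈⟨ sum-cong-≋ (λ j → sum-cong-≋ λ k → *-congˡ {sign (toℕ j) * M zero j}
           (*-congʳ {D (punchIn j ∘ punchIn k)} (*-congˡ {sign (toℕ k)} (eq (punchIn j k))))) ⟨
    sum (λ j → sum λ k → sign (toℕ j) * M zero j *
      (sign (toℕ k) * M zero (punchIn j k) * D (punchIn j ∘ punchIn k)))
      ≈⟨ doubleExpansion n (M zero) D (λ eq → det-cong λ x y →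
           reflexive (≡.cong (M (suc (suc x))) (eq y))) ⟩
    0# ∎
    where
    D : (Fin n → Fin (suc (suc n))) → Carrier
    D e = det λ x y → M (suc (suc x)) (e y)

  Alternating : ℕ → Set _
  Alternating n = ∀ (M : Matrix n) i j → i ≢ j → (∀ k → M i k ≈ M j k) → det M ≈ 0#

  -- Every minor along the top row still contains the two equal rows.
  alternating-lower : ∀ {n} → Alternating n → ∀ (M : Matrix (suc n)) i j → i ≢ j →
                      (∀ k → M (suc i) k ≈ M (suc j) k) → det M ≈ 0#
  alternating-lower alt M i j i≢j eq = sum-zero λ k →
    trans (*-congˡ {sign (toℕ k) * M zero k} (alt (minor M k) i j i≢j (eq ∘ punchIn k))) (zeroʳ _)

  -- Alternation below the top row makes det antisymmetric in rows 1 and j,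
  -- so that a row j equal to row 0 can be moved next to it.
  alternating-top : ∀ {n} → Alternating n → ∀ (M : Matrix (suc n)) j →
                    (∀ k → M zero k ≈ M (suc j) k) → det M ≈ 0#
  alternating-top {suc n} alt M zero    eq = det-rows01 M eq
  alternating-top {suc n} alt M (suc j) eq = begin
    det M                       ≈⟨ det-cong (λ x k → reflexive (≡.cong (λ row → row k) (same x))) ⟨
    det (X a b)                 ≈⟨ +-identityʳ _ ⟨
    det (X a b) + 0#            ≈⟨ +-congˡ (det-rows01 (X b a) eq) ⟨
    det (X a b) + det (X b a)   ≈⟨ antisymmetric ⟩
    0# ∎
    where
    a = M (suc zero)
    b = M (suc (suc j))
    a+b : Vector Carrier (suc (suc n))
    a+b k = a k + b k
    X : Vector Carrier (suc (suc n)) → Vector Carrier (suc (suc n)) → Matrix (suc (suc n))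
    X r r′ = M [ suc zero ≔ r ] [ suc (suc j) ≔ r′ ]
    same : ∀ x → X a b x ≡ M x
    same zero          = ≡.refl
    same (suc zero)    = ≡.refl
    same (suc (suc x)) = ≔-id (λ y → M (suc (suc y))) j x
    equal-rows : ∀ r → det (X r r) ≈ 0#
    equal-rows r = alternating-lower alt (X r r) zero (suc j) (λ ()) λ k →
      reflexive (≡.cong (λ row → row k) (≡.sym (≔-same (λ y → M (suc (suc y))) j r)))
    additiveʳ : ∀ r → det (X r a+b) ≈ det (X r a) + det (X r b)
    additiveʳ r = det-row-+ (M [ suc zero ≔ r ]) (suc (suc j)) a b
    swap : ∀ r r′ x → X r r′ x ≡ (M [ suc (suc j) ≔ r′ ] [ suc zero ≔ r ]) x
    swap r r′ zero          = ≡.refl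
    swap r r′ (suc zero)    = ≡.refl
    swap r r′ (suc (suc x)) = ≡.refl
    det-swap : ∀ r r′ → det (X r r′) ≈ det (M [ suc (suc j) ≔ r′ ] [ suc zero ≔ r ])
    det-swap r r′ = det-cong λ x k → reflexive (≡.cong (λ row → row k) (swap r r′ x))
    additiveˡ : ∀ r′ → det (X a+b r′) ≈ det (X a r′) + det (X b r′)
    additiveˡ r′ = trans (det-swap a+b r′) (trans (det-row-+ (M [ suc (suc j) ≔ r′ ]) (suc zero) a b)
      (+-cong (sym (det-swap a r′)) (sym (det-swap b r′))))
    -- Polarisation: the vanishing `det (X a+b a+b)` is expanded in both rows.
    antisymmetric : det (X a b) + det (X b a) ≈ 0#
    antisymmetric = begin
      det (X a b) + det (X b a)
        ≈⟨ +-cong (+-identityˡ _) (+-identityʳ _) ⟨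
      (0# + det (X a b)) + (det (X b a) + 0#)
        ≈⟨ +-cong (+-congʳ (equal-rows a)) (+-congˡ (equal-rows b)) ⟨
      (det (X a a) + det (X a b)) + (det (X b a) + det (X b b))
        ≈⟨ +-cong (additiveʳ a) (additiveʳ b) ⟨
      det (X a a+b) + det (X b a+b)
        ≈⟨ additiveˡ a+b ⟨
      det (X a+b a+b)
        ≈⟨ equal-rows a+b ⟩
      0# ∎

  det-alternating : ∀ n → Alternating n
  det-alternating (suc n) M zero    zero    i≢j eq = contradiction ≡.refl i≢j
  det-alternating (suc n) M zero    (suc j) i≢j eq = alternating-top (det-alternating n) M j eq
  det-alternating (suc n) M (suc i) zero    i≢j eq = alternating-top (det-alternating n) M i (sym ∘ eq)
  det-alternating (suc n) M (suc i) (suc j) i≢j eq =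
    alternating-lower (det-alternating n) M i j (i≢j ∘ ≡.cong suc) eq

  -- Derivations of the ring and Jacobi's formula

  record IsDerivation (δ : Carrier → Carrier) : Set (c ⊔ ℓ) where
    field
      δ-+    : ∀ x y → δ (x + y) ≈ δ x + δ y
      δ-*    : ∀ x y → δ (x * y) ≈ δ x * y + x * δ y
      δ-0    : δ 0# ≈ 0#
      δ-1    : δ 1# ≈ 0#
      δ-neg1 : δ (- 1#) ≈ 0#

    δ-sum : ∀ {n} (f : Vector Carrier n) → δ (sum f) ≈ sum (δ ∘ f)
    δ-sum {zero}  f = δ-0
    δ-sum {suc n} f = trans (δ-+ _ _) (+-congˡ (δ-sum (f ∘ suc)))

    δ-sign : ∀ j → δ (sign j) ≈ 0#
    δ-sign zero    = δ-1
    δ-sign (suc j) = begin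
      δ ((- 1#) * sign j)                  ≈⟨ δ-* _ _ ⟩
      δ (- 1#) * sign j + (- 1#) * δ (sign j) ≈⟨ +-cong (trans (*-congʳ δ-neg1) (zeroˡ _)) (trans (*-congˡ
            (δ-sign j)) (zeroʳ _)) ⟩
      0# + 0#                              ≈⟨ +-identityʳ 0# ⟩
      0# ∎

    δ-det : ∀ {n} (M : Matrix n) → δ (det M) ≈ sum λ i → det (M [ i ≔ δ ∘ M i ])
    δ-det {zero}  M = δ-1
    δ-det {suc n} M = begin
      δ (det M)
        ≈⟨ δ-sum (λ j → s j * M zero j * D j) ⟩
      sum (λ j → δ (s j * M zero j * D j))
        ≈⟨ sum-cong-≋ (λ j → leibniz j) ⟩
      sum (λ j → s j * δ (M zero j) * D j + s j * M zero j * δ (D j))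
        ≈⟨ ∑-distrib-+ (λ j → s j * δ (M zero j) * D j) (λ j → s j * M zero j * δ (D j)) ⟩
      det (M [ zero ≔ δ ∘ M zero ]) + sum (λ j → s j * M zero j * δ (D j))
        ≈⟨ +-congˡ (sum-cong-≋ λ j → trans (*-congˡ (δ-det (minor M j)))
             (*-distribˡ-sum (s j * M zero j) (λ i → det (minor M j [ i ≔ δ ∘ minor M j i ])))) ⟩
      det (M [ zero ≔ δ ∘ M zero ])
        + sum (λ j → sum λ i → s j * M zero j * det (minor M j [ i ≔ δ ∘ minor M j i ]))
        ≈⟨ +-congˡ (∑-comm (λ j i → s j * M zero j * det (minor M j [ i ≔ δ ∘ minor M j i ]))) ⟩
      det (M [ zero ≔ δ ∘ M zero ])
        + sum (λ i → sum λ j → s j * M zero j * det (minor M j [ i ≔ δ ∘ minor M j i ]))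
        ≈⟨ +-congˡ (sum-cong-≋ λ i → sum-cong-≋ λ j → *-congˡ {s j * M zero j} (minor-≔ M i (δ ∘ M (suc i)) j)) ⟨
      det (M [ zero ≔ δ ∘ M zero ]) + sum (λ i → det (M [ suc i ≔ δ ∘ M (suc i) ])) ∎
      where
      s : Fin (suc n) → Carrier
      s = sign ∘ toℕ
      D : Fin (suc n) → Carrier
      D j = det (minor M j)
      leibniz : ∀ j → δ (s j * M zero j * D j) ≈ s j * δ (M zero j) * D j + s j * M zero j * δ (D j)
      leibniz j = trans (δ-* _ _) (+-congʳ (*-congʳ (trans (δ-* _ _)
        (trans (+-congʳ (trans (*-congʳ (δ-sign (toℕ j))) (zeroˡ _))) (+-identityˡ _)))))

    -- `N` plays the part of δM·M⁻¹, so neither inverse nor adjugate occurs. After `δ-det`, row i is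
    -- a combination of the rows of `M`; all of them but row i itself repeat another row of the
    -- matrix and contribute 0.
    jacobi : ∀ {n} (M N : Matrix n) → (∀ i k → δ (M i k) ≈ sum λ l → N i l * M l k) →
                  δ (det M) ≈ sum (λ i → N i i) * det M
    jacobi {n} M N eq = begin
      δ (det M)                              ≈⟨ δ-det M ⟩
      sum (λ i → det (M [ i ≔ δ ∘ M i ]))    ≈⟨ sum-cong-≋ diagonal ⟩
      sum (λ i → N i i * det M)              ≈⟨ *-distribʳ-sum (det M) (λ i → N i i) ⟨
      sum (λ i → N i i) * det M ∎
      where
      diagonal : ∀ i → det (M [ i ≔ δ ∘ M i ]) ≈ N i i * det M
      diagonal i = begin
        det (M [ i ≔ δ ∘ M i ])                      ≈⟨ det-cong (≔-cong M i (eq i)) ⟩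
        det (M [ i ≔ (λ k → sum λ l → N i l * M l k) ]) ≈⟨ det-row-sum M i (N i) M ⟩
        sum (λ l → N i l * det (M [ i ≔ M l ]))      ≈⟨ sum-single i (λ l l≢i → trans (*-congˡ (off l l≢i)) (zeroʳ _)) ⟩
        N i i * det (M [ i ≔ M i ])                  ≈⟨ *-congˡ (det-cong λ x k → reflexive (≡.cong (λ row → row k)
              (≔-id M i x))) ⟩
        N i i * det M ∎
        where
        off : ∀ l → l ≢ i → det (M [ i ≔ M l ]) ≈ 0#
        off l l≢i = det-alternating n (M [ i ≔ M l ]) i l (≡.≢-sym l≢i) λ k →
          reflexive (≡.cong (λ row → row k)
            (≡.trans (≔-same M i (M l)) (≡.sym (≔-other M (M l) l≢i))))

-- Power series

open ≡ using (refl; sym; trans)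

ℤ-ring : CommutativeRing 0ℓ 0ℓ
ℤ-ring = ℤ.+-*-commutativeRing

+-congˡ : ∀ a {b c} → b ≡ c → a ℤ.+ b ≡ a ℤ.+ c
+-congˡ a = cong (λ x → a ℤ.+ x)

module Series where
  open import Data.Integer.Base using (_+_; _*_; -_)
  open ≡-Reasoning

  Series : Set
  Series = ℕ → ℤ

  infix 4 _≋_
  infixl 6 _⊕_
  infixl 7 _⊛_

  _≋_ : Series → Series → Set
  f ≋ g = ∀ n → f n ≡ g n

  tail : Series → Series
  tail f = f ∘ suc

  const : ℤ → Series
  const c zero    = c
  const c (suc n) = 0ℤ

  -- The Cauchy product, from f = f₀ + t · `tail f`; inductions on products therefore run along the
  -- left factor.
  _⊕_ _⊛_ : Series → Series → Series
  (f ⊕ g) n       = f n + g n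
  (f ⊛ g) zero    = f zero * g zero
  (f ⊛ g) (suc n) = f zero * g (suc n) + (tail f ⊛ g) n

  ⊛-cong : ∀ {f f′ g g′} → f ≋ f′ → g ≋ g′ → f ⊛ g ≋ f′ ⊛ g′
  ⊛-cong p q zero    = cong₂ _*_ (p zero) (q zero)
  ⊛-cong p q (suc n) = cong₂ _+_ (cong₂ _*_ (p zero) (q (suc n))) (⊛-cong (p ∘ suc) q n)

  ⊛-zeroˡ : ∀ f → (λ _ → 0ℤ) ⊛ f ≋ λ _ → 0ℤ
  ⊛-zeroˡ f zero    = refl
  ⊛-zeroˡ f (suc n) = trans (ℤ.+-identityˡ _) (⊛-zeroˡ f n)

  const-⊛ : ∀ c f → const c ⊛ f ≋ λ n → c * f n
  const-⊛ c f zero    = refl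
  const-⊛ c f (suc n) = trans (+-congˡ (c * f (suc n)) (⊛-zeroˡ f n)) (ℤ.+-identityʳ _)

  ⊛-identityˡ : ∀ f → const 1ℤ ⊛ f ≋ f
  ⊛-identityˡ f n = trans (const-⊛ 1ℤ f n) (ℤ.*-identityˡ (f n))

  ⊛-distribʳ : ∀ h f g → (f ⊕ g) ⊛ h ≋ (f ⊛ h) ⊕ (g ⊛ h)
  ⊛-distribʳ h f g zero    = ℤ.*-distribʳ-+ (h zero) (f zero) (g zero)
  ⊛-distribʳ h f g (suc n) = trans (+-congˡ ((f zero + g zero) * h (suc n)) (⊛-distribʳ h (tail f) (tail g) n))
    (lemma (f zero) (g zero) (h (suc n)) _ _)
    where
    lemma : ∀ a b c x y → (a + b) * c + (x + y) ≡ a * c + x + (b * c + y)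
    lemma = solve-∀

  ⊛-scale : ∀ c f g → (λ n → c * f n) ⊛ g ≋ λ n → c * (f ⊛ g) n
  ⊛-scale c f g zero    = ℤ.*-assoc c (f zero) (g zero)
  ⊛-scale c f g (suc n) = trans (+-congˡ (c * f zero * g (suc n)) (⊛-scale c (tail f) g n)) (lemma c (f zero) (g (suc n)) _)
    where
    lemma : ∀ c a b x → c * a * b + c * x ≡ c * (a * b + x)
    lemma = solve-∀

  ⊛-assoc : ∀ f g h → (f ⊛ g) ⊛ h ≋ f ⊛ (g ⊛ h)
  ⊛-assoc f g h zero    = ℤ.*-assoc (f zero) (g zero) (h zero)
  ⊛-assoc f g h (suc n) = begin
    f zero * g zero * h (suc n) + (tail (f ⊛ g) ⊛ h) n
      ≡⟨ +-congˡ (f zero * g zero * h (suc n)) (⊛-distribʳ h (λ k → f zero * g (suc k)) (tail f ⊛ g) n) ⟩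
    f zero * g zero * h (suc n) + (((λ k → f zero * g (suc k)) ⊛ h) n + ((tail f ⊛ g) ⊛ h) n)
      ≡⟨ +-congˡ (f zero * g zero * h (suc n)) (cong₂ _+_ (⊛-scale (f zero) (tail g) h n) (⊛-assoc (tail f) g h n)) ⟩
    f zero * g zero * h (suc n) + (f zero * (tail g ⊛ h) n + (tail f ⊛ (g ⊛ h)) n)
      ≡⟨ lemma (f zero) (g zero) (h (suc n)) _ _ ⟩
    f zero * (g zero * h (suc n) + (tail g ⊛ h) n) + (tail f ⊛ (g ⊛ h)) n ∎
    where
    lemma : ∀ a b c x y → a * b * c + (a * x + y) ≡ a * (b * c + x) + y
    lemma = solve-∀

  -- The definition unfolds the left factor only; with the right factor unfolded as well,
  -- commutativity follows by induction.
  ⊛-unfoldʳ : ∀ f g n → (f ⊛ g) (suc n) ≡ (f ⊛ tail g) n + f (suc n) * g zero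
  ⊛-unfoldʳ f g zero    = refl
  ⊛-unfoldʳ f g (suc n) = trans (+-congˡ (f zero * g (suc (suc n))) (⊛-unfoldʳ (tail f) g n)) (sym (ℤ.+-assoc
        (f zero * g (suc (suc n))) _ _))

  ⊛-comm : ∀ f g → f ⊛ g ≋ g ⊛ f
  ⊛-comm f g zero    = ℤ.*-comm (f zero) (g zero)
  ⊛-comm f g (suc n) = begin
    f zero * g (suc n) + (tail f ⊛ g) n ≡⟨ cong₂ _+_ (ℤ.*-comm (f zero) _) (⊛-comm (tail f) g n) ⟩
    g (suc n) * f zero + (g ⊛ tail f) n ≡⟨ ℤ.+-comm (g (suc n) * f zero) _ ⟩
    (g ⊛ tail f) n + g (suc n) * f zero ≡⟨ ⊛-unfoldʳ g f n ⟨
    (g ⊛ f) (suc n) ∎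

  Series-ring : CommutativeRing 0ℓ 0ℓ
  Series-ring = record
    { Carrier = Series ; _≈_ = _≋_ ; _+_ = _⊕_ ; _*_ = _⊛_ ; -_ = λ f n → - f n
    ; 0# = λ _ → 0ℤ ; 1# = const 1ℤ
    ; isCommutativeRing = record
      { isRing = record
        { +-isAbelianGroup = record
          { isGroup = record
            { isMonoid = record
              { isSemigroup = record
                { isMagma = record
                  { isEquivalence = record
                    { refl = λ _ → refl ; sym = λ p n → sym (p n) ; trans = λ p q n → trans (p n) (q n) }
                  ; ∙-cong = λ p q n → cong₂ _+_ (p n) (q n) }
                ; assoc = λ f g h n → ℤ.+-assoc (f n) (g n) (h n) }
              ; identity = (λ f n → ℤ.+-identityˡ (f n)) , (λ f n → ℤ.+-identityʳ (f n)) }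
            ; inverse = (λ f n → ℤ.+-inverseˡ (f n)) , (λ f n → ℤ.+-inverseʳ (f n))
            ; ⁻¹-cong = λ p n → cong -_ (p n) }
          ; comm = λ f g n → ℤ.+-comm (f n) (g n) }
        ; *-cong = ⊛-cong
        ; *-assoc = ⊛-assoc
        ; *-identity = ⊛-identityˡ , λ f n → trans (⊛-comm f (const 1ℤ) n) (⊛-identityˡ f n)
        ; distrib = (λ f g h n → trans (⊛-comm f (g ⊕ h) n)
                      (trans (⊛-distribʳ f g h n) (cong₂ _+_ (⊛-comm g f n) (⊛-comm h f n))))
                    , ⊛-distribʳ }
      ; *-comm = ⊛-comm } }

  ⊛-cancelʳ : ∀ f g → g zero ≡ 1ℤ → f ⊛ g ≋ (λ _ → 0ℤ) → f ≋ λ _ → 0ℤ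
  ⊛-cancelʳ f g g0 fg n = go n f fg
    where
    head-zero : ∀ f → f ⊛ g ≋ (λ _ → 0ℤ) → f zero ≡ 0ℤ
    head-zero f fg = trans (sym (ℤ.*-identityʳ (f zero))) (trans (cong (f zero *_) (sym g0)) (fg zero))
    go : ∀ n f → f ⊛ g ≋ (λ _ → 0ℤ) → f n ≡ 0ℤ
    go zero    f fg = head-zero f fg
    go (suc n) f fg = go n (tail f) λ m → begin
      (tail f ⊛ g) m                      ≡⟨ ℤ.+-identityˡ _ ⟨
      0ℤ * g (suc m) + (tail f ⊛ g) m     ≡⟨ cong (λ a → a * g (suc m) + (tail f ⊛ g) m) (head-zero f fg) ⟨
      (f ⊛ g) (suc m)                     ≡⟨ fg (suc m) ⟩
      0ℤ ∎

  -- t·d/dt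
  θ : Series → Series
  θ f n = + n * f n

  -- The product rule for t·d/dt. In the induction the index shift appears as `tail (θ f)` =
  -- `tail f` ⊕ `θ (tail f)`, which is `lemma₃`.
  θ-⊛ : ∀ f g → θ (f ⊛ g) ≋ (θ f ⊛ g) ⊕ (f ⊛ θ g)
  θ-⊛ f g zero    = lemma (f zero) (g zero)
    where
    lemma : ∀ a b → 0ℤ * (a * b) ≡ 0ℤ * a * b + a * (0ℤ * b)
    lemma = solve-∀
  θ-⊛ f g (suc n) = begin
    (1ℤ + + n) * (f zero * g (suc n) + (tail f ⊛ g) n)
      ≡⟨ lemma₁ (+ n) (f zero) (g (suc n)) _ ⟩
    (1ℤ + + n) * (f zero * g (suc n)) + (tail f ⊛ g) n + + n * (tail f ⊛ g) n
      ≡⟨ +-congˡ ((1ℤ + + n) * (f zero * g (suc n)) + (tail f ⊛ g) n) (θ-⊛ (tail f) g n) ⟩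
    (1ℤ + + n) * (f zero * g (suc n)) + (tail f ⊛ g) n + ((θ (tail f) ⊛ g) n + (tail f ⊛ θ g) n)
      ≡⟨ lemma₂ (+ n) (f zero) (g (suc n)) _ _ _ ⟩
    0ℤ * f zero * g (suc n) + ((tail f ⊛ g) n + (θ (tail f) ⊛ g) n) + (f zero * ((1ℤ + + n) * g (suc n)) + (tail f ⊛ θ g) n)
      ≡⟨ cong (λ x → 0ℤ * f zero * g (suc n) + x + (f zero * ((1ℤ + + n) * g (suc n)) + (tail f ⊛ θ g) n))
           (trans (sym (⊛-distribʳ g (tail f) (θ (tail f)) n))
                  (⊛-cong {g = g} (λ k → lemma₃ (+ k) (f (suc k))) (λ _ → refl) n)) ⟩
    (θ f ⊛ g) (suc n) + (f ⊛ θ g) (suc n) ∎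
    where
    lemma₁ : ∀ n a b x → (1ℤ + n) * (a * b + x) ≡ (1ℤ + n) * (a * b) + x + n * x
    lemma₁ = solve-∀
    lemma₂ : ∀ n a b x y z → (1ℤ + n) * (a * b) + x + (y + z) ≡ 0ℤ * a * b + (x + y) + (a * ((1ℤ + n) * b) + z)
    lemma₂ = solve-∀
    lemma₃ : ∀ k a → a + k * a ≡ (1ℤ + k) * a
    lemma₃ = solve-∀

  open Determinant Series-ring public using () renaming (module IsDerivation to IsDerivationˢ; sign to signˢ)
  open Determinant ℤ-ring using (sign)

  θ-isDerivation : Determinant.IsDerivation Series-ring θ
  θ-isDerivation = record
    { δ-+    = λ f g n → ℤ.*-distribˡ-+ (+ n) (f n) (g n)
    ; δ-*    = θ-⊛
    ; δ-0    = λ n → ℤ.*-zeroʳ (+ n)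
    ; δ-1    = λ { zero → refl ; (suc n) → ℤ.*-zeroʳ (+ suc n) }
    ; δ-neg1 = λ { zero → refl ; (suc n) → ℤ.*-zeroʳ (+ suc n) }
    }

  module Dˢ = Matrices (CommutativeRing.rawRing Series-ring)
  module Dᶻ = Matrices (CommutativeRing.rawRing ℤ-ring)
  module Sumˢ = SemiringSum (CommutativeRing.semiring Series-ring)
  module Sumᶻ = SemiringSum (CommutativeRing.semiring ℤ-ring)

  -- Polynomials among the power series and their values

  Degree≤ : ℕ → Series → Set
  Degree≤ n f = ∀ k → n < k → f k ≡ 0ℤ

  -- Σ fᵢ xᵐ⁻ⁱ, the homogenised value of a polynomial of degree at most m.
  eval : ℕ → ℤ → Series → ℤ
  eval zero    x f = f zero
  eval (suc m) x f = x * eval m x f + f (suc m)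

  sum-coeff : ∀ {n} (f : Vector Series n) k → Sumˢ.sum f k ≡ Sumᶻ.sum λ i → f i k
  sum-coeff {zero}  f k = refl
  sum-coeff {suc n} f k = +-congˡ (f zero k) (sum-coeff (f ∘ suc) k)

  eval-+ : ∀ m x f g → eval m x (f ⊕ g) ≡ eval m x f + eval m x g
  eval-+ zero    x f g = refl
  eval-+ (suc m) x f g = trans (cong (λ a → x * a + (f (suc m) + g (suc m))) (eval-+ m x f g))
    (lemma x (eval m x f) (eval m x g) (f (suc m)) (g (suc m)))
    where
    lemma : ∀ x a b c d → x * (a + b) + (c + d) ≡ x * a + c + (x * b + d)
    lemma = solve-∀

  eval-0 : ∀ m x → eval m x (λ _ → 0ℤ) ≡ 0ℤ
  eval-0 zero    x = refl
  eval-0 (suc m) x = trans (ℤ.+-identityʳ _) (trans (cong (x *_) (eval-0 m x)) (ℤ.*-zeroʳ x))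

  eval-sum : ∀ m x {n} (f : Vector Series n) → eval m x (Sumˢ.sum f) ≡ Sumᶻ.sum λ i → eval m x (f i)
  eval-sum m x {zero}  f = eval-0 m x
  eval-sum m x {suc n} f = trans (eval-+ m x (f zero) (Sumˢ.sum (f ∘ suc))) (+-congˡ (eval m x (f zero)) (eval-sum m x (f ∘ suc)))

  linear-⊛ : ∀ f g → Degree≤ 1 f → ∀ k → (f ⊛ g) (suc k) ≡ f zero * g (suc k) + f 1 * g k
  linear-⊛ f g d k = +-congˡ (f zero * g (suc k))
    (trans (⊛-cong {g = g} tail≋const (λ _ → refl) k) (const-⊛ (f 1) g k))
    where
    tail≋const : tail f ≋ const (f 1)
    tail≋const zero    = refl
    tail≋const (suc n) = d (suc (suc n)) (s≤s (s≤s z≤n))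

  degree-linear-⊛ : ∀ m f g → Degree≤ 1 f → Degree≤ m g → Degree≤ (suc m) (f ⊛ g)
  degree-linear-⊛ m f g d e (suc k) (s≤s m<k) = begin
    (f ⊛ g) (suc k)                ≡⟨ linear-⊛ f g d k ⟩
    f zero * g (suc k) + f 1 * g k ≡⟨ cong₂ (λ a b → f zero * a + f 1 * b) (e (suc k) (ℕ.m<n⇒m<1+n m<k)) (e k m<k) ⟩
    f zero * 0ℤ + f 1 * 0ℤ         ≡⟨ cong₂ _+_ (ℤ.*-zeroʳ (f zero)) (ℤ.*-zeroʳ (f 1)) ⟩
    0ℤ ∎

  -- `go` holds at every truncation. The degree bound on `g` serves at the end, to drop its
  -- coefficient at `suc m`, so that both values of `g` are taken at the same truncation.
  eval-linear-⊛ : ∀ m x f g → Degree≤ 1 f → Degree≤ m g →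
                  eval (suc m) x (f ⊛ g) ≡ (x * f zero + f 1) * eval m x g
  eval-linear-⊛ m x f g d e = trans (go m)
    (trans (cong (λ a → f zero * (x * eval m x g + a) + f 1 * eval m x g) (e (suc m) ℕ.≤-refl))
           (lemma (f zero) (f 1) x (eval m x g)))
    where
    lemma : ∀ a b x v → a * (x * v + 0ℤ) + b * v ≡ (x * a + b) * v
    lemma = solve-∀
    step₀ : ∀ a b x u v → x * (a * u) + (a * v + b * u) ≡ a * (x * u + v) + b * u
    step₀ = solve-∀
    step : ∀ a b x u v g₁ → x * (a * (x * u + g₁) + b * u) + (a * v + b * g₁) ≡
           a * (x * (x * u + g₁) + v) + b * (x * u + g₁)
    step = solve-∀
    go : ∀ k → eval (suc k) x (f ⊛ g) ≡ f zero * eval (suc k) x g + f 1 * eval k x g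
    go zero    = trans (+-congˡ (x * (f zero * g zero)) (linear-⊛ f g d 0)) (step₀ (f zero) (f 1) x (g zero) (g 1))
    go (suc k) = trans (cong₂ (λ a b → x * a + b) (go k) (linear-⊛ f g d (suc k)))
      (step (f zero) (f 1) x (eval k x g) (g (suc (suc k))) (g (suc k)))

  degree-sum : ∀ m {n} (f : Vector Series n) → (∀ i → Degree≤ m (f i)) → Degree≤ m (Sumˢ.sum f)
  degree-sum m {zero}  f d k m<k = refl
  degree-sum m {suc n} f d k m<k = cong₂ _+_ (d zero k m<k) (degree-sum m (f ∘ suc) (d ∘ suc) k m<k)

  signˢ-const : ∀ j → signˢ j ≋ const (sign j)
  signˢ-const zero    n       = refl
  signˢ-const (suc j) n = trans (⊛-cong {g = signˢ j} -1≋ (signˢ-const j) n)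
    (trans (const-⊛ -1ℤ (const (sign j)) n) (scaled n))
    where
    -1≋ : (λ n → - const 1ℤ n) ≋ const -1ℤ
    -1≋ zero    = refl
    -1≋ (suc n) = refl
    scaled : ∀ n → -1ℤ * const (sign j) n ≡ const (-1ℤ * sign j) n
    scaled zero    = refl
    scaled (suc n) = refl

  module _ (x : ℤ) where
    -- Degree and value are proved together, since evaluating a product at truncation `suc n`
    -- requires the bound n on each minor. For the entries of I - tS the right-hand side is det (xI
    -- - S).
    eval-det : ∀ {n} (M : Dˢ.Matrix n) → (∀ i j → Degree≤ 1 (M i j)) →
               Degree≤ n (Dˢ.det M) × eval n x (Dˢ.det M) ≡ Dᶻ.det (λ i j → x * M i j zero + M i j 1)
    eval-det {zero}  M d = (λ { (suc k) _ → refl }) , refl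
    eval-det {suc n} M d =
        degree-sum (suc n) term (λ j → degree-linear-⊛ n (head j) (rest j) (head-linear j) (proj₁ (ih j)))
      , trans (eval-sum (suc n) x term) (Sumᶻ.sum-cong-≗ λ j → begin
          eval (suc n) x (head j ⊛ rest j)
            ≡⟨ eval-linear-⊛ n x (head j) (rest j) (head-linear j) (proj₁ (ih j)) ⟩
          (x * head j zero + head j 1) * eval n x (rest j)
            ≡⟨ cong₂ _*_ (trans (cong₂ (λ a b → x * a + b) (head-coeff j 0) (head-coeff j 1))
                 (lemma x (sign (toℕ j)) (M zero j 0) (M zero j 1))) (proj₂ (ih j)) ⟩
          sign (toℕ j) * (x * M zero j 0 + M zero j 1) *
            Dᶻ.det (λ i k → x * M (suc i) (punchIn j k) 0 + M (suc i) (punchIn j k) 1) ∎)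
      where
      head rest term : Fin (suc n) → Series
      head j = signˢ (toℕ j) ⊛ M zero j
      rest j = Dˢ.det λ i k → M (suc i) (punchIn j k)
      term j = head j ⊛ rest j
      ih : ∀ j → Degree≤ n (rest j) × eval n x (rest j) ≡
             Dᶻ.det (λ i k → x * M (suc i) (punchIn j k) 0 + M (suc i) (punchIn j k) 1)
      ih j = eval-det (λ i k → M (suc i) (punchIn j k)) λ i k → d (suc i) (punchIn j k)
      head-coeff : ∀ j n → head j n ≡ sign (toℕ j) * M zero j n
      head-coeff j n = trans (⊛-cong {g = M zero j} (signˢ-const (toℕ j)) (λ _ → refl) n) (const-⊛ (sign (toℕ j)) (M zero j) n)
      head-linear : ∀ j → Degree≤ 1 (head j)
      head-linear j k 1<k = trans (head-coeff j k) (trans (cong (sign (toℕ j) *_) (d zero j k 1<k)) (ℤ.*-zeroʳ (sign (toℕ j))))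
      lemma : ∀ x s a b → x * (s * a) + s * b ≡ s * (x * a + b)
      lemma = solve-∀

  ∣all⇒0 : ∀ m → (∀ x → suc x ℕ.∣ m) → m ≡ 0
  ∣all⇒0 zero    _   = refl
  ∣all⇒0 (suc m) div = contradiction (ℕ.∣⇒≤ (div (suc m))) (ℕ.<⇒≱ ℕ.≤-refl)

  -- The last coefficient is divisible by every x.
  last-zero : ∀ m f → (∀ x → eval (suc m) (+ suc x) f ≡ 0ℤ) → f (suc m) ≡ 0ℤ
  last-zero m f ev = ℤ.∣i∣≡0⇒i≡0 (∣all⇒0 ℤ.∣ f (suc m) ∣ λ x → ℕ.divides ℤ.∣ eval m (+ suc x) f ∣ (begin
    ℤ.∣ f (suc m) ∣                    ≡⟨ ℤ.∣-i∣≡∣i∣ (f (suc m)) ⟨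
    ℤ.∣ - f (suc m) ∣                  ≡⟨ cong ℤ.∣_∣ (move (+ suc x * eval m (+ suc x) f) (f (suc m)) (ev x)) ⟨
    ℤ.∣ + suc x * eval m (+ suc x) f ∣ ≡⟨ ℤ.abs-* (+ suc x) (eval m (+ suc x) f) ⟩
    suc x ℕ.* ℤ.∣ eval m (+ suc x) f ∣ ≡⟨ ℕ.*-comm (suc x) _ ⟩
    ℤ.∣ eval m (+ suc x) f ∣ ℕ.* suc x ∎))
    where
    lemma : ∀ a b → a ≡ a + b + - b
    lemma = solve-∀
    move : ∀ a b → a + b ≡ 0ℤ → a ≡ - b
    move a b p = trans (lemma a b) (trans (cong (_+ - b) p) (ℤ.+-identityˡ (- b)))

  -- Once the last coefficient is gone, the value is x times the value one degree lower, and x is a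
  -- positive integer. Divisibility thus replaces the counting of roots.
  eval≡0⇒coeff≡0 : ∀ m f → (∀ x → eval m (+ suc x) f ≡ 0ℤ) → ∀ k → k ≤ m → f k ≡ 0ℤ
  eval≡0⇒coeff≡0 zero    f ev .zero z≤n = ev 0
  eval≡0⇒coeff≡0 (suc m) f ev k k≤1+m with ℕ.m≤n⇒m<n∨m≡n k≤1+m
  ... | inj₂ refl = last-zero m f ev
  ... | inj₁ (s≤s k≤m) = eval≡0⇒coeff≡0 m f earlier k k≤m
    where
    earlier : ∀ x → eval m (+ suc x) f ≡ 0ℤ
    earlier x with ℤ.i*j≡0⇒i≡0∨j≡0 (+ suc x) {eval m (+ suc x) f}
                     (trans (sym (ℤ.+-identityʳ _)) (trans (+-congˡ (+ suc x * eval m (+ suc x) f) (sym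
                           (last-zero m f ev))) (ev x)))
    ... | inj₂ p = p

-- The characteristic polynomial determines the power traces

module IntegerMatrices where
  open import Data.Integer.Base using (_+_; _*_; -_)
  open ≡-Reasoning
  open SemiringSum (CommutativeRing.semiring ℤ-ring) public
    using (sum; sum-cong-≗; ∑-distrib-+; ∑-comm; *-distribˡ-sum; *-distribʳ-sum)
  open Determinant ℤ-ring public using (sum-zero; sum-single)
  open Matrices (CommutativeRing.rawRing ℤ-ring) public using (Matrix; det; scalar; charPoly)

  neg-sum : ∀ {k} (f : Vector ℤ k) → sum (λ l → - f l) ≡ - sum f
  neg-sum {zero}  f = refl
  neg-sum {suc k} f = trans (+-congˡ (- f zero) (neg-sum (f ∘ suc))) (sym (ℤ.neg-distrib-+ (f zero) _))

  infixl 7 _·_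

  _·_ : ∀ {n} → Matrix n → Matrix n → Matrix n
  (M · N) i k = sum λ l → M i l * N l k

  I : ∀ {n} → Matrix n
  I = scalar 1ℤ

  I-diag : ∀ {n} (i : Fin n) → I i i ≡ 1ℤ
  I-diag i = cong (if_then 1ℤ else 0ℤ) (dec-true (i Fin.≟ i) refl)

  I-off : ∀ {n} {i j : Fin n} → i ≢ j → I i j ≡ 0ℤ
  I-off {i = i} {j} i≢j = cong (if_then 1ℤ else 0ℤ) (dec-false (i Fin.≟ j) i≢j)

  sum-Iˡ : ∀ {n} (f : Vector ℤ n) i → sum (λ l → I i l * f l) ≡ f i
  sum-Iˡ f i = trans (sum-single i λ l l≢i → cong (_* f l) (I-off (≡.≢-sym l≢i)))
    (trans (cong (_* f i) (I-diag i)) (ℤ.*-identityˡ (f i)))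

  sum-Iʳ : ∀ {n} (f : Vector ℤ n) i → sum (λ l → f l * I l i) ≡ f i
  sum-Iʳ f i = trans (sum-single i λ l l≢i → trans (cong (f l *_) (I-off l≢i)) (ℤ.*-zeroʳ (f l)))
    (trans (cong (f i *_) (I-diag i)) (ℤ.*-identityʳ (f i)))

  ·-assoc : ∀ {n} (L M N : Matrix n) i k → ((L · M) · N) i k ≡ (L · (M · N)) i k
  ·-assoc L M N i k = begin
    sum (λ b → sum (λ a → L i a * M a b) * N b k)
      ≡⟨ sum-cong-≗ (λ b → trans (*-distribʳ-sum (N b k) (λ a → L i a * M a b))
           (sum-cong-≗ λ a → ℤ.*-assoc (L i a) (M a b) (N b k))) ⟩
    sum (λ b → sum λ a → L i a * (M a b * N b k))
      ≡⟨ ∑-comm (λ b a → L i a * (M a b * N b k)) ⟩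
    sum (λ a → sum λ b → L i a * (M a b * N b k))
      ≡⟨ sum-cong-≗ (λ a → *-distribˡ-sum (L i a) (λ b → M a b * N b k)) ⟨
    sum (λ a → L i a * sum λ b → M a b * N b k) ∎

  pow : ∀ {n} → Matrix n → ℕ → Matrix n
  pow S zero    = I
  pow S (suc m) = S · pow S m

  trace : ∀ {n} → Matrix n → ℤ
  trace M = sum λ i → M i i

  pow-+ : ∀ {n} (S : Matrix n) a b i k → (pow S a · pow S b) i k ≡ pow S (a ℕ.+ b) i k
  pow-+ S zero    b i k = sum-Iˡ (λ l → pow S b l k) i
  pow-+ S (suc a) b i k = trans (·-assoc S (pow S a) (pow S b) i k)
    (sum-cong-≗ λ l → cong (S i l *_) (pow-+ S a b l k))

  pow-1 : ∀ {n} (S : Matrix n) i k → pow S 1 i k ≡ S i k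
  pow-1 S i k = sum-Iʳ (S i) k

  pow-sucʳ : ∀ {n} (S : Matrix n) m i k → (pow S m · S) i k ≡ pow S (suc m) i k
  pow-sucʳ S m i k = begin
    (pow S m · S) i k       ≡⟨ sum-cong-≗ (λ l → cong (pow S m i l *_) (pow-1 S l k)) ⟨
    (pow S m · pow S 1) i k ≡⟨ pow-+ S m 1 i k ⟩
    pow S (m ℕ.+ 1) i k     ≡⟨ cong (λ e → pow S e i k) (ℕ.+-comm m 1) ⟩
    pow S (suc m) i k ∎

  det-I : ∀ n → det (I {n}) ≡ 1ℤ
  det-I zero    = refl
  det-I (suc n) = trans (sum-single {f = term} zero λ { zero 0≢0 → contradiction refl 0≢0 ; (suc j) _ →
      trans (cong (_* D (suc j)) (ℤ.*-zeroʳ (Determinant.sign ℤ-ring (toℕ (suc j))))) refl })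
    (trans (ℤ.*-identityˡ _) (det-I n))
    where
    D term : Fin (suc n) → ℤ
    D j = det λ i k → I (suc i) (punchIn j k)
    term j = Determinant.sign ℤ-ring (toℕ j) * I zero j * D j

  module CharacteristicSeries {n} (S : Matrix n) where
    open Series

    entry : ℤ → ℤ → Series
    entry a b zero          = a
    entry a b (suc zero)    = b
    entry a b (suc (suc k)) = 0ℤ

    I-tS : Dˢ.Matrix n
    I-tS i j = entry (I i j) (- S i j)

    -- The reversed characteristic polynomial. Its constant term is 1, which allows cancellation,
    -- and `eval n x` turns it back into det (xI - S).
    series : Series
    series = Dˢ.det I-tS

    linear : ∀ i j → Degree≤ 1 (I-tS i j)
    linear i j (suc (suc k)) _ = refl
    linear i j (suc zero) (s≤s ())

    degree : Degree≤ n series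
    degree = proj₁ (eval-det 0ℤ I-tS linear)

    eval-series : ∀ x → eval n x series ≡ charPoly S x
    eval-series x = trans (proj₂ (eval-det x I-tS linear)) (Determinant.det-cong ℤ-ring λ i j → cong (_+ - S i j) (scale i j))
      where
      scale : ∀ i j → x * I i j ≡ scalar x i j
      scale i j with does (i Fin.≟ j)
      ... | true  = ℤ.*-identityʳ x
      ... | false = ℤ.*-zeroʳ x

    powerTraces : Series
    powerTraces zero    = 0ℤ
    powerTraces (suc m) = - trace (pow S (suc m))

    -- The geometric series of -tS(I - tS)⁻¹. Multiplied by I - tS it telescopes to -tS, which is
    -- `θ` applied to I - tS: the hypothesis of `jacobi`.
    logDerivative : Dˢ.Matrix n
    logDerivative i j zero    = 0ℤ
    logDerivative i j (suc m) = - pow S (suc m) i j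

    θ-I-tS : ∀ i k → θ (I-tS i k) ≋ Sumˢ.sum λ l → logDerivative i l ⊛ I-tS l k
    θ-I-tS i k m = sym (trans (sum-coeff (λ l → logDerivative i l ⊛ I-tS l k) m) (go m))
      where
      product : ∀ l m → (logDerivative i l ⊛ I-tS l k) (suc m) ≡ I l k * logDerivative i l (suc m) + - S l k * logDerivative i l m
      product l m = trans (⊛-comm (logDerivative i l) (I-tS l k) (suc m)) (linear-⊛ (I-tS l k) (logDerivative i l) (linear l k) m)
      go : ∀ m → sum (λ l → (logDerivative i l ⊛ I-tS l k) m) ≡ + m * I-tS i k m
      go zero = sum-zero {f = λ l → 0ℤ * I l k} λ l → refl
      go (suc m) = begin
        sum (λ l → (logDerivative i l ⊛ I-tS l k) (suc m))
          ≡⟨ sum-cong-≗ (λ l → product l m) ⟩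
        sum (λ l → I l k * - pow S (suc m) i l + - S l k * logDerivative i l m)
          ≡⟨ ∑-distrib-+ (λ l → I l k * - pow S (suc m) i l) (λ l → - S l k * logDerivative i l m) ⟩
        sum (λ l → I l k * - pow S (suc m) i l) + sum (λ l → - S l k * logDerivative i l m)
          ≡⟨ cong (_+ sum (λ l → - S l k * logDerivative i l m))
               (trans (sum-cong-≗ λ l → ℤ.*-comm (I l k) (- pow S (suc m) i l)) (sum-Iʳ (λ l → - pow S (suc m) i l) k)) ⟩
        - pow S (suc m) i k + sum (λ l → - S l k * logDerivative i l m)
          ≡⟨ rest m ⟩
        + suc m * I-tS i k (suc m) ∎
        where
        rest : ∀ m → - pow S (suc m) i k + sum (λ l → - S l k * logDerivative i l m) ≡ + suc m * I-tS i k (suc m)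
        rest zero = begin
          - pow S 1 i k + sum (λ l → - S l k * 0ℤ)
            ≡⟨ cong₂ (λ a b → - a + b) (pow-1 S i k) (sum-zero λ l → ℤ.*-zeroʳ (- S l k)) ⟩
          - S i k + 0ℤ   ≡⟨ ℤ.+-identityʳ (- S i k) ⟩
          - S i k        ≡⟨ ℤ.*-identityˡ (- S i k) ⟨
          1ℤ * - S i k ∎
        rest (suc m) = begin
          - pow S (suc (suc m)) i k + sum (λ l → - S l k * - pow S (suc m) i l)
            ≡⟨ +-congˡ (- pow S (suc (suc m)) i k) (trans (sum-cong-≗ λ l → lemma (S l k) (pow S (suc m) i l))
                  (pow-sucʳ S (suc m) i k)) ⟩
          - pow S (suc (suc m)) i k + pow S (suc (suc m)) i k
            ≡⟨ ℤ.+-inverseˡ (pow S (suc (suc m)) i k) ⟩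
          0ℤ
            ≡⟨ ℤ.*-zeroʳ (+ suc (suc m)) ⟨
          + suc (suc m) * 0ℤ ∎
          where
          lemma : ∀ a b → - a * - b ≡ b * a
          lemma = solve-∀

    sum-logDerivative : Sumˢ.sum (λ i → logDerivative i i) ≋ powerTraces
    sum-logDerivative zero    = trans (sum-coeff (λ i → logDerivative i i) 0) (sum-zero {n} λ _ → refl)
    sum-logDerivative (suc m) = trans (sum-coeff (λ i → logDerivative i i) (suc m)) (neg-sum (λ i → pow S (suc m) i i))

    θ-series : θ series ≋ powerTraces ⊛ series
    θ-series m = trans (IsDerivationˢ.jacobi θ-isDerivation I-tS logDerivative θ-I-tS m)
      (⊛-cong {g = series} sum-logDerivative (λ _ → refl) m)

    series-0 : series 0 ≡ 1ℤ
    series-0 = trans (constantTerm I-tS) (det-I n)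
      where
      constantTerm : ∀ {n} (M : Dˢ.Matrix n) → Dˢ.det M 0 ≡ det (λ i j → M i j 0)
      constantTerm {zero}  M = refl
      constantTerm {suc n} M = trans (sum-coeff (λ j → (signˢ (toℕ j) ⊛ M zero j) ⊛ Dˢ.det (λ i k → M (suc i) (punchIn j k))) 0)
        (sum-cong-≗ λ j → cong₂ (λ s d → s * M zero j 0 * d) (signˢ-const (toℕ j) 0)
          (constantTerm (λ i k → M (suc i) (punchIn j k))))

  -- Equal values at the positive integers make the two reversed polynomials the same series f. Both
  -- series of power traces then solve `θ f ≋ p ⊛ f` for p, and f can be cancelled.
  charPoly⇒traces : ∀ {n} (S S′ : Matrix n) → (∀ x → charPoly S x ≡ charPoly S′ x) →
                    ∀ m → trace (pow S m) ≡ trace (pow S′ m)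
  charPoly⇒traces {n} S S′ eq zero    = refl
  charPoly⇒traces {n} S S′ eq (suc m) =
    ℤ.neg-injective (move _ _ (⊛-cancelʳ (λ k → A.powerTraces k + - B.powerTraces k) A.series A.series-0 vanish (suc m)))
    where
    open Series
    module A = CharacteristicSeries S
    module B = CharacteristicSeries S′
    move : ∀ a b → a + - b ≡ 0ℤ → a ≡ b
    move a b p = trans (lemma a b) (trans (cong (_+ b) p) (ℤ.+-identityˡ b))
      where
      lemma : ∀ a b → a ≡ a + - b + b
      lemma = solve-∀
    eval-scale : ∀ m x c f → eval m x (λ k → c * f k) ≡ c * eval m x f
    eval-scale zero    x c f = refl
    eval-scale (suc m) x c f = trans (cong (λ a → x * a + c * f (suc m)) (eval-scale m x c f)) (lemma x c
          (eval m x f) (f (suc m)))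
      where
      lemma : ∀ x c a b → x * (c * a) + c * b ≡ c * (x * a + b)
      lemma = solve-∀
    difference : Series
    difference k = A.series k + -1ℤ * B.series k
    eval-difference : ∀ x → eval n x difference ≡ 0ℤ
    eval-difference x = begin
      eval n x difference ≡⟨ eval-+ n x A.series (λ k → -1ℤ * B.series k) ⟩
      eval n x A.series + eval n x (λ k → -1ℤ * B.series k) ≡⟨ +-congˡ (eval n x A.series) (eval-scale n x -1ℤ B.series) ⟩
      eval n x A.series + -1ℤ * eval n x B.series
        ≡⟨ cong₂ (λ a b → a + -1ℤ * b) (trans (A.eval-series x) (eq x)) (B.eval-series x) ⟩
      charPoly S′ x + -1ℤ * charPoly S′ x ≡⟨ lemma (charPoly S′ x) ⟩
      0ℤ ∎
      where
      lemma : ∀ a → a + -1ℤ * a ≡ 0ℤ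
      lemma = solve-∀
    same : A.series ≋ B.series
    same k = move _ _ (trans (+-congˡ (A.series k) (sym (ℤ.-1*i≡-i (B.series k)))) (zero-coeff k))
      where
      zero-coeff : ∀ k → difference k ≡ 0ℤ
      zero-coeff k with k ℕ.≤? n
      ... | yes k≤n = eval≡0⇒coeff≡0 n difference (λ x → eval-difference (+ suc x)) k k≤n
      ... | no  k≰n = cong₂ (λ a b → a + -1ℤ * b) (A.degree k (ℕ.≰⇒> k≰n)) (B.degree k (ℕ.≰⇒> k≰n))
    vanish : (λ k → A.powerTraces k + - B.powerTraces k) ⊛ A.series ≋ λ _ → 0ℤ
    vanish m = begin
      ((λ k → A.powerTraces k + - B.powerTraces k) ⊛ A.series) m
        ≡⟨ ⊛-distribʳ A.series A.powerTraces (λ k → - B.powerTraces k) m ⟩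
      (A.powerTraces ⊛ A.series) m + ((λ k → - B.powerTraces k) ⊛ A.series) m
        ≡⟨ cong₂ _+_ (sym (A.θ-series m)) (trans (⊛-cong (λ k → sym (ℤ.-1*i≡-i (B.powerTraces k))) same m)
             (⊛-scale -1ℤ B.powerTraces B.series m)) ⟩
      + m * A.series m + -1ℤ * (B.powerTraces ⊛ B.series) m
        ≡⟨ cong₂ (λ a b → + m * a + -1ℤ * b) (same m) (sym (B.θ-series m)) ⟩
      + m * B.series m + -1ℤ * (+ m * B.series m)
        ≡⟨ lemma (+ m * B.series m) ⟩
      0ℤ ∎
      where
      lemma : ∀ a → a + -1ℤ * a ≡ 0ℤ
      lemma = solve-∀

-- From real to integer characteristic polynomials

module _ {R R′ : RawRing 0ℓ 0ℓ} where
  private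
    module R = RawRing R
    module R′ = RawRing R′

  module _ (h : R.Carrier → R′.Carrier)
           (h-0 : h R.0# ≡ R′.0#) (h-1 : h R.1# ≡ R′.1#) (h-neg : ∀ x → h (R.- x) ≡ R′.- h x)
           (h-+ : ∀ x y → h (x R.+ y) ≡ h x R′.+ h y) (h-* : ∀ x y → h (x R.* y) ≡ h x R′.* h y) where

    -- Stated for raw rings so that one proof serves both the embedding `ι` of ℤ into ℚ and the map
    -- that takes a real to the k-th term of its sequence.
    det-hom : ∀ {n} {A : Matrices.Matrix R n} {B : Matrices.Matrix R′ n} → (∀ i j → h (A i j) ≡ B i j) → h
          (Matrices.det R A) ≡ Matrices.det R′ B
    det-hom {zero}  eq = h-1
    det-hom {suc n} eq = h-sum λ j → trans (h-* _ _) (cong₂ R′._*_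
      (trans (h-* _ _) (cong₂ R′._*_ (h-sign (toℕ j)) (eq zero j)))
      (det-hom λ i k → eq (suc i) (punchIn j k)))
      where
      h-sign : ∀ j → h (RawSemiringDefinitions._^_ R.rawSemiring
            (R.- R.1#) j) ≡ RawSemiringDefinitions._^_ R′.rawSemiring (R′.- R′.1#) j
      h-sign zero    = h-1
      h-sign (suc j) = trans (h-* _ _) (cong₂ R′._*_ (trans (h-neg R.1#) (cong R′.-_ h-1)) (h-sign j))
      h-sum : ∀ {m} {f : Vector R.Carrier m} {g} → (∀ i → h (f i) ≡ g i) → h
            (RawSemiringDefinitions.sum R.rawSemiring f) ≡ RawSemiringDefinitions.sum R′.rawSemiring g
      h-sum {zero}  eq = h-0
      h-sum {suc m} eq = trans (h-+ _ _) (cong₂ R′._+_ (eq zero) (h-sum (eq ∘ suc)))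

    charPoly-hom : ∀ {n} {A : Matrices.Matrix R n} {B : Matrices.Matrix R′ n} → (∀ i j → h (A i j) ≡ B i j) →
                   ∀ x → h (Matrices.charPoly R A x) ≡ Matrices.charPoly R′ B (h x)
    charPoly-hom eq x = det-hom λ i j → trans (h-+ _ _)
      (cong₂ R′._+_ (h-scalar (does (i Fin.≟ j))) (trans (h-neg _) (cong R′.-_ (eq i j))))
      where
      h-scalar : ∀ b → h (if b then x else R.0#) ≡ (if b then h x else R′.0#)
      h-scalar true  = refl
      h-scalar false = h-0

-- Defined through unnormalised rationals, where the homomorphism laws are identities between
-- fractions with denominator 1.
ι : ℤ → ℚ
ι z = ℚ.fromℚᵘ (mkℚᵘ z 0)

ι-injective : ∀ {a b} → ι a ≡ ι b → a ≡ b
ι-injective {a} {b} eq with ℚᵘ.≃-trans (ℚᵘ.≃-sym (ℚ.toℚᵘ-fromℚᵘ (mkℚᵘ a 0)))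
                              (ℚᵘ.≃-trans (ℚ.toℚᵘ-cong eq) (ℚ.toℚᵘ-fromℚᵘ (mkℚᵘ b 0)))
... | *≡* p = trans (sym (ℤ.*-identityʳ a)) (trans p (ℤ.*-identityʳ b))

ι-+ : ∀ a b → ι (a ℤ.+ b) ≡ ι a ℚ.+ ι b
ι-+ a b = ℚ.toℚᵘ-injective (begin
  ℚ.toℚᵘ (ι (a ℤ.+ b))             ≈⟨ ℚ.toℚᵘ-fromℚᵘ (mkℚᵘ (a ℤ.+ b) 0) ⟩
  mkℚᵘ (a ℤ.+ b) 0                 ≈⟨ *≡* (lemma a b) ⟩
  mkℚᵘ a 0 ℚᵘ.+ mkℚᵘ b 0           ≈⟨ ℚᵘ.+-cong (ℚ.toℚᵘ-fromℚᵘ (mkℚᵘ a 0)) (ℚ.toℚᵘ-fromℚᵘ (mkℚᵘ b 0)) ⟨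
  ℚ.toℚᵘ (ι a) ℚᵘ.+ ℚ.toℚᵘ (ι b)   ≈⟨ ℚ.toℚᵘ-homo-+ (ι a) (ι b) ⟨
  ℚ.toℚᵘ (ι a ℚ.+ ι b) ∎)
  where
  open SetoidReasoning ℚᵘ.≃-setoid
  lemma : ∀ a b → (a ℤ.+ b) ℤ.* 1ℤ ≡ (a ℤ.* 1ℤ ℤ.+ b ℤ.* 1ℤ) ℤ.* 1ℤ
  lemma = solve-∀

ι-* : ∀ a b → ι (a ℤ.* b) ≡ ι a ℚ.* ι b
ι-* a b = ℚ.toℚᵘ-injective (begin
  ℚ.toℚᵘ (ι (a ℤ.* b))             ≈⟨ ℚ.toℚᵘ-fromℚᵘ (mkℚᵘ (a ℤ.* b) 0) ⟩
  mkℚᵘ a 0 ℚᵘ.* mkℚᵘ b 0           ≈⟨ ℚᵘ.*-cong (ℚ.toℚᵘ-fromℚᵘ (mkℚᵘ a 0)) (ℚ.toℚᵘ-fromℚᵘ (mkℚᵘ b 0)) ⟨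
  ℚ.toℚᵘ (ι a) ℚᵘ.* ℚ.toℚᵘ (ι b)   ≈⟨ ℚ.toℚᵘ-homo-* (ι a) (ι b) ⟨
  ℚ.toℚᵘ (ι a ℚ.* ι b) ∎)
  where open SetoidReasoning ℚᵘ.≃-setoid

ι-neg : ∀ a → ι (ℤ.- a) ≡ ℚ.- ι a
ι-neg a = ℚ.toℚᵘ-injective (begin
  ℚ.toℚᵘ (ι (ℤ.- a))   ≈⟨ ℚ.toℚᵘ-fromℚᵘ (mkℚᵘ (ℤ.- a) 0) ⟩
  ℚᵘ.- mkℚᵘ a 0        ≈⟨ ℚᵘ.-‿cong (ℚ.toℚᵘ-fromℚᵘ (mkℚᵘ a 0)) ⟨
  ℚᵘ.- ℚ.toℚᵘ (ι a)    ≈⟨ ℚ.toℚᵘ-homo‿- (ι a) ⟨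
  ℚ.toℚᵘ (ℚ.- ι a) ∎)
  where open SetoidReasoning ℚᵘ.≃-setoid

-- Here `r` will be the product over the unknown eigenvalues, an arbitrary real, while the two
-- characteristic polynomials at a rational are constant sequences. Two constants with a common
-- limit cannot be ε apart, since each comes within ε/2 of `r`.
≈ʳ-const⇒≡ : ∀ x y r p q → (∀ k → seq x k ≡ p) → (∀ k → seq y k ≡ q) → x ≈ʳ r → y ≈ʳ r → p ≡ q
≈ʳ-const⇒≡ x y r p q xp yq x≈r y≈r = decidable-stable (p ℚ.≟ q) λ p≢q →
  let ε = ℚ.∣ p ℚ.- q ∣
      ε>0 : 0ℚ ℚ.< ε
      ε>0 = ℚ.≰⇒> λ ε≤0 → p≢q (p-q≡0⇒p≡q (ℚ.∣p∣≡0⇒p≡0 (p ℚ.- q) (ℚ.≤-antisym ε≤0 (ℚ.0≤∣p∣ (p ℚ.- q)))))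
      (M , xr) = x≈r (½ ℚ.* ε) (ℝ-Lemmas.0<½*ε ε>0)
      (N , yr) = y≈r (½ ℚ.* ε) (ℝ-Lemmas.0<½*ε ε>0)
      k = M ℕ.⊔ N
      xk = subst (λ a → ℚ.∣ a ℚ.- seq r k ∣ ℚ.< ½ ℚ.* ε) (xp k) (xr k (ℕ.m≤m⊔n M N))
      yk = subst (λ a → ℚ.∣ a ℚ.- seq r k ∣ ℚ.< ½ ℚ.* ε) (yq k) (yr k (ℕ.m≤n⊔m M N))
  in ℚ.<-irrefl refl (begin-strict
    ε                                                          ≡⟨ cong ℚ.∣_∣ (between p q (seq r k)) ⟩
    ℚ.∣ (p ℚ.- seq r k) ℚ.- (q ℚ.- seq r k) ∣                  ≤⟨ ℚ.∣p-q∣≤∣p∣+∣q∣ (p ℚ.- seq r k) (q ℚ.- seq r k) ⟩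
    ℚ.∣ p ℚ.- seq r k ∣ ℚ.+ ℚ.∣ q ℚ.- seq r k ∣                <⟨ ℚ.+-mono-< xk yk ⟩
    ½ ℚ.* ε ℚ.+ ½ ℚ.* ε                                        ≡⟨ ℝ-Lemmas.½*ε+½*ε ε ⟩
    ε ∎)
  where
  open ℚ.≤-Reasoning
  open import Data.Rational.Solver using (module +-*-Solver)
  open +-*-Solver
  between : ∀ p q r → p ℚ.- q ≡ (p ℚ.- r) ℚ.- (q ℚ.- r)
  between = solve 3 (λ p q r → p :- q := (p :- r) :- (q :- r)) refl
  p-q≡0⇒p≡q : ∀ {p q} → p ℚ.- q ≡ 0ℚ → p ≡ q
  p-q≡0⇒p≡q {p} {q} eq = trans (ℝ-Lemmas.split p q) (trans (cong (λ d → q ℚ.+ d) eq) (ℚ.+-identityʳ q))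


open IntegerMatrices
open import Data.Integer.Base using (_+_; _*_; -_)

adjacencyᶻ : ∀ {n} → Graph n → Matrix n
adjacencyᶻ G i j = if does (Graph._~?_ G i j) then 1ℤ else 0ℤ


charPoly-seq : ∀ {n} (G : Graph n) z k →
               seq (Matrices.charPoly ℝ-rawRing (adjacency G) (fromℚ (ι z))) k ≡ ι (charPoly (adjacencyᶻ G) z)
charPoly-seq {n} G z k = trans step₁ step₂
  where
  adjacencyℚ : Matrices.Matrix ℚ.+-*-rawRing n
  adjacencyℚ i j = if does (Graph._~?_ G i j) then 1ℚ else 0ℚ
  entryʳ : ∀ b → seq (if b then fromℚ 1ℚ else fromℚ 0ℚ) k ≡ (if b then 1ℚ else 0ℚ)
  entryʳ true  = refl
  entryʳ false = refl
  entryᶻ : ∀ b → ι (if b then 1ℤ else 0ℤ) ≡ (if b then 1ℚ else 0ℚ)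
  entryᶻ true  = refl
  entryᶻ false = refl
  step₁ : seq (Matrices.charPoly ℝ-rawRing (adjacency G) (fromℚ (ι z))) k ≡ Matrices.charPoly ℚ.+-*-rawRing adjacencyℚ (ι z)
  step₁ = charPoly-hom {ℝ-rawRing} {ℚ.+-*-rawRing} (λ x → seq x k) refl refl (λ _ → refl) (λ _ _ → refl) (λ _ _ → refl)
    {n} {adjacency G} {adjacencyℚ} (λ i j → entryʳ (does (Graph._~?_ G i j))) (fromℚ (ι z))
  step₂ : Matrices.charPoly ℚ.+-*-rawRing adjacencyℚ (ι z) ≡ ι (charPoly (adjacencyᶻ G) z)
  step₂ = sym (charPoly-hom {CommutativeRing.rawRing ℤ-ring} {ℚ.+-*-rawRing} ι refl refl ι-neg ι-+ ι-*
    {n} {adjacencyᶻ G} {adjacencyℚ} (λ i j → entryᶻ (does (Graph._~?_ G i j))) z)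

cospectral⇒charPoly : ∀ {m n} (G : Graph m) (H : Graph n) → Cospectral G H →
                      m ≡ n × (∀ z → charPoly (adjacencyᶻ G) z ≡ charPoly (adjacencyᶻ H) z)
cospectral⇒charPoly G H (Λ , (lenG , specG) , (lenH , specH)) =
    trans (sym lenG) lenH
  , λ z → let x = fromℚ (ι z) in ι-injective
      (≈ʳ-const⇒≡ (Matrices.charPoly ℝ-rawRing (adjacency G) x) (Matrices.charPoly ℝ-rawRing (adjacency H) x)
            (Matrices.rootProduct ℝ-rawRing Λ x) _ _
        (charPoly-seq G z) (charPoly-seq H z) (specG x) (specH x))

-- The Hamming graph

sum-↑ : ∀ m n (f : Vector ℤ (m ℕ.+ n)) → sum f ≡ sum {m} (λ i → f (i ↑ˡ n)) + sum {n} (λ i → f (m ↑ʳ i))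
sum-↑ zero    n f = sym (ℤ.+-identityˡ (sum f))
sum-↑ (suc m) n f = trans (+-congˡ (f zero) (sum-↑ m n (f ∘ suc)))
  (sym (ℤ.+-assoc (f zero) (sum {m} λ i → f (suc i ↑ˡ n)) (sum {n} λ i → f (suc m ↑ʳ i))))

sum-combine : ∀ m n (f : Vector ℤ (m ℕ.* n)) → sum f ≡ sum {m} λ a → sum {n} λ b → f (combine a b)
sum-combine zero    n f = refl
sum-combine (suc m) n f = trans (sum-↑ n (m ℕ.* n) f)
  (+-congˡ (sum {n} λ i → f (i ↑ˡ (m ℕ.* n))) (sum-combine m n λ i → f (n ↑ʳ i)))

funToFin-cong : ∀ d {q} {f g : Fin d → Fin q} → (∀ k → f k ≡ g k) → funToFin f ≡ funToFin g
funToFin-cong zero    eq = refl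
funToFin-cong (suc d) eq = cong₂ combine (eq zero) (funToFin-cong d (eq ∘ suc))

sum-const : ∀ n c → sum {n} (λ _ → c) ≡ + n * c
sum-const zero    c = refl
sum-const (suc n) c = trans (+-congˡ c (sum-const n c)) (sym (ℤ.suc-* (+ n) c))

-- The least eigenvalue of H(3,q) is -3; after the shift all eigenvalues are multiples of q and the
-- least one is 0.
shifted : ∀ {n} → Graph n → Matrix n
shifted G i j = adjacencyᶻ G i j + + 3 * I i j

module HammingCube (q : ℕ) where
  open ≡-Reasoning

  V : Set
  V = Fin (q ℕ.^ 3)

  tuple : V → Fin 3 → Fin q
  tuple = finToFun

  -- The power `q ^ 3` unfolds to q * (q * (q * 1)), whence the final `zero` in `Fin 1`.
  code : Fin q → Fin q → Fin q → V
  code a b c = combine a (combine b (combine c zero))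

  tuple-combine₀ : ∀ d a (j : Fin (q ℕ.^ d)) → finToFun {q} {suc d} (combine a j) zero ≡ a
  tuple-combine₀ d a j = cong proj₁ (Fin.remQuot-combine {q} {q ℕ.^ d} a j)

  tuple-combineₛ : ∀ d a (j : Fin (q ℕ.^ d)) k → finToFun {q} {suc d} (combine a j) (suc k) ≡ finToFun {q} {d} j k
  tuple-combineₛ d a j k = cong (λ p → finToFun {q} {d} (proj₂ p) k) (Fin.remQuot-combine {q} {q ℕ.^ d} a j)

  sum-code : ∀ (f : V → ℤ) → sum {q ℕ.^ 3} f ≡ sum λ a → sum λ b → sum λ c → f (code a b c)
  sum-code f = trans (sum-combine q (q ℕ.^ 2) f) (sum-cong-≗ λ a →
    trans (sum-combine q (q ℕ.^ 1) (λ j → f (combine a j))) (sum-cong-≗ λ b →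
    trans (sum-combine q 1 (λ j → f (combine a (combine b j)))) (sum-cong-≗ λ c → ℤ.+-identityʳ (f (code a b c)))))

  sum-tuple : ∀ (F : Fin q → Fin q → Fin q → ℤ) →
              sum {q ℕ.^ 3} (λ i → F (tuple i 0F) (tuple i 1F) (tuple i 2F)) ≡ sum λ a → sum λ b → sum λ c → F a b c
  sum-tuple F = trans (sum-code (λ i → F (tuple i 0F) (tuple i 1F) (tuple i 2F)))
    (sum-cong-≗ λ a → sum-cong-≗ λ b → sum-cong-≗ λ c →
      cong₃ (tuple-combine₀ 2 a (combine b (combine c zero)))
            (trans (tuple-combineₛ 2 a (combine b (combine c zero)) 0F) (tuple-combine₀ 1 b (combine c zero)))
            (trans (tuple-combineₛ 2 a (combine b (combine c zero)) 1F)
              (trans (tuple-combineₛ 1 b (combine c zero) 0F) (tuple-combine₀ 0 c zero))))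
    where
    cong₃ : ∀ {a a′ b b′ c c′} → a ≡ a′ → b ≡ b′ → c ≡ c′ → F a b c ≡ F a′ b′ c′
    cong₃ refl refl refl = refl

  tuple-injective : ∀ {i j} → (∀ k → tuple i k ≡ tuple j k) → i ≡ j
  tuple-injective {i} {j} eq = trans (sym (Fin.funToFin-finToFin {3} {q} i))
    (trans (funToFin-cong 3 eq) (Fin.funToFin-finToFin {3} {q} j))

  S : Matrix (q ℕ.^ 3)
  S = shifted (Hamming 3 q)

  pairs : ℤ → ℤ → ℤ → ℤ
  pairs a b c = a * b + a * c + b * c

  e : Fin 3 → V → V → ℤ
  e k i j = I (tuple i k) (tuple j k)

  -- If i and j agree in m coordinates, both sides are m(m - 1)/2: 3 on the diagonal, 1 for
  -- neighbours and 0 otherwise. In this polynomial form powers of S can be summed one coordinate at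
  -- a time.
  S-pairs : ∀ i j → S i j ≡ pairs (e 0F i j) (e 1F i j) (e 2F i j)
  S-pairs i j = go (tuple i 0F Fin.≟ tuple j 0F) (tuple i 1F Fin.≟ tuple j 1F) (tuple i 2F Fin.≟ tuple j 2F)
    where
    open import Relation.Nullary.Decidable using (Dec)
    u v : Fin 3 → Fin q
    u = tuple i
    v = tuple j
    same : ∀ {k} → u k ≡ v k → e k i j ≡ 1ℤ
    same {k} eq = trans (cong (I (u k)) (sym eq)) (I-diag (u k))
    differ : ∀ {k} → u k ≢ v k → e k i j ≡ 0ℤ
    differ = I-off
    entry : ∀ {a b x y z} → adjacencyᶻ (Hamming 3 q) i j ≡ a → I i j ≡ b → a + + 3 * b ≡ pairs x y z →
            e 0F i j ≡ x → e 1F i j ≡ y → e 2F i j ≡ z → S i j ≡ pairs (e 0F i j) (e 1F i j) (e 2F i j)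
    entry p q r s t w rewrite p | q | s | t | w = r
    adjacent : DifferInOneCoordinate u v → adjacencyᶻ (Hamming 3 q) i j ≡ 1ℤ
    adjacent d = cong (if_then 1ℤ else 0ℤ) (dec-true (differInOneCoordinate? u v) d)
    nonadjacent : ¬ DifferInOneCoordinate u v → adjacencyᶻ (Hamming 3 q) i j ≡ 0ℤ
    nonadjacent d = cong (if_then 1ℤ else 0ℤ) (dec-false (differInOneCoordinate? u v) d)
    distinct : ∀ k → u k ≢ v k → I i j ≡ 0ℤ
    distinct k ne = I-off λ eq → ne (cong (λ w → tuple w k) eq)
    two : ∀ k l → k ≢ l → u k ≢ v k → u l ≢ v l → ¬ DifferInOneCoordinate u v
    two k l k≢l nk nl (m , _ , uniq) = k≢l (trans (sym (uniq nk)) (uniq nl))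
    go : Dec (u 0F ≡ v 0F) → Dec (u 1F ≡ v 1F) → Dec (u 2F ≡ v 2F) → S i j ≡ pairs (e 0F i j) (e 1F i j) (e 2F i j)
    go (yes a) (yes b) (yes c) = entry (nonadjacent λ { (0F , ne , _) → ne a ; (1F , ne , _) → ne b ; (2F , ne , _) → ne c })
      (trans (cong (I i) (sym (tuple-injective {i} {j} λ { 0F → a ; 1F → b ; 2F → c }))) (I-diag i)) refl
            (same {0F} a) (same {1F} b) (same {2F} c)
    go (no a)  (yes b) (yes c) = entry (adjacent
          (0F , a , λ { {0F} _ → refl ; {1F} n → contradiction b n ; {2F} n → contradiction c n }))
      (distinct 0F a) refl (differ {0F} a) (same {1F} b) (same {2F} c)
    go (yes a) (no b)  (yes c) = entry (adjacent
          (1F , b , λ { {1F} _ → refl ; {0F} n → contradiction a n ; {2F} n → contradiction c n }))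
      (distinct 1F b) refl (same {0F} a) (differ {1F} b) (same {2F} c)
    go (yes a) (yes b) (no c)  = entry (adjacent
          (2F , c , λ { {2F} _ → refl ; {0F} n → contradiction a n ; {1F} n → contradiction b n }))
      (distinct 2F c) refl (same {0F} a) (same {1F} b) (differ {2F} c)
    go (no a)  (no b)  (yes c) = entry (nonadjacent (two 0F 1F (λ ()) a b)) (distinct 0F a) refl (differ {0F} a)
          (differ {1F} b) (same {2F} c)
    go (no a)  (yes b) (no c)  = entry (nonadjacent (two 0F 2F (λ ()) a c)) (distinct 0F a) refl (differ {0F} a)
          (same {1F} b) (differ {2F} c)
    go (yes a) (no b)  (no c)  = entry (nonadjacent (two 1F 2F (λ ()) b c)) (distinct 1F b) refl (same {0F} a)
          (differ {1F} b) (differ {2F} c)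
    go (no a)  (no b)  (no c)  = entry (nonadjacent (two 0F 1F (λ ()) a b)) (distinct 0F a) refl (differ {0F} a)
          (differ {1F} b) (differ {2F} c)

  -- In any single coordinate b, a product of a polynomial linear in `I x b` with one linear in
  -- `I b y` has this shape, so the same four sums serve every coordinate of every product.
  sum-bilinear : ∀ x y c₀ c₁ c₂ c₃ →
    sum {q} (λ b → c₀ + c₁ * I x b + c₂ * I b y + c₃ * (I x b * I b y)) ≡ + q * c₀ + c₁ + c₂ + c₃ * I x y
  sum-bilinear x y c₀ c₁ c₂ c₃ = begin
    sum (λ b → c₀ + c₁ * I x b + c₂ * I b y + c₃ * (I x b * I b y))
      ≡⟨ ∑-distrib-+ (λ b → c₀ + c₁ * I x b + c₂ * I b y) (λ b → c₃ * (I x b * I b y)) ⟩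
    sum (λ b → c₀ + c₁ * I x b + c₂ * I b y) + sum (λ b → c₃ * (I x b * I b y))
      ≡⟨ cong₂ _+_ (∑-distrib-+ (λ b → c₀ + c₁ * I x b) (λ b → c₂ * I b y))
           (trans (sym (*-distribˡ-sum c₃ (λ b → I x b * I b y))) (cong (c₃ *_) (sum-Iˡ (λ b → I b y) x))) ⟩
    sum (λ b → c₀ + c₁ * I x b) + sum (λ b → c₂ * I b y) + c₃ * I x y
      ≡⟨ cong (_+ c₃ * I x y) (cong₂ _+_ (trans (∑-distrib-+ (λ _ → c₀) (λ b → c₁ * I x b))
           (cong₂ _+_ (sum-const q c₀) (trans (sum-cong-≗ λ b → ℤ.*-comm c₁ (I x b)) (sum-Iˡ (λ _ → c₁) x))))
           (sum-Iʳ (λ _ → c₂) y)) ⟩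
    + q * c₀ + c₁ + c₂ + c₃ * I x y ∎

  -- Each lemma sums out one coordinate at a time; the arguments of
  -- sum-bilinear are the coefficients of 1, I x b, I b y and I x b * I b y.
  S·S : ∀ i j → (S · S) i j ≡ + q * S i j + + 2 * (e 0F i j + e 1F i j + e 2F i j)
  S·S i j = begin
    sum (λ w → S i w * S w j)
      ≡⟨ sum-cong-≗ (λ w → cong₂ _*_ (S-pairs i w) (S-pairs w j)) ⟩
    sum (λ w → pairs (e 0F i w) (e 1F i w) (e 2F i w) * pairs (e 0F w j) (e 1F w j) (e 2F w j))
      ≡⟨ sum-tuple (λ a b c → pairs (I x₀ a) (I x₁ b) (I x₂ c) * pairs (I a y₀) (I b y₁) (I c y₂)) ⟩
    sum (λ a → sum λ b → sum λ c → pairs (I x₀ a) (I x₁ b) (I x₂ c) * pairs (I a y₀) (I b y₁) (I c y₂))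
      ≡⟨ sum-cong-≗ (λ a → sum-cong-≗ λ b → trans (sum-cong-≗ λ c →
           step₂ (I x₀ a) (I x₁ b) (I x₂ c) (I a y₀) (I b y₁) (I c y₂)) (sum-bilinear x₂ y₂ _ _ _
             ((I x₀ a + I x₁ b) * (I a y₀ + I b y₁)))) ⟩
    _ ≡⟨ sum-cong-≗ (λ a → trans (sum-cong-≗ λ b →
           step₁ (+ q) (I x₀ a) (I x₁ b) (I a y₀) (I b y₁) (I x₂ y₂)) (sum-bilinear x₁ y₁ _ _ _
             (+ q * (I x₀ a * I a y₀) + I a y₀ + I x₀ a + I x₂ y₂))) ⟩
    _ ≡⟨ trans (sum-cong-≗ λ a →
           step₀ (+ q) (I x₀ a) (I a y₀) (I x₁ y₁) (I x₂ y₂)) (sum-bilinear x₀ y₀ _ _ _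
             (+ q * I x₁ y₁ + + q * I x₂ y₂ + + 2)) ⟩
    _ ≡⟨ final (+ q) (I x₀ y₀) (I x₁ y₁) (I x₂ y₂) ⟩
    + q * pairs (e 0F i j) (e 1F i j) (e 2F i j) + + 2 * (e 0F i j + e 1F i j + e 2F i j)
      ≡⟨ cong (λ s → + q * s + + 2 * (e 0F i j + e 1F i j + e 2F i j)) (S-pairs i j) ⟨
    + q * S i j + + 2 * (e 0F i j + e 1F i j + e 2F i j) ∎
    where
    x₀ = tuple i 0F ; x₁ = tuple i 1F ; x₂ = tuple i 2F
    y₀ = tuple j 0F ; y₁ = tuple j 1F ; y₂ = tuple j 2F
    step₂ : ∀ p₀ p₁ p₂ r₀ r₁ r₂ → (p₀ * p₁ + p₀ * p₂ + p₁ * p₂) * (r₀ * r₁ + r₀ * r₂ + r₁ * r₂) ≡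
      p₀ * p₁ * (r₀ * r₁) + (p₀ + p₁) * (r₀ * r₁) * p₂ + p₀ * p₁ * (r₀ + r₁) * r₂ + (p₀ + p₁) * (r₀ + r₁) * (p₂ * r₂)
    step₂ = solve-∀
    step₁ : ∀ q p₀ p₁ r₀ r₁ e₂ →
      q * (p₀ * p₁ * (r₀ * r₁)) + (p₀ + p₁) * (r₀ * r₁) + p₀ * p₁ * (r₀ + r₁) + (p₀ + p₁) * (r₀ + r₁) * e₂ ≡
      p₀ * r₀ * e₂ + (p₀ * r₀ + r₀ * e₂) * p₁ + (p₀ * r₀ + p₀ * e₂) * r₁ + (q * (p₀ * r₀) + r₀ + p₀ + e₂) * (p₁ * r₁)
    step₁ = solve-∀
    step₀ : ∀ q p₀ r₀ e₁ e₂ →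
      q * (p₀ * r₀ * e₂) + (p₀ * r₀ + r₀ * e₂) + (p₀ * r₀ + p₀ * e₂) + (q * (p₀ * r₀) + r₀ + p₀ + e₂) * e₁ ≡
      e₁ * e₂ + (e₁ + e₂) * p₀ + (e₁ + e₂) * r₀ + (q * e₁ + q * e₂ + + 2) * (p₀ * r₀)
    step₀ = solve-∀
    final : ∀ q e₀ e₁ e₂ → q * (e₁ * e₂) + (e₁ + e₂) + (e₁ + e₂) + (q * e₁ + q * e₂ + + 2) * e₀ ≡
      q * (e₀ * e₁ + e₀ * e₂ + e₁ * e₂) + + 2 * (e₀ + e₁ + e₂)
    final = solve-∀

  -- Let E = e₀ + e₁ + e₂ be the number of agreeing coordinates. The relations S² = qS + 2E and SE =
  -- 2qE + 3J close up under multiplication by S, and eliminating E from them gives `S-cubic`.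
  S·e : ∀ i j → sum (λ w → S i w * (e 0F w j + e 1F w j + e 2F w j)) ≡ + 2 * + q * (e 0F i j + e 1F i j + e 2F i j) + + 3
  S·e i j = begin
    sum (λ w → S i w * (e 0F w j + e 1F w j + e 2F w j))
      ≡⟨ sum-cong-≗ (λ w → cong (_* (e 0F w j + e 1F w j + e 2F w j)) (S-pairs i w)) ⟩
    sum (λ w → pairs (e 0F i w) (e 1F i w) (e 2F i w) * (e 0F w j + e 1F w j + e 2F w j))
      ≡⟨ sum-tuple (λ a b c → pairs (I x₀ a) (I x₁ b) (I x₂ c) * (I a y₀ + I b y₁ + I c y₂)) ⟩
    sum (λ a → sum λ b → sum λ c → pairs (I x₀ a) (I x₁ b) (I x₂ c) * (I a y₀ + I b y₁ + I c y₂))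
      ≡⟨ sum-cong-≗ (λ a → sum-cong-≗ λ b → trans (sum-cong-≗ λ c →
           step₂ (I x₀ a) (I x₁ b) (I x₂ c) (I a y₀) (I b y₁) (I c y₂)) (sum-bilinear x₂ y₂ _ _ _
             (I x₀ a + I x₁ b))) ⟩
    _ ≡⟨ sum-cong-≗ (λ a → trans (sum-cong-≗ λ b →
           step₁ (+ q) (I x₀ a) (I x₁ b) (I a y₀) (I b y₁) (I x₂ y₂)) (sum-bilinear x₁ y₁ _ _ _
             (+ q * I x₀ a + + 1))) ⟩
    _ ≡⟨ trans (sum-cong-≗ λ a →
           step₀ (+ q) (I x₀ a) (I a y₀) (I x₁ y₁) (I x₂ y₂)) (sum-bilinear x₀ y₀ _ _ _
             (+ 2 * + q)) ⟩
    _ ≡⟨ final (+ q) (I x₀ y₀) (I x₁ y₁) (I x₂ y₂) ⟩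
    + 2 * + q * (e 0F i j + e 1F i j + e 2F i j) + + 3 ∎
    where
    x₀ = tuple i 0F ; x₁ = tuple i 1F ; x₂ = tuple i 2F
    y₀ = tuple j 0F ; y₁ = tuple j 1F ; y₂ = tuple j 2F
    step₂ : ∀ p₀ p₁ p₂ r₀ r₁ r₂ → (p₀ * p₁ + p₀ * p₂ + p₁ * p₂) * (r₀ + r₁ + r₂) ≡
      p₀ * p₁ * (r₀ + r₁) + (p₀ + p₁) * (r₀ + r₁) * p₂ + p₀ * p₁ * r₂ + (p₀ + p₁) * (p₂ * r₂)
    step₂ = solve-∀
    step₁ : ∀ q p₀ p₁ r₀ r₁ e₂ →
      q * (p₀ * p₁ * (r₀ + r₁)) + (p₀ + p₁) * (r₀ + r₁) + p₀ * p₁ + (p₀ + p₁) * e₂ ≡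
      (p₀ * r₀ + p₀ * e₂) + (q * (p₀ * r₀) + r₀ + p₀ + e₂) * p₁ + p₀ * r₁ + (q * p₀ + + 1) * (p₁ * r₁)
    step₁ = solve-∀
    step₀ : ∀ q p₀ r₀ e₁ e₂ →
      q * (p₀ * r₀ + p₀ * e₂) + (q * (p₀ * r₀) + r₀ + p₀ + e₂) + p₀ + (q * p₀ + + 1) * e₁ ≡
      (e₁ + e₂) + (q * e₁ + q * e₂ + + 2) * p₀ + + 1 * r₀ + (+ 2 * q) * (p₀ * r₀)
    step₀ = solve-∀
    final : ∀ q e₀ e₁ e₂ → q * (e₁ + e₂) + (q * e₁ + q * e₂ + + 2) + + 1 + (+ 2 * q) * e₀ ≡
      + 2 * q * (e₀ + e₁ + e₂) + + 3
    final = solve-∀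

  S-rowSum : ∀ i → sum (S i) ≡ + 3 * + q
  S-rowSum i = begin
    sum (S i)
      ≡⟨ sum-cong-≗ (S-pairs i) ⟩
    sum (λ w → pairs (e 0F i w) (e 1F i w) (e 2F i w))
      ≡⟨ sum-tuple (λ a b c → pairs (I x₀ a) (I x₁ b) (I x₂ c)) ⟩
    sum (λ a → sum λ b → sum λ c → pairs (I x₀ a) (I x₁ b) (I x₂ c))
      -- A row sum involves no second vertex; the first one stands in for it, with coefficients
      -- `0ℤ`.
      ≡⟨ sum-cong-≗ (λ a → sum-cong-≗ λ b → trans (sum-cong-≗ λ c →
           step₂ (I x₀ a) (I x₁ b) (I x₂ c) (I c x₂)) (sum-bilinear x₂ x₂ _ _ 0ℤ 0ℤ)) ⟩
    _ ≡⟨ sum-cong-≗ (λ a → trans (sum-cong-≗ λ b →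
           step₁ (+ q) (I x₀ a) (I x₁ b) (I b x₁) (I x₂ x₂)) (sum-bilinear x₁ x₁ _ _ 0ℤ 0ℤ)) ⟩
    _ ≡⟨ trans (sum-cong-≗ λ a → step₀ (+ q) (I x₀ a) (I a x₀) (I x₁ x₁)) (sum-bilinear x₀ x₀ _ _ 0ℤ 0ℤ) ⟩
    _ ≡⟨ final (+ q) (I x₀ x₀) ⟩
    + 3 * + q ∎
    where
    x₀ = tuple i 0F ; x₁ = tuple i 1F ; x₂ = tuple i 2F
    step₂ : ∀ p₀ p₁ p₂ r₂ → p₀ * p₁ + p₀ * p₂ + p₁ * p₂ ≡ p₀ * p₁ + (p₀ + p₁) * p₂ + 0ℤ * r₂ + 0ℤ * (p₂ * r₂)
    step₂ = solve-∀
    step₁ : ∀ q p₀ p₁ r₁ e₂ → q * (p₀ * p₁) + (p₀ + p₁) + 0ℤ + 0ℤ * e₂ ≡ p₀ + (q * p₀ + + 1) * p₁ + 0ℤ * r₁ + 0ℤ * (p₁ * r₁)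
    step₁ = solve-∀
    step₀ : ∀ q p₀ r₀ e₁ → q * p₀ + (q * p₀ + + 1) + 0ℤ + 0ℤ * e₁ ≡ + 1 + (+ 2 * q) * p₀ + 0ℤ * r₀ + 0ℤ * (p₀ * r₀)
    step₀ = solve-∀
    final : ∀ q e₀ → q * + 1 + (+ 2 * q) + 0ℤ + 0ℤ * e₀ ≡ + 3 * q
    final = solve-∀

  S-pow₂ : ∀ i j → pow S 2 i j ≡ (S · S) i j
  S-pow₂ i j = sum-cong-≗ λ w → cong (S i w *_) (pow-1 S w j)

  S-cubic : ∀ i j → pow S 3 i j ≡ + 3 * + q * pow S 2 i j + - (+ 2 * + q * + q) * S i j + + 6
  S-cubic i j = begin
    sum (λ w → S i w * pow S 2 w j)
      ≡⟨ sum-cong-≗ (λ w → trans (cong (S i w *_) (trans (S-pow₂ w j) (S·S w j))) (expand (S i w) (+ q) (S w j) _)) ⟩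
    sum (λ w → + q * (S i w * S w j) + + 2 * (S i w * E w))
      ≡⟨ trans (∑-distrib-+ (λ w → + q * (S i w * S w j)) (λ w → + 2 * (S i w * E w)))
           (cong₂ _+_ (sym (*-distribˡ-sum (+ q) (λ w → S i w * S w j))) (sym (*-distribˡ-sum (+ 2) (λ w → S i w * E w)))) ⟩
    + q * (S · S) i j + + 2 * sum (λ w → S i w * E w)
      ≡⟨ cong₂ (λ a b → + q * a + + 2 * b) (S·S i j) (S·e i j) ⟩
    + q * (+ q * S i j + + 2 * E i) + + 2 * (+ 2 * + q * E i + + 3)
      ≡⟨ final (+ q) (S i j) (E i) ⟩
    + 3 * + q * (+ q * S i j + + 2 * E i) + - (+ 2 * + q * + q) * S i j + + 6
      ≡⟨ cong (λ a → + 3 * + q * a + - (+ 2 * + q * + q) * S i j + + 6) (trans (S-pow₂ i j) (S·S i j)) ⟨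
    + 3 * + q * pow S 2 i j + - (+ 2 * + q * + q) * S i j + + 6 ∎
    where
    E : V → ℤ
    E w = e 0F w j + e 1F w j + e 2F w j
    expand : ∀ s q a b → s * (q * a + + 2 * b) ≡ q * (s * a) + + 2 * (s * b)
    expand = solve-∀
    final : ∀ q s e → q * (q * s + + 2 * e) + + 2 * (+ 2 * q * e + + 3) ≡ + 3 * q * (q * s + + 2 * e) + - (+ 2 * q * q) * s + + 6
    final = solve-∀

-- Sums and symmetric matrices over ℤ

0≤square : ∀ x → 0ℤ ℤ.≤ x * x
0≤square (+ n)    = subst (0ℤ ℤ.≤_) (ℤ.pos-* n n) (+≤+ z≤n)
0≤square -[1+ n ] = +≤+ z≤n

square≡0 : ∀ x → x * x ≡ 0ℤ → x ≡ 0ℤ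
square≡0 x eq with ℤ.i*j≡0⇒i≡0∨j≡0 x eq
... | inj₁ p = p
... | inj₂ p = p

0≤+ : ∀ {a b} → 0ℤ ℤ.≤ a → 0ℤ ℤ.≤ b → 0ℤ ℤ.≤ a + b
0≤+ p q = ℤ.+-mono-≤ p q

0≤* : ∀ n {a} → 0ℤ ℤ.≤ a → 0ℤ ℤ.≤ + n * a
0≤* n {+ a} _ = subst (0ℤ ℤ.≤_) (ℤ.pos-* n a) (+≤+ z≤n)

0≤-cancel : ∀ n {a} → 0ℤ ℤ.≤ + suc n * a → 0ℤ ℤ.≤ a
0≤-cancel n {a} p = ℤ.*-cancelˡ-≤-pos 0ℤ a (+ suc n) (subst (ℤ._≤ + suc n * a) (sym (ℤ.*-zeroʳ (+ suc n))) p)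

sum-mono : ∀ {n} {f g : Vector ℤ n} → (∀ i → f i ℤ.≤ g i) → sum f ℤ.≤ sum g
sum-mono {zero}  p = +≤+ z≤n
sum-mono {suc n} p = ℤ.+-mono-≤ (p zero) (sum-mono (p ∘ suc))

0≤sum : ∀ {n} {f : Vector ℤ n} → (∀ i → 0ℤ ℤ.≤ f i) → 0ℤ ℤ.≤ sum f
0≤sum {n} {f} p = subst (ℤ._≤ sum f) (sum-zero {n} λ _ → refl) (sum-mono p)

+≡0⇒≡0 : ∀ {a b} → 0ℤ ℤ.≤ a → 0ℤ ℤ.≤ b → a + b ℤ.≤ 0ℤ → a ≡ 0ℤ × b ≡ 0ℤ
+≡0⇒≡0 {+ zero} {+ zero} _ _ _ = refl , refl
+≡0⇒≡0 {+ suc a} {+ b} _ _ (+≤+ ())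
+≡0⇒≡0 {+ zero} {+ suc b} _ _ (+≤+ ())

sum≤0⇒≡0 : ∀ {n} (f : Vector ℤ n) → (∀ i → 0ℤ ℤ.≤ f i) → sum f ℤ.≤ 0ℤ → ∀ i → f i ≡ 0ℤ
sum≤0⇒≡0 {suc n} f p s zero    = proj₁ (+≡0⇒≡0 (p zero) (0≤sum (p ∘ suc)) s)
sum≤0⇒≡0 {suc n} f p s (suc i) = sum≤0⇒≡0 (f ∘ suc) (p ∘ suc)
  (ℤ.≤-reflexive (proj₂ (+≡0⇒≡0 (p zero) (0≤sum (p ∘ suc)) s))) i

sum-product : ∀ {n} a b c d (f g h k : Vector ℤ n) →
  sum (λ i → (a * f i + b * g i) * (c * h i + d * k i)) ≡
  a * c * sum (λ i → f i * h i) + a * d * sum (λ i → f i * k i) +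
  (b * c * sum (λ i → g i * h i) + b * d * sum (λ i → g i * k i))
sum-product {zero}  a b c d f g h k = lemma a b c d
  where
  lemma : ∀ a b c d → 0ℤ ≡ a * c * 0ℤ + a * d * 0ℤ + (b * c * 0ℤ + b * d * 0ℤ)
  lemma = solve-∀
sum-product {suc n} a b c d f g h k = trans
  (+-congˡ ((a * f zero + b * g zero) * (c * h zero + d * k zero))
    (sum-product a b c d (f ∘ suc) (g ∘ suc) (h ∘ suc) (k ∘ suc)))
  (lemma a b c d (f zero) (g zero) (h zero) (k zero) _ _ _ _)
  where
  lemma : ∀ a b c d f g h k fh fk gh gk →
    (a * f + b * g) * (c * h + d * k) + (a * c * fh + a * d * fk + (b * c * gh + b * d * gk)) ≡
    a * c * (f * h + fh) + a * d * (f * k + fk) + (b * c * (g * h + gh) + b * d * (g * k + gk))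
  lemma = solve-∀

sum₂ : ∀ {n} → Matrix n → ℤ
sum₂ M = sum λ i → sum (M i)

sum₂-cong : ∀ {n} {M N : Matrix n} → (∀ i j → M i j ≡ N i j) → sum₂ M ≡ sum₂ N
sum₂-cong eq = sum-cong-≗ λ i → sum-cong-≗ (eq i)

sum₂-+ : ∀ {n} (M N : Matrix n) → sum₂ (λ i j → M i j + N i j) ≡ sum₂ M + sum₂ N
sum₂-+ M N = trans (sum-cong-≗ λ i → ∑-distrib-+ (M i) (N i)) (∑-distrib-+ (λ i → sum (M i)) (λ i → sum (N i)))

sum₂-* : ∀ {n} c (M : Matrix n) → sum₂ (λ i j → c * M i j) ≡ c * sum₂ M
sum₂-* c M = trans (sum-cong-≗ λ i → sym (*-distribˡ-sum c (M i))) (sym (*-distribˡ-sum c (λ i → sum (M i))))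

sum₂-sum : ∀ {n k} (M : Fin k → Matrix n) → sum₂ (λ i j → sum λ a → M a i j) ≡ sum λ a → sum₂ (M a)
sum₂-sum M = trans (sum-cong-≗ λ i → ∑-comm λ j a → M a i j) (∑-comm λ i a → sum (M a i))

combination : ∀ {n k} → Matrix n → Vector ℤ k → Matrix n
combination S c i j = sum λ a → c a * pow S (toℕ a) i j

sum₂-combination : ∀ {n k} (S : Matrix n) (c : Vector ℤ k) →
                   sum₂ (combination S c) ≡ sum λ a → c a * sum₂ (pow S (toℕ a))
sum₂-combination S c = trans (sum₂-sum λ a i j → c a * pow S (toℕ a) i j)
  (sum-cong-≗ λ a → sum₂-* (c a) (pow S (toℕ a)))

I-symmetric : ∀ {n} (i j : Fin n) → I i j ≡ I j i
I-symmetric i j = go (i Fin.≟ j)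
  where
  go : Dec (i ≡ j) → I i j ≡ I j i
  go (yes i≡j) = cong₂ I i≡j (sym i≡j)
  go (no i≢j)  = trans (I-off i≢j) (sym (I-off (≢-sym i≢j)))

module SymmetricMatrix {n} (S : Matrix n) (symmetric : ∀ i j → S i j ≡ S j i) where
  open ≡-Reasoning

  pow-symmetric : ∀ m i j → pow S m i j ≡ pow S m j i
  pow-symmetric zero    i j = I-symmetric i j
  pow-symmetric (suc m) i j = begin
    sum (λ l → S i l * pow S m l j)  ≡⟨ sum-cong-≗ (λ l → trans (cong₂ _*_ (symmetric i l) (pow-symmetric m l j))
          (ℤ.*-comm (S l i) (pow S m j l))) ⟩
    (pow S m · S) j i                ≡⟨ pow-sucʳ S m j i ⟩
    pow S (suc m) j i ∎

  pow-row-product : ∀ a b i k → sum (λ j → pow S a i j * pow S b k j) ≡ pow S (a ℕ.+ b) i k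
  pow-row-product a b i k = trans (sum-cong-≗ λ j → cong (pow S a i j *_) (pow-symmetric b k j)) (pow-+ S a b i k)

  sum₂-pow-product : ∀ a b → sum₂ (λ i j → pow S a i j * pow S b i j) ≡ trace (pow S (a ℕ.+ b))
  sum₂-pow-product a b = sum-cong-≗ λ i → pow-row-product a b i i

  rowSum : ℕ → Fin n → ℤ
  rowSum m i = sum (pow S m i)

  -- With 1 the all-ones vector this is ⟨Sᵃ1, Sᵇ1⟩ = 1ᵀSᵃ⁺ᵇ1, by symmetry of S.
  sum-rowSum-product : ∀ a b → sum (λ i → rowSum a i * rowSum b i) ≡ sum₂ (pow S (a ℕ.+ b))
  sum-rowSum-product a b = begin
    sum (λ i → rowSum a i * rowSum b i)
      ≡⟨ sum-cong-≗ (λ i → trans (*-distribʳ-sum (rowSum b i) (pow S a i))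
           (sum-cong-≗ λ j → *-distribˡ-sum (pow S a i j) (pow S b i))) ⟩
    sum (λ i → sum λ j → sum λ k → pow S a i j * pow S b i k)
      ≡⟨ ∑-comm (λ i j → sum λ k → pow S a i j * pow S b i k) ⟩
    sum (λ j → sum λ i → sum λ k → pow S a i j * pow S b i k)
      ≡⟨ sum-cong-≗ (λ j → ∑-comm λ i k → pow S a i j * pow S b i k) ⟩
    sum (λ j → sum λ k → sum λ i → pow S a i j * pow S b i k)
      ≡⟨ sum-cong-≗ (λ j → sum-cong-≗ λ k → trans (sum-cong-≗ λ i → cong (_* pow S b i k) (pow-symmetric a i j))
            (pow-+ S a b j k)) ⟩
    sum₂ (pow S (a ℕ.+ b)) ∎

  norm-combination : ∀ {k} (c : Vector ℤ k) → sum₂ (λ i j → combination S c i j * combination S c i j) ≡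
                     sum λ a → sum λ b → c a * c b * trace (pow S (toℕ a ℕ.+ toℕ b))
  norm-combination c = begin
    sum₂ (λ i j → combination S c i j * combination S c i j)
      ≡⟨ sum₂-cong (λ i j → trans (*-distribʳ-sum (combination S c i j) (λ a → c a * pow S (toℕ a) i j))
           (sum-cong-≗ λ a → trans (*-distribˡ-sum (c a * pow S (toℕ a) i j) (λ b → c b * pow S (toℕ b) i j))
             (sum-cong-≗ λ b → lemma (c a) (pow S (toℕ a) i j) (c b) (pow S (toℕ b) i j)))) ⟩
    sum₂ (λ i j → sum λ a → sum λ b → c a * c b * (pow S (toℕ a) i j * pow S (toℕ b) i j))
      ≡⟨ trans (sum₂-sum λ a i j → sum λ b → c a * c b * (pow S (toℕ a) i j * pow S (toℕ b) i j))
           (sum-cong-≗ λ a → sum₂-sum λ b i j → c a * c b * (pow S (toℕ a) i j * pow S (toℕ b) i j)) ⟩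
    sum (λ a → sum λ b → sum₂ λ i j → c a * c b * (pow S (toℕ a) i j * pow S (toℕ b) i j))
      ≡⟨ sum-cong-≗ (λ a → sum-cong-≗ λ b → trans (sum₂-* (c a * c b) (λ i j → pow S (toℕ a) i j * pow S (toℕ b) i j))
           (cong (c a * c b *_) (sum₂-pow-product (toℕ a) (toℕ b)))) ⟩
    sum (λ a → sum λ b → c a * c b * trace (pow S (toℕ a ℕ.+ toℕ b))) ∎
    where
    lemma : ∀ a x b y → a * x * (b * y) ≡ a * b * (x * y)
    lemma = solve-∀

sum₂-I : ∀ n → sum₂ (I {n}) ≡ + n
sum₂-I n = begin
  sum {n} (λ i → sum {n} (I i))        ≡⟨ sum-cong-≗ (λ i → sum-cong-≗ λ j → sym (ℤ.*-identityʳ (I {n} i j))) ⟩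
  sum {n} (λ i → sum λ j → I i j * 1ℤ)   ≡⟨ sum-cong-≗ (λ i → sum-Iˡ {n} (λ _ → 1ℤ) i) ⟩
  sum {n} (λ _ → 1ℤ)                 ≡⟨ sum-const n 1ℤ ⟩
  + n * 1ℤ                           ≡⟨ ℤ.*-identityʳ (+ n) ⟩
  + n ∎
  where open ≡-Reasoning

-- The shifted adjacency matrix of a graph

module _ {n} (G : Graph n) where
  open Graph G
  private
    A S : Matrix n
    A = adjacencyᶻ G
    S = shifted G

  adjacent⇒1 : ∀ {i j} → i ~ j → A i j ≡ 1ℤ
  adjacent⇒1 {i} {j} i~j = cong (if_then 1ℤ else 0ℤ) (dec-true (i ~? j) i~j)

  nonadjacent⇒0 : ∀ {i j} → ¬ i ~ j → A i j ≡ 0ℤ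
  nonadjacent⇒0 {i} {j} i≁j = cong (if_then 1ℤ else 0ℤ) (dec-false (i ~? j) i≁j)

  adjacency-symmetric : ∀ i j → A i j ≡ A j i
  adjacency-symmetric i j = go (i ~? j)
    where
    go : Dec (i ~ j) → A i j ≡ A j i
    go (yes i~j) = trans (adjacent⇒1 i~j) (sym (adjacent⇒1 (sym~ i~j)))
    go (no i≁j)  = trans (nonadjacent⇒0 i≁j) (sym (nonadjacent⇒0 (i≁j ∘ sym~)))

  shifted-symmetric : ∀ i j → S i j ≡ S j i
  shifted-symmetric i j = cong₂ (λ a b → a + + 3 * b) (adjacency-symmetric i j)
    (I-symmetric i j)

  -- Off the diagonal the entries are 0 or 1 and equal their squares; on it 3² = 3 + 6. This is the
  -- one place where a sum of squares turns into a linear sum.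
  shifted-square : ∀ i j → S i j * S i j ≡ S i j + + 6 * I i j
  shifted-square i j = go (i Fin.≟ j) (i ~? j)
    where
    entries : ∀ {a b} → A i j ≡ a → I i j ≡ b → (a + + 3 * b) * (a + + 3 * b) ≡ a + + 3 * b + + 6 * b →
              S i j * S i j ≡ S i j + + 6 * I i j
    entries p q r rewrite p | q = r
    go : Dec (i ≡ j) → Dec (i ~ j) → S i j * S i j ≡ S i j + + 6 * I i j
    go (yes refl) _         = entries (nonadjacent⇒0 (irrefl refl)) (I-diag i) refl
    go (no i≢j)   (yes i~j) = entries (adjacent⇒1 i~j) (I-off i≢j) refl
    go (no i≢j)   (no i≁j)  = entries (nonadjacent⇒0 i≁j) (I-off i≢j) refl

  -- The number of edges is read off from tr S², hence is determined by the spectrum.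
  sum₂-shifted : sum₂ S + + 6 * + n ≡ trace (pow S 2)
  sum₂-shifted = begin
    sum₂ S + + 6 * + n                      ≡⟨ cong (λ m → sum₂ S + + 6 * m) (sum₂-I n) ⟨
    sum₂ S + + 6 * sum₂ (I {n})             ≡⟨ +-congˡ (sum₂ S) (sum₂-* (+ 6) (I {n})) ⟨
    sum₂ S + sum₂ {n} (λ i j → + 6 * I i j)     ≡⟨ sum₂-+ {n} S (λ i j → + 6 * I i j) ⟨
    sum₂ (λ i j → S i j + + 6 * I i j)      ≡⟨ sum₂-cong shifted-square ⟨
    sum₂ (λ i j → S i j * S i j)            ≡⟨ sum₂-cong (λ i j → cong₂ _*_ (pow-1 S i j) (pow-1 S i j)) ⟨
    sum₂ (λ i j → pow S 1 i j * pow S 1 i j) ≡⟨ SymmetricMatrix.sum₂-pow-product S shifted-symmetric 1 1 ⟩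
    trace (pow S 2) ∎
    where open ≡-Reasoning

  charPoly-shifted : ∀ x → charPoly S x ≡ charPoly A (x + - + 3)
  charPoly-shifted x = Determinant.det-cong ℤ-ring λ i j → shift (does (i Fin.≟ j)) (A i j)
    where
    shift : ∀ b a → (if b then x else 0ℤ) + - (a + + 3 * (if b then 1ℤ else 0ℤ)) ≡ (if b then x + - + 3 else 0ℤ) + - a
    shift true  a = lemma x a
      where
      lemma : ∀ x a → x + - (a + + 3 * + 1) ≡ x + - + 3 + - a
      lemma = solve-∀
    shift false a = cong (λ b → 0ℤ + - b) (ℤ.+-identityʳ a)

-- Consequences of cospectrality

module Quartic {n} (Q : ℤ) (M : Matrix n)
  (cubic : ∀ i j → pow M 3 i j ≡ + 3 * Q * pow M 2 i j + - (+ 2 * Q * Q) * M i j + + 6)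
  (rowSums : ∀ i → sum (M i) ≡ + 3 * Q) where
  open ≡-Reasoning

  -- The cubic relation times M; the constant matrix 6J is multiplied by the row sum 3Q. It is
  -- applied to the Hamming matrix for p(T) = 0, and later to S to compute P².
  quartic : ∀ i j → pow M 4 i j ≡ + 3 * Q * pow M 3 i j + - (+ 2 * Q * Q) * pow M 2 i j + + 18 * Q
  quartic i j = begin
    sum (λ z → M i z * pow M 3 z j)
      ≡⟨ sum-cong-≗ (λ z → trans (cong (M i z *_) (cubic z j)) (lemma (M i z) (+ 3 * Q) (pow M 2 z j) (-
            (+ 2 * Q * Q)) (M z j))) ⟩
    sum (λ z → + 3 * Q * (M i z * pow M 2 z j) + - (+ 2 * Q * Q) * (M i z * M z j) + + 6 * M i z)
      ≡⟨ trans (∑-distrib-+ (λ z → + 3 * Q * (M i z * pow M 2 z j) + - (+ 2 * Q * Q) * (M i z * M z j)) (λ z → + 6 * M i z))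
           (cong₂ _+_ (∑-distrib-+ (λ z → + 3 * Q * (M i z * pow M 2 z j)) (λ z → - (+ 2 * Q * Q) * (M i z * M z j)))
             (sym (*-distribˡ-sum (+ 6) (M i)))) ⟩
    sum (λ z → + 3 * Q * (M i z * pow M 2 z j)) + sum (λ z → - (+ 2 * Q * Q) * (M i z * M z j)) + + 6 * sum (M i)
      ≡⟨ cong₂ (λ a b → a + b + + 6 * sum (M i))
           (sym (*-distribˡ-sum (+ 3 * Q) (λ z → M i z * pow M 2 z j)))
           (trans (sym (*-distribˡ-sum (- (+ 2 * Q * Q)) (λ z → M i z * M z j)))
             (cong (- (+ 2 * Q * Q) *_) (sum-cong-≗ λ z → cong (M i z *_) (sym (pow-1 M z j))))) ⟩
    + 3 * Q * pow M 3 i j + - (+ 2 * Q * Q) * pow M 2 i j + + 6 * sum (M i)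
      ≡⟨ cong (λ a → + 3 * Q * pow M 3 i j + - (+ 2 * Q * Q) * pow M 2 i j + a) (trans (cong (+ 6 *_) (rowSums i)) (last Q)) ⟩
    + 3 * Q * pow M 3 i j + - (+ 2 * Q * Q) * pow M 2 i j + + 18 * Q ∎
    where
    lemma : ∀ m a x b y → m * (a * x + b * y + + 6) ≡ a * (m * x) + b * (m * y) + + 6 * m
    lemma = solve-∀
    last : ∀ Q → + 6 * (+ 3 * Q) ≡ + 18 * Q
    last = solve-∀

0≤-cancelˡ : ∀ k {a} → 1ℤ ℤ.≤ k → 0ℤ ℤ.≤ k * a → 0ℤ ℤ.≤ a
0≤-cancelˡ (+ suc k) 1≤k p = 0≤-cancel k p
0≤-cancelˡ (+ zero) (+≤+ ()) p

weighted≡0 : ∀ k → 0 ℕ.< k → ∀ x y → 0ℤ ℤ.≤ x → 0ℤ ℤ.≤ y → y + + k * x ≡ 0ℤ → x ≡ 0ℤ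
weighted≡0 k 0<k x y 0≤x 0≤y eq with ℤ.i*j≡0⇒i≡0∨j≡0 (+ k) (proj₂ (+≡0⇒≡0 0≤y (0≤* k 0≤x) (ℤ.≤-reflexive eq)))
... | inj₁ k≡0 = contradiction (ℤ.+-injective k≡0) (≢-sym (ℕ.<⇒≢ 0<k))
... | inj₂ x≡0 = x≡0

a+b-b : ∀ a b → a ≡ a + b + - b
a+b-b = solve-∀

-≡0⇒≡ : ∀ a b → a + - b ≡ 0ℤ → a ≡ b
-≡0⇒≡ a b p = trans (lemma a b) (trans (cong (_+ b) p) (ℤ.+-identityˡ b))
  where
  lemma : ∀ a b → a ≡ a + - b + b
  lemma = solve-∀

module Spectral (q : ℕ) (24≤q : 24 ℕ.≤ q) (G : Graph (q ℕ.^ 3))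
  (traces : ∀ m → trace (pow (shifted G) m) ≡ trace (pow (shifted (Hamming 3 q)) m)) where
  open ≡-Reasoning

  private
    n : ℕ
    n = q ℕ.^ 3
    Q : ℤ
    Q = + q
    S T : Matrix n
    S = shifted G
    T = shifted (Hamming 3 q)
    open SymmetricMatrix S (shifted-symmetric G)
    module H = HammingCube q
    module TS = SymmetricMatrix T (shifted-symmetric (Hamming 3 q))

  n≡Q³ : + n ≡ Q * (Q * Q)
  n≡Q³ = trans (ℤ.pos-* q (q ℕ.* (q ℕ.* 1))) (cong (Q *_)
    (trans (ℤ.pos-* q (q ℕ.* 1)) (cong (λ m → Q * + m) (ℕ.*-identityʳ q))))

  norm-transfer : ∀ {k} (c : Vector ℤ k) → sum₂ (λ i j → combination S c i j * combination S c i j) ≡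
                  sum₂ (λ i j → combination T c i j * combination T c i j)
  norm-transfer c = trans (norm-combination c) (trans
    (sum-cong-≗ λ a → sum-cong-≗ λ b → cong (c a * c b *_) (traces (toℕ a ℕ.+ toℕ b)))
    (sym (TS.norm-combination c)))

  -- w = x(x - q)(x - 2q) and p = (x - 3q) w.
  w : Vector ℤ 4
  w 0F = 0ℤ
  w 1F = + 2 * Q * Q
  w 2F = - (+ 3 * Q)
  w 3F = 1ℤ

  p : Vector ℤ 5
  p 0F = 0ℤ
  p 1F = - (+ 6 * Q * Q * Q)
  p 2F = + 11 * Q * Q
  p 3F = - (+ 6 * Q)
  p 4F = 1ℤ

  combination-w : ∀ (M : Matrix n) i j → combination M w i j ≡ + 2 * Q * Q * M i j + - (+ 3 * Q) * pow M 2 i j + pow M 3 i j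
  combination-w M i j = trans (cong (λ m → 0ℤ * I i j + (+ 2 * Q * Q * m + (- (+ 3 * Q) * pow M 2 i j +
        (1ℤ * pow M 3 i j + 0ℤ)))) (pow-1 M i j))
    (lemma (I i j) (+ 2 * Q * Q) (M i j) (- (+ 3 * Q)) (pow M 2 i j) (pow M 3 i j))
    where
    lemma : ∀ e a x b y z → 0ℤ * e + (a * x + (b * y + (1ℤ * z + 0ℤ))) ≡ a * x + b * y + z
    lemma = solve-∀

  w-T : ∀ i j → combination T w i j ≡ + 6
  w-T i j = trans (combination-w T i j) (trans (+-congˡ (+ 2 * Q * Q * T i j + - (+ 3 * Q) * pow T 2 i j) (H.S-cubic i j))
    (lemma Q (T i j) (pow T 2 i j)))
    where
    lemma : ∀ Q x y → + 2 * Q * Q * x + - (+ 3 * Q) * y + (+ 3 * Q * y + - (+ 2 * Q * Q) * x + + 6) ≡ + 6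
    lemma = solve-∀

  p-T : ∀ i j → combination T p i j ≡ 0ℤ
  p-T i j = trans (cong₂ (λ s f → 0ℤ * I i j + (- (+ 6 * Q * Q * Q) * s + (+ 11 * Q * Q * pow T 2 i j + (-
        (+ 6 * Q) * pow T 3 i j + (1ℤ * f + 0ℤ)))))
      (pow-1 T i j) (Quartic.quartic Q T H.S-cubic H.S-rowSum i j))
    (trans (cong (λ c → 0ℤ * I i j + (- (+ 6 * Q * Q * Q) * T i j + (+ 11 * Q * Q * pow T 2 i j + (- (+ 6 * Q) * c +
        (1ℤ * (+ 3 * Q * c + - (+ 2 * Q * Q) * pow T 2 i j + + 18 * Q) + 0ℤ))))) (H.S-cubic i j))
      (lemma (I i j) Q (T i j) (pow T 2 i j)))
    where
    lemma : ∀ e Q x y → 0ℤ * e + (- (+ 6 * Q * Q * Q) * x + (+ 11 * Q * Q * y + (- (+ 6 * Q) * (+ 3 * Q * y + -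
          (+ 2 * Q * Q) * x + + 6) +
        (1ℤ * (+ 3 * Q * (+ 3 * Q * y + - (+ 2 * Q * Q) * x + + 6) + - (+ 2 * Q * Q) * y + + 18 * Q) + 0ℤ)))) ≡ 0ℤ
    lemma = solve-∀

  sum₂-const : ∀ m c → sum₂ {m} (λ _ _ → c) ≡ + m * (+ m * c)
  sum₂-const m c = trans (sum-const m (sum {m} λ _ → c)) (cong (+ m *_) (sum-const m c))

  sum₂-squares≡0 : ∀ (M : Matrix n) → sum₂ (λ i j → M i j * M i j) ≡ 0ℤ → ∀ i j → M i j ≡ 0ℤ
  sum₂-squares≡0 M eq i j = square≡0 (M i j) (sum≤0⇒≡0 (λ k → M i k * M i k) (λ k → 0≤square (M i k))
    (ℤ.≤-reflexive (sum≤0⇒≡0 (λ k → sum λ l → M k l * M k l) (λ k → 0≤sum λ l → 0≤square (M k l)) (ℤ.≤-reflexive eq) i)) j)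

  -- The sum of squared entries of p(S) transfers to H(3,q), where p(T) = 0; so S is annihilated by
  -- p without being diagonalised.
  p-S : ∀ i j → combination S p i j ≡ 0ℤ
  p-S = sum₂-squares≡0 (combination S p) (trans (norm-transfer p)
    (trans (sum₂-cong λ i j → cong (λ x → x * x) (p-T i j)) (trans (sum₂-const n 0ℤ) (lemma (+ n)))))
    where
    lemma : ∀ n → n * (n * 0ℤ) ≡ 0ℤ
    lemma = solve-∀

  -- Regularity

  U : ℕ → ℤ
  U m = sum₂ (pow S m)

  -- By `sum₂-shifted` and the traces of S², G has as many edges as H(3,q), whose row sums are
  -- known.
  U₁ : U 1 ≡ + 3 * Q * U 0
  U₁ = begin
    U 1                    ≡⟨ sum₂-cong (pow-1 S) ⟩
    sum₂ S                 ≡⟨ a+b-b (sum₂ S) (+ 6 * + n) ⟩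
    sum₂ S + + 6 * + n + - (+ 6 * + n)
      ≡⟨ cong (_+ - (+ 6 * + n)) (trans (sum₂-shifted G) (trans (traces 2) (sym (sum₂-shifted (Hamming 3 q))))) ⟩
    sum₂ T + + 6 * + n + - (+ 6 * + n) ≡⟨ a+b-b (sum₂ T) (+ 6 * + n) ⟨
    sum₂ T                 ≡⟨ sum-cong-≗ H.S-rowSum ⟩
    sum {n} (λ _ → + 3 * Q) ≡⟨ sum-const n (+ 3 * Q) ⟩
    + n * (+ 3 * Q)        ≡⟨ ℤ.*-comm (+ n) (+ 3 * Q) ⟩
    + 3 * Q * + n          ≡⟨ cong (+ 3 * Q *_) (sum₂-I n) ⟨
    + 3 * Q * U 0 ∎

  U-p : 0ℤ * U 0 + (- (+ 6 * Q * Q * Q) * U 1 + (+ 11 * Q * Q * U 2 + (- (+ 6 * Q) * U 3 + (1ℤ * U 4 + 0ℤ)))) ≡ 0ℤ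
  U-p = trans (sym (sum₂-combination S p)) (trans (sum₂-cong p-S) (trans (sum₂-const n 0ℤ) (lemma (+ n))))
    where
    lemma : ∀ n → n * (n * 0ℤ) ≡ 0ℤ
    lemma = solve-∀

  -- With 1 the all-ones vector, these are |(S - 3q)1|² and |(3qS - S²)1|².  By
  -- p(S) = 0 and U₁ a positive combination of them vanishes.
  X Y : ℤ
  X = sum λ i → (1ℤ * rowSum 1 i + - (+ 3 * Q) * rowSum 0 i) * (1ℤ * rowSum 1 i + - (+ 3 * Q) * rowSum 0 i)
  Y = sum λ i → (+ 3 * Q * rowSum 1 i + -1ℤ * rowSum 2 i) * (+ 3 * Q * rowSum 1 i + -1ℤ * rowSum 2 i)

  -- The identity x²(x - 3q)² + 2q²(x - 3q)² = p(x) + 6q³(3q - x), read with `U m` in place of xᵐ.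
  -- On the right, p contributes 0 by `U-p` and the other term vanishes by `U₁`.
  Y+2Q²X : Y + + (2 ℕ.* (q ℕ.* q)) * X ≡ 0ℤ
  Y+2Q²X = trans (cong₂ (λ y x → y + + (2 ℕ.* (q ℕ.* q)) * x) Y-expand X-expand)
    (trans (cong (λ c → Y′ (U 1) (U 2) (U 3) (U 4) + c * X′ (U 0) (U 1) (U 2)) (trans (ℤ.pos-* 2 (q ℕ.* q)) (cong
          (+ 2 *_) (ℤ.pos-* q q))))
    (trans (lemma₁ Q (U 0) (U 1) (U 2) (U 3) (U 4))
    (trans (cong₂ (λ z u → z + + 6 * Q * Q * Q * (+ 3 * Q * U 0 + - u)) U-p U₁) (lemma₂ Q (U 0)))))
    where
    X′ : ℤ → ℤ → ℤ → ℤ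
    X′ u₀ u₁ u₂ = 1ℤ * 1ℤ * u₂ + 1ℤ * - (+ 3 * Q) * u₁ + (- (+ 3 * Q) * 1ℤ * u₁ + - (+ 3 * Q) * - (+ 3 * Q) * u₀)
    Y′ : ℤ → ℤ → ℤ → ℤ → ℤ
    Y′ u₁ u₂ u₃ u₄ = + 3 * Q * (+ 3 * Q) * u₂ + + 3 * Q * -1ℤ * u₃ + (-1ℤ * (+ 3 * Q) * u₃ + -1ℤ * -1ℤ * u₄)
    X-expand : X ≡ X′ (U 0) (U 1) (U 2)
    X-expand = trans (sum-product 1ℤ (- (+ 3 * Q)) 1ℤ (- (+ 3 * Q)) (rowSum 1) (rowSum 0) (rowSum 1) (rowSum 0))
      (cong₂ _+_ (cong₂ (λ a b → 1ℤ * 1ℤ * a + 1ℤ * - (+ 3 * Q) * b) (sum-rowSum-product 1 1) (sum-rowSum-product 1 0))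
                 (cong₂ (λ a b → - (+ 3 * Q) * 1ℤ * a + - (+ 3 * Q) * - (+ 3 * Q) * b) (sum-rowSum-product 0 1)
                       (sum-rowSum-product 0 0)))
    Y-expand : Y ≡ Y′ (U 1) (U 2) (U 3) (U 4)
    Y-expand = trans (sum-product (+ 3 * Q) -1ℤ (+ 3 * Q) -1ℤ (rowSum 1) (rowSum 2) (rowSum 1) (rowSum 2))
      (cong₂ _+_ (cong₂ (λ a b → + 3 * Q * (+ 3 * Q) * a + + 3 * Q * -1ℤ * b) (sum-rowSum-product 1 1) (sum-rowSum-product 1 2))
                 (cong₂ (λ a b → -1ℤ * (+ 3 * Q) * a + -1ℤ * -1ℤ * b) (sum-rowSum-product 2 1) (sum-rowSum-product 2 2)))
    lemma₁ : ∀ Q u₀ u₁ u₂ u₃ u₄ →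
      + 3 * Q * (+ 3 * Q) * u₂ + + 3 * Q * -1ℤ * u₃ + (-1ℤ * (+ 3 * Q) * u₃ + -1ℤ * -1ℤ * u₄) +
        + 2 * (Q * Q) * (1ℤ * 1ℤ * u₂ + 1ℤ * - (+ 3 * Q) * u₁ + (- (+ 3 * Q) * 1ℤ * u₁ + - (+ 3 * Q) * - (+ 3 * Q) * u₀)) ≡
      (0ℤ * u₀ + (- (+ 6 * Q * Q * Q) * u₁ + (+ 11 * Q * Q * u₂ + (- (+ 6 * Q) * u₃ + (1ℤ * u₄ + 0ℤ))))) +
        + 6 * Q * Q * Q * (+ 3 * Q * u₀ + - u₁)
    lemma₁ = solve-∀
    lemma₂ : ∀ Q u₀ → 0ℤ + + 6 * Q * Q * Q * (+ 3 * Q * u₀ + - (+ 3 * Q * u₀)) ≡ 0ℤ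
    lemma₂ = solve-∀

  0<q : 0 ℕ.< q
  0<q = ℕ.≤-trans (ℕ.s≤s z≤n) 24≤q

  rowSums : ∀ i → sum (S i) ≡ + 3 * Q
  rowSums i = begin
    sum (S i)                ≡⟨ sum-cong-≗ (pow-1 S i) ⟨
    rowSum 1 i               ≡⟨ lemma (rowSum 1 i) (+ 3 * Q) (rowSum 0 i) ⟩
    1ℤ * rowSum 1 i + - (+ 3 * Q) * rowSum 0 i + + 3 * Q * rowSum 0 i ≡⟨ cong (_+ + 3 * Q * rowSum 0 i) (zero-at i) ⟩
    0ℤ + + 3 * Q * rowSum 0 i ≡⟨ cong (λ r → 0ℤ + + 3 * Q * r) rowSum-0 ⟩
    0ℤ + + 3 * Q * 1ℤ         ≡⟨ trans (ℤ.+-identityˡ _) (ℤ.*-identityʳ (+ 3 * Q)) ⟩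
    + 3 * Q ∎
    where
    lemma : ∀ r c s → r ≡ 1ℤ * r + - c * s + c * s
    lemma = solve-∀
    rowSum-0 : rowSum 0 i ≡ 1ℤ
    rowSum-0 = trans (sum-cong-≗ λ j → sym (ℤ.*-identityʳ (I i j))) (sum-Iˡ (λ _ → 1ℤ) i)
    f : Fin n → ℤ
    f i = 1ℤ * rowSum 1 i + - (+ 3 * Q) * rowSum 0 i
    X≡0 : X ≡ 0ℤ
    X≡0 = weighted≡0 (2 ℕ.* (q ℕ.* q)) (ℕ.*-mono-< {0} {2} (ℕ.s≤s z≤n) (ℕ.*-mono-< 0<q 0<q)) X Y
      (0≤sum λ i → 0≤square (f i))
      (0≤sum λ i → 0≤square (+ 3 * Q * rowSum 1 i + -1ℤ * rowSum 2 i)) Y+2Q²X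
    zero-at : ∀ i → f i ≡ 0ℤ
    zero-at i = square≡0 (f i) (sum≤0⇒≡0 (λ i → f i * f i) (λ i → 0≤square (f i)) (ℤ.≤-reflexive X≡0) i)

  U-suc : ∀ m → U (suc m) ≡ + 3 * Q * U m
  U-suc m = begin
    U (suc m)                              ≡⟨ sum-rowSum-product 1 m ⟨
    sum (λ i → rowSum 1 i * rowSum m i)
      ≡⟨ sum-cong-≗ (λ i → cong (_* rowSum m i) (trans (sum-cong-≗ (pow-1 S i)) (rowSums i))) ⟩
    sum (λ i → + 3 * Q * rowSum m i)       ≡⟨ *-distribˡ-sum (+ 3 * Q) (rowSum m) ⟨
    + 3 * Q * U m ∎

  -- Write |w(S) - 6J|² = |w(S)|² - 12 Σ w(S) + 36n². The norm transfers from H(3,q), where it is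
  -- 36n²; the entry sum is w(3q)n = 6q³n by regularity; and n = q³ makes the total 0.
  w-S : ∀ i j → combination S w i j ≡ + 6
  w-S i j = -≡0⇒≡ (combination S w i j) (+ 6) (sum₂-squares≡0 (λ i j → W i j + - + 6) vanish i j)
    where
    W : Matrix n
    W = combination S w
    square : ∀ x → (x + - + 6) * (x + - + 6) ≡ x * x + (- + 12 * x + + 36)
    square = solve-∀
    sum-W² : sum₂ (λ i j → W i j * W i j) ≡ + n * (+ n * + 36)
    sum-W² = trans (norm-transfer w) (trans (sum₂-cong λ i j → cong (λ x → x * x) (w-T i j)) (sum₂-const n (+ 36)))
    sum-W : sum₂ W ≡ + 6 * (Q * (Q * Q)) * + n
    sum-W = begin
      sum₂ W ≡⟨ sum₂-combination S w ⟩
      0ℤ * U 0 + (+ 2 * Q * Q * U 1 + (- (+ 3 * Q) * U 2 + (1ℤ * U 3 + 0ℤ)))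
        ≡⟨ cong (λ u → 0ℤ * U 0 + (+ 2 * Q * Q * U 1 + (- (+ 3 * Q) * U 2 + (1ℤ * u + 0ℤ)))) (U-suc 2) ⟩
      0ℤ * U 0 + (+ 2 * Q * Q * U 1 + (- (+ 3 * Q) * U 2 + (1ℤ * (+ 3 * Q * U 2) + 0ℤ)))
        ≡⟨ trans (cancel Q (U 0) (U 1) (U 2)) (cong (λ u → + 2 * Q * Q * u) U₁) ⟩
      + 2 * Q * Q * (+ 3 * Q * U 0) ≡⟨ cong (λ u → + 2 * Q * Q * (+ 3 * Q * u)) (sum₂-I n) ⟩
      + 2 * Q * Q * (+ 3 * Q * + n) ≡⟨ regroup Q (+ n) ⟩
      + 6 * (Q * (Q * Q)) * + n ∎
      where
      cancel : ∀ Q u₀ u₁ u₂ → 0ℤ * u₀ + (+ 2 * Q * Q * u₁ + (- (+ 3 * Q) * u₂ + (1ℤ * (+ 3 * Q * u₂) + 0ℤ))) ≡ + 2 * Q * Q * u₁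
      cancel = solve-∀
      regroup : ∀ Q n → + 2 * Q * Q * (+ 3 * Q * n) ≡ + 6 * (Q * (Q * Q)) * n
      regroup = solve-∀
    vanish : sum₂ (λ i j → (W i j + - + 6) * (W i j + - + 6)) ≡ 0ℤ
    vanish = begin
      sum₂ (λ i j → (W i j + - + 6) * (W i j + - + 6))
        ≡⟨ sum₂-cong (λ i j → square (W i j)) ⟩
      sum₂ (λ i j → W i j * W i j + (- + 12 * W i j + + 36))
        ≡⟨ trans (sum₂-+ (λ i j → W i j * W i j) (λ i j → - + 12 * W i j + + 36))
             (+-congˡ (sum₂ λ i j → W i j * W i j) (sum₂-+ (λ i j → - + 12 * W i j) (λ _ _ → + 36))) ⟩
      sum₂ (λ i j → W i j * W i j) + (sum₂ (λ i j → - + 12 * W i j) + sum₂ {n} (λ _ _ → + 36))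
        ≡⟨ cong₂ _+_ sum-W² (cong₂ _+_ (trans (sum₂-* (- + 12) W) (cong (- + 12 *_) sum-W)) (sum₂-const n (+ 36))) ⟩
      + n * (+ n * + 36) + (- + 12 * (+ 6 * (Q * (Q * Q)) * + n) + + n * (+ n * + 36))
        ≡⟨ cong (λ m → + n * (+ n * + 36) + (- + 12 * (+ 6 * m * + n) + + n * (+ n * + 36))) n≡Q³ ⟨
      + n * (+ n * + 36) + (- + 12 * (+ 6 * + n * + n) + + n * (+ n * + 36))
        ≡⟨ lemma (+ n) ⟩
      0ℤ ∎
      where
      lemma : ∀ n → n * (n * + 36) + (- + 12 * (+ 6 * n * n) + n * (n * + 36)) ≡ 0ℤ
      lemma = solve-∀

  cubic : ∀ i j → pow S 3 i j ≡ + 3 * Q * pow S 2 i j + - (+ 2 * Q * Q) * S i j + + 6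
  cubic i j = trans (lemma Q (S i j) (pow S 2 i j) (pow S 3 i j))
    (+-congˡ (+ 3 * Q * pow S 2 i j + - (+ 2 * Q * Q) * S i j) (trans (sym (combination-w S i j)) (w-S i j)))
    where
    lemma : ∀ Q x y z → z ≡ + 3 * Q * y + - (+ 2 * Q * Q) * x + (+ 2 * Q * Q * x + - (+ 3 * Q) * y + z)
    lemma = solve-∀

  quartic : ∀ i j → pow S 4 i j ≡ + 3 * Q * pow S 3 i j + - (+ 2 * Q * Q) * pow S 2 i j + + 18 * Q
  quartic = Quartic.quartic Q S cubic rowSums

  -- The polynomial x(x - q) kills the eigenvalues 0 and q and is positive at 2q and 3q, so P is
  -- positive semidefinite. In H(3,q) itself, by `S·S`, its entries are twice the number of agreeing
  -- coordinates.
  P : Matrix n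
  P i j = pow S 2 i j + - Q * S i j

  P·P : ∀ x y → sum (λ u → P x u * P y u) ≡ + 2 * Q * Q * P x y + + 24 * Q
  P·P x y = begin
    sum (λ u → P x u * P y u)
      ≡⟨ sum-cong-≗ (λ u → cong₂ _*_ (unfold x u) (unfold y u)) ⟩
    sum (λ u → (1ℤ * pow S 2 x u + - Q * pow S 1 x u) * (1ℤ * pow S 2 y u + - Q * pow S 1 y u))
      ≡⟨ sum-product 1ℤ (- Q) 1ℤ (- Q) (pow S 2 x) (pow S 1 x) (pow S 2 y) (pow S 1 y) ⟩
    1ℤ * 1ℤ * sum (λ u → pow S 2 x u * pow S 2 y u) + 1ℤ * - Q * sum (λ u → pow S 2 x u * pow S 1 y u) +
      (- Q * 1ℤ * sum (λ u → pow S 1 x u * pow S 2 y u) + - Q * - Q * sum (λ u → pow S 1 x u * pow S 1 y u))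
      ≡⟨ cong₂ _+_
           (cong₂ (λ a b → 1ℤ * 1ℤ * a + 1ℤ * - Q * b) (trans (pow-row-product 2 2 x y) (quartic x y)) (pow-row-product 2 1 x y))
           (cong₂ (λ a b → - Q * 1ℤ * a + - Q * - Q * b) (pow-row-product 1 2 x y) (pow-row-product 1 1 x y)) ⟩
    1ℤ * 1ℤ * (+ 3 * Q * pow S 3 x y + - (+ 2 * Q * Q) * pow S 2 x y + + 18 * Q) + 1ℤ * - Q * pow S 3 x y +
      (- Q * 1ℤ * pow S 3 x y + - Q * - Q * pow S 2 x y)
      ≡⟨ lemma₁ Q (pow S 2 x y) (pow S 3 x y) ⟩
    Q * pow S 3 x y + - (Q * Q) * pow S 2 x y + + 18 * Q
      ≡⟨ cong (λ a → Q * a + - (Q * Q) * pow S 2 x y + + 18 * Q) (cubic x y) ⟩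
    Q * (+ 3 * Q * pow S 2 x y + - (+ 2 * Q * Q) * S x y + + 6) + - (Q * Q) * pow S 2 x y + + 18 * Q
      ≡⟨ lemma₂ Q (S x y) (pow S 2 x y) ⟩
    + 2 * Q * Q * P x y + + 24 * Q ∎
    where
    unfold : ∀ x u → P x u ≡ 1ℤ * pow S 2 x u + - Q * pow S 1 x u
    unfold x u = trans (cong (λ s → pow S 2 x u + - Q * s) (sym (pow-1 S x u))) (cong (_+ - Q * pow S 1 x u) (sym
          (ℤ.*-identityˡ (pow S 2 x u))))
    lemma₁ : ∀ Q y z → 1ℤ * 1ℤ * (+ 3 * Q * z + - (+ 2 * Q * Q) * y + + 18 * Q) + 1ℤ * - Q * z + (- Q * 1ℤ * z + - Q * - Q * y) ≡
      Q * z + - (Q * Q) * y + + 18 * Q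
    lemma₁ = solve-∀
    lemma₂ : ∀ Q x y → Q * (+ 3 * Q * y + - (+ 2 * Q * Q) * x + + 6) + - (Q * Q) * y + + 18 * Q ≡ + 2 * Q * Q *
          (y + - Q * x) + + 24 * Q
    lemma₂ = solve-∀

  pow₂-diag : ∀ x → pow S 2 x x ≡ + 3 * Q + + 6
  pow₂-diag x = begin
    pow S 2 x x                                   ≡⟨ pow-row-product 1 1 x x ⟨
    sum (λ u → pow S 1 x u * pow S 1 x u)
      ≡⟨ sum-cong-≗ (λ u → trans (cong₂ _*_ (pow-1 S x u) (pow-1 S x u)) (shifted-square G x u)) ⟩
    sum (λ u → S x u + + 6 * I x u)               ≡⟨ ∑-distrib-+ (S x) (λ u → + 6 * I x u) ⟩
    sum (S x) + sum (λ u → + 6 * I x u)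
      ≡⟨ cong₂ _+_ (rowSums x) (trans (sum-cong-≗ λ u → ℤ.*-comm (+ 6) (I x u)) (sum-Iˡ (λ _ → + 6) x)) ⟩
    + 3 * Q + + 6 ∎

  S-diag : ∀ x → S x x ≡ + 3
  S-diag x = cong₂ (λ a b → a + + 3 * b) (nonadjacent⇒0 G (Graph.irrefl G refl)) (I-diag x)

  P-diag : ∀ x → P x x ≡ + 6
  P-diag x = trans (cong₂ (λ a b → a + - Q * b) (pow₂-diag x) (S-diag x)) (lemma Q)
    where
    lemma : ∀ Q → + 3 * Q + + 6 + - Q * + 3 ≡ + 6
    lemma = solve-∀

  24≤Q : 0ℤ ℤ.≤ Q + - + 24
  24≤Q = ℤ.i≤j⇒0≤j-i (+≤+ 24≤q)

  1≤Q : 1ℤ ℤ.≤ Q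
  1≤Q = +≤+ 0<q

  sum-square-P : ∀ ε x y → sum (λ u → (1ℤ * P x u + ε * P y u) * (1ℤ * P x u + ε * P y u)) ≡
                 + 12 * Q * Q + + 24 * Q + + 2 * ε * (+ 2 * Q * Q * P x y + + 24 * Q) + ε * ε * (+ 12 * Q * Q + + 24 * Q)
  sum-square-P ε x y = trans (sum-product 1ℤ ε 1ℤ ε (P x) (P y) (P x) (P y))
    (trans (cong₂ _+_
      (cong₂ (λ a b → 1ℤ * 1ℤ * a + 1ℤ * ε * b) (diagonal x) (P·P x y))
      (cong₂ (λ a b → ε * 1ℤ * a + ε * ε * b) (trans (sum-cong-≗ λ u → ℤ.*-comm (P y u) (P x u)) (P·P x y)) (diagonal y)))
      (lemma Q ε (P x y)))
    where
    diagonal : ∀ x → sum (λ u → P x u * P x u) ≡ + 2 * Q * Q * + 6 + + 24 * Q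
    diagonal x = trans (P·P x x) (cong (λ a → + 2 * Q * Q * a + + 24 * Q) (P-diag x))
    lemma : ∀ Q ε a → 1ℤ * 1ℤ * (+ 2 * Q * Q * + 6 + + 24 * Q) + 1ℤ * ε * (+ 2 * Q * Q * a + + 24 * Q) +
        (ε * 1ℤ * (+ 2 * Q * Q * a + + 24 * Q) + ε * ε * (+ 2 * Q * Q * + 6 + + 24 * Q)) ≡
      + 12 * Q * Q + + 24 * Q + + 2 * ε * (+ 2 * Q * Q * a + + 24 * Q) + ε * ε * (+ 12 * Q * Q + + 24 * Q)
    lemma = solve-∀

  -- In |P_x - P_y|² the contributions of 24qJ cancel, and 4q²(6 - P x y) is left.
  P≤6 : ∀ x y → 0ℤ ℤ.≤ + 6 + - P x y
  P≤6 x y = 0≤-cancelˡ Q 1≤Q (0≤-cancelˡ Q 1≤Q (0≤-cancel 3 (subst (0ℤ ℤ.≤_)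
      (trans (sum-square-P -1ℤ x y) (lemma Q (P x y)))
      (0≤sum λ u → 0≤square (1ℤ * P x u + -1ℤ * P y u)))))
    where
    lemma : ∀ Q a → + 12 * Q * Q + + 24 * Q + + 2 * -1ℤ * (+ 2 * Q * Q * a + + 24 * Q) + -1ℤ * -1ℤ * (+ 12 * Q * Q + + 24 * Q) ≡
      + 4 * (Q * (Q * (+ 6 + - a)))
    lemma = solve-∀

  -- Here |P_x + P_y|² = 4q(6q + 24 + q · P x y), which gives P x y ≥ -6 - 24/q. The assumption 24 ≤
  -- q turns this into the integer bound -7.
  -7≤P : ∀ x y → 0ℤ ℤ.≤ P x y + + 7
  -7≤P x y = 0≤-cancelˡ Q 1≤Q (subst (0ℤ ℤ.≤_) (lemma₂ Q (P x y)) (0≤+ bound 24≤Q))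
    where
    lemma₁ : ∀ Q a → + 12 * Q * Q + + 24 * Q + + 2 * 1ℤ * (+ 2 * Q * Q * a + + 24 * Q) + 1ℤ * 1ℤ * (+ 12 * Q * Q + + 24 * Q) ≡
      + 4 * (Q * (+ 6 * Q + + 24 + Q * a))
    lemma₁ = solve-∀
    bound : 0ℤ ℤ.≤ + 6 * Q + + 24 + Q * P x y
    bound = 0≤-cancelˡ Q 1≤Q (0≤-cancel 3 (subst (0ℤ ℤ.≤_)
      (trans (sum-square-P 1ℤ x y) (lemma₁ Q (P x y)))
      (0≤sum λ u → 0≤square (1ℤ * P x u + 1ℤ * P y u))))
    lemma₂ : ∀ Q a → + 6 * Q + + 24 + Q * a + (Q + - + 24) ≡ Q * (a + + 7)
    lemma₂ = solve-∀

  -- Counts of common neighbours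

  A E : Matrix n
  A = adjacencyᶻ G
  E i j = A i j + I i j

  A-pow : ∀ i j → A i j ≡ 1ℤ * pow S 1 i j + - + 3 * pow S 0 i j
  A-pow i j = trans (lemma (A i j) (I i j)) (cong (λ s → 1ℤ * s + - + 3 * I i j) (sym (pow-1 S i j)))
    where
    lemma : ∀ a e → a ≡ 1ℤ * (a + + 3 * e) + - + 3 * e
    lemma = solve-∀

  E-pow : ∀ i j → E i j ≡ 1ℤ * pow S 1 i j + - + 2 * pow S 0 i j
  E-pow i j = trans (lemma (A i j) (I i j)) (cong (λ s → 1ℤ * s + - + 2 * I i j) (sym (pow-1 S i j)))
    where
    lemma : ∀ a e → a + e ≡ 1ℤ * (a + + 3 * e) + - + 2 * e
    lemma = solve-∀

  private
    product : ∀ a b x y → sum (λ u → (1ℤ * pow S 1 x u + a * pow S 0 x u) * (1ℤ * pow S 1 y u + b * pow S 0 y u)) ≡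
              pow S 2 x y + (a + b) * S x y + a * b * I x y
    product a b x y = trans (sum-product 1ℤ a 1ℤ b (pow S 1 x) (pow S 0 x) (pow S 1 y) (pow S 0 y))
      (trans (cong₂ _+_
        (cong₂ (λ s t → 1ℤ * 1ℤ * s + 1ℤ * b * t) (pow-row-product 1 1 x y) (trans (pow-row-product 1 0 x y) (pow-1 S x y)))
        (cong₂ (λ s t → a * 1ℤ * s + a * b * t) (trans (pow-row-product 0 1 x y) (pow-1 S x y)) (pow-row-product 0 0 x y)))
        (lemma a b (pow S 2 x y) (S x y) (I x y)))
      where
      lemma : ∀ a b y x e → 1ℤ * 1ℤ * y + 1ℤ * b * x + (a * 1ℤ * x + a * b * e) ≡ y + (a + b) * x + a * b * e
      lemma = solve-∀

  degree : ∀ v → sum (A v) ≡ + 3 * Q + - + 3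
  degree v = begin
    sum (A v)                                    ≡⟨ sum-cong-≗ (λ u → lemma (A v u) (I v u)) ⟩
    sum (λ u → S v u + I v u * - + 3)            ≡⟨ ∑-distrib-+ (S v) (λ u → I v u * - + 3) ⟩
    sum (S v) + sum (λ u → I v u * - + 3)        ≡⟨ cong₂ _+_ (rowSums v) (sum-Iˡ (λ _ → - + 3) v) ⟩
    + 3 * Q + - + 3 ∎
    where
    lemma : ∀ a e → a ≡ a + + 3 * e + e * - + 3
    lemma = solve-∀

  A·E : ∀ x y → sum (λ u → A x u * E y u) ≡ pow S 2 x y + - + 5 * S x y + + 6 * I x y
  A·E x y = trans (sum-cong-≗ λ u → cong₂ _*_ (A-pow x u) (E-pow y u)) (product (- + 3) (- + 2) x y)

  E·E : ∀ x y → sum (λ u → E x u * E y u) ≡ pow S 2 x y + - + 4 * S x y + + 4 * I x y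
  E·E x y = trans (sum-cong-≗ λ u → cong₂ _*_ (E-pow x u) (E-pow y u)) (product (- + 2) (- + 2) x y)

  open Graph G

  nonequal : ∀ {x y} → x ~ y → x ≢ y
  nonequal x~y x≡y = irrefl x≡y x~y

  -- The sum is one more than the number of common neighbours, as u = y is counted; it is the closed
  -- degree of y inside the neighbourhood of x.
  A·E-adjacent : ∀ {x y} → x ~ y → sum (λ u → A x u * E y u) ≡ Q + P x y + - + 5
  A·E-adjacent {x} {y} x~y = trans (A·E x y) (trans
    (cong₂ (λ s e → pow S 2 x y + - + 5 * s + + 6 * e) S-adjacent (I-off (nonequal x~y)))
    (trans (lemma Q (pow S 2 x y)) (cong (λ s → Q + (pow S 2 x y + - Q * s) + - + 5) (sym S-adjacent))))
    where
    S-adjacent : S x y ≡ 1ℤ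
    S-adjacent = cong₂ (λ a b → a + + 3 * b) (adjacent⇒1 G x~y) (I-off (nonequal x~y))
    lemma : ∀ Q s → s + - + 5 * 1ℤ + + 6 * 0ℤ ≡ Q + (s + - Q * 1ℤ) + - + 5
    lemma = solve-∀

  localDegree-lower : ∀ {x y} → x ~ y → 0ℤ ℤ.≤ sum (λ u → A x u * E y u) + - (Q + - + 12)
  localDegree-lower {x} {y} x~y = subst (0ℤ ℤ.≤_) (trans (lemma Q (P x y)) (cong (_+ - (Q + - + 12)) (sym
        (A·E-adjacent x~y)))) (-7≤P x y)
    where
    lemma : ∀ Q a → a + + 7 ≡ Q + a + - + 5 + - (Q + - + 12)
    lemma = solve-∀

  localDegree-upper : ∀ {x y} → x ~ y → 0ℤ ℤ.≤ Q + + 1 + - sum (λ u → A x u * E y u)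
  localDegree-upper {x} {y} x~y = subst (0ℤ ℤ.≤_) (trans (lemma Q (P x y)) (cong (λ s → Q + + 1 + - s) (sym
        (A·E-adjacent x~y)))) (P≤6 x y)
    where
    lemma : ∀ Q a → + 6 + - a ≡ Q + + 1 + - (Q + a + - + 5)
    lemma = solve-∀

  common≤6 : ∀ {x y} → x ≢ y → ¬ x ~ y → 0ℤ ℤ.≤ + 6 + - sum (λ u → E x u * E y u)
  common≤6 {x} {y} x≢y x≁y = subst (0ℤ ℤ.≤_) (cong (λ s → + 6 + - s) eq) (P≤6 x y)
    where
    S-nonadjacent : S x y ≡ 0ℤ
    S-nonadjacent = cong₂ (λ a b → a + + 3 * b) (nonadjacent⇒0 G x≁y) (I-off x≢y)
    lemma : ∀ Q s → s + - Q * 0ℤ ≡ s + - + 4 * 0ℤ + + 4 * 0ℤ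
    lemma = solve-∀
    eq : P x y ≡ sum (λ u → E x u * E y u)
    eq = trans (cong (λ s → pow S 2 x y + - Q * s) S-nonadjacent) (trans (lemma Q (pow S 2 x y))
      (sym (trans (E·E x y) (cong₂ (λ s e → pow S 2 x y + - + 4 * s + + 4 * e) S-nonadjacent (I-off x≢y)))))

  -- This counts ordered pairs y ≃ u of neighbours of v, and is a combination of diagonal entries of
  -- S, S² and S³, the last of which `cubic` supplies. Three disjoint cliques of size q - 1 would
  -- give the same number.
  localEdges : ∀ v → sum (λ y → A v y * sum (λ u → A v u * E y u)) ≡ + 3 * (Q + - + 1) * (Q + - + 1)
  localEdges v = begin
    sum (λ y → A v y * sum (λ u → A v u * E y u))
      ≡⟨ sum-cong-≗ (λ y → cong₂ _*_ (A-pow v y)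
           (trans (A·E v y) (trans (cong (λ s → pow S 2 v y + - + 5 * s + + 6 * I v y) (sym (pow-1 S v y)))
             (rewrap (pow S 2 v y) (pow S 1 v y) (I v y))))) ⟩
    sum (λ y → (1ℤ * pow S 1 v y + - + 3 * pow S 0 v y) * (1ℤ * X′ y + + 6 * pow S 0 v y))
      ≡⟨ sum-product 1ℤ (- + 3) 1ℤ (+ 6) (pow S 1 v) (pow S 0 v) X′ (pow S 0 v) ⟩
    1ℤ * 1ℤ * sum (λ y → pow S 1 v y * X′ y) + 1ℤ * + 6 * sum (λ y → pow S 1 v y * pow S 0 v y) +
      (- + 3 * 1ℤ * sum (λ y → pow S 0 v y * X′ y) + - + 3 * + 6 * sum (λ y → pow S 0 v y * pow S 0 v y))
      ≡⟨ cong₂ _+_ (cong₂ (λ a b → 1ℤ * 1ℤ * a + 1ℤ * + 6 * b) (row 1) (pow-row-product 1 0 v v))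
           (cong₂ (λ a b → - + 3 * 1ℤ * a + - + 3 * + 6 * b) (row 0) (pow-row-product 0 0 v v)) ⟩
    Z (pow S 3 v v) (pow S 2 v v) (pow S 1 v v) (I v v)
      ≡⟨ trans (cong (λ c → Z c (pow S 2 v v) (pow S 1 v v) (I v v)) (cubic v v))
           (trans (cong₂ (λ s e → Z (+ 3 * Q * pow S 2 v v + - (+ 2 * Q * Q) * S v v + + 6) (pow S 2 v v) s e)
                 (trans (pow-1 S v v) (S-diag v)) (I-diag v))
             (cong₂ (λ t s → Z (+ 3 * Q * t + - (+ 2 * Q * Q) * s + + 6) t (+ 3) 1ℤ) (pow₂-diag v) (S-diag v))) ⟩
    Z (+ 3 * Q * (+ 3 * Q + + 6) + - (+ 2 * Q * Q) * + 3 + + 6) (+ 3 * Q + + 6) (+ 3) 1ℤ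
      ≡⟨ final Q ⟩
    + 3 * (Q + - + 1) * (Q + - + 1) ∎
    where
    X′ : Fin n → ℤ
    X′ y = 1ℤ * pow S 2 v y + - + 5 * pow S 1 v y
    rewrap : ∀ a b e → a + - + 5 * b + + 6 * e ≡ 1ℤ * (1ℤ * a + - + 5 * b) + + 6 * e
    rewrap = solve-∀
    row : ∀ m → sum (λ y → pow S m v y * X′ y) ≡ pow S (m ℕ.+ 2) v v + - + 5 * pow S (m ℕ.+ 1) v v
    row m = begin
      sum (λ y → pow S m v y * X′ y)
        ≡⟨ sum-cong-≗ (λ y → expand (pow S m v y) (pow S 2 v y) (pow S 1 v y)) ⟩
      sum (λ y → pow S m v y * pow S 2 v y + - + 5 * (pow S m v y * pow S 1 v y))
        ≡⟨ ∑-distrib-+ (λ y → pow S m v y * pow S 2 v y) (λ y → - + 5 * (pow S m v y * pow S 1 v y)) ⟩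
      sum (λ y → pow S m v y * pow S 2 v y) + sum (λ y → - + 5 * (pow S m v y * pow S 1 v y))
        ≡⟨ cong₂ _+_ (pow-row-product m 2 v v) (trans (sym (*-distribˡ-sum (- + 5) (λ y → pow S m v y * pow S 1 v y)))
             (cong (- + 5 *_) (pow-row-product m 1 v v))) ⟩
      pow S (m ℕ.+ 2) v v + - + 5 * pow S (m ℕ.+ 1) v v ∎
      where
      expand : ∀ c a b → c * (1ℤ * a + - + 5 * b) ≡ c * a + - + 5 * (c * b)
      expand = solve-∀
    Z : ℤ → ℤ → ℤ → ℤ → ℤ
    Z c t s e = 1ℤ * 1ℤ * (c + - + 5 * t) + 1ℤ * + 6 * s + (- + 3 * 1ℤ * (t + - + 5 * s) + - + 3 * + 6 * e)
    final : ∀ Q → 1ℤ * 1ℤ * (+ 3 * Q * (+ 3 * Q + + 6) + - (+ 2 * Q * Q) * + 3 + + 6 + - + 5 * (+ 3 * Q + + 6)) + 1ℤ * + 6 * + 3 +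
        (- + 3 * 1ℤ * (+ 3 * Q + + 6 + - + 5 * + 3) + - + 3 * + 6 * 1ℤ) ≡ + 3 * (Q + - + 1) * (Q + - + 1)
    final = solve-∀

-- The neighbourhood of a vertex

-- A 0-1 integer presented through `Fin 2`, so that pointwise inequalities between indicators become
-- finite tables settled by evaluation.
Bit : ℤ → Set
Bit x = Σ[ i ∈ Fin 2 ] x ≡ + toℕ i

bit-cover : ∀ {g a b} → Bit g → Bit a → Bit b → (1ℤ ℤ.≤ g → 1ℤ ℤ.≤ a + b) → g ℤ.≤ g * a + g * b
bit-cover (g , refl) (a , refl) (b , refl) = table g a b
  where
  table : ∀ (g a b : Fin 2) → (1ℤ ℤ.≤ + toℕ g → 1ℤ ℤ.≤ + toℕ a + + toℕ b) → + toℕ g ℤ.≤ + toℕ g * + toℕ a + + toℕ g * + toℕ b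
  table = toWitness {a? = Fin.all? λ g → Fin.all? λ a → Fin.all? λ b →
    ((1ℤ ℤ.≤? + toℕ g) →-dec (1ℤ ℤ.≤? + toℕ a + + toℕ b)) →-dec (+ toℕ g ℤ.≤? + toℕ g * + toℕ a + + toℕ g * + toℕ b)} _

-- If m of the four bits are 1, then m - m(m - 1)/2 ≤ 1. The pair terms carry no factor `g`: their
-- sums are counts in the whole graph, which is what `common≤6` bounds.
bit-bonferroni : ∀ {g a b c d} → Bit g → Bit a → Bit b → Bit c → Bit d →
  g * a + g * b + (g * c + g * d) ℤ.≤ g + ((a * b + a * c) + (a * d + b * c) + (b * d + c * d))
bit-bonferroni (g , refl) (a , refl) (b , refl) (c , refl) (d , refl) = table g a b c d
  where
  table : ∀ (g a b c d : Fin 2) → _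
  table = toWitness {a? = Fin.all? λ g → Fin.all? λ a → Fin.all? λ b → Fin.all? λ c → Fin.all? λ d →
    (+ toℕ g * + toℕ a + + toℕ g * + toℕ b + (+ toℕ g * + toℕ c + + toℕ g * + toℕ d)) ℤ.≤?
    (+ toℕ g + ((+ toℕ a * + toℕ b + + toℕ a * + toℕ c) + (+ toℕ a * + toℕ d + + toℕ b * + toℕ c) +
          (+ toℕ b * + toℕ d + + toℕ c * + toℕ d)))} _

only : ℤ → ℤ → ℤ → ℤ → ℤ
only g a b c = g * (a * ((1ℤ + - b) * (1ℤ + - c)))

bit-only : ∀ {g a b c} → Bit g → Bit a → Bit b → Bit c → Bit (only g a b c)
bit-only (g , refl) (a , refl) (b , refl) (c , refl) = table g a b c
  where
  table : ∀ (g a b c : Fin 2) → Bit (only (+ toℕ g) (+ toℕ a) (+ toℕ b) (+ toℕ c))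
  table = toWitness {a? = Fin.all? λ g → Fin.all? λ a → Fin.all? λ b → Fin.all? λ c → Fin.any? λ i → _ ℤ.≟ + toℕ i} _

-- A point of g lies in exactly one of a, b, c, or else in two of them, and then a pair term pays
-- for it.
bit-pigeonhole : ∀ {g a b c z} → Bit g → Bit a → Bit b → Bit c → Bit z → (1ℤ ℤ.≤ g → 1ℤ ℤ.≤ a + (b + c)) →
  g * z ℤ.≤ only g a b c * z + only g b a c * z + (only g c a b * z + (a * b + (a * c + b * c)))
bit-pigeonhole (g , refl) (a , refl) (b , refl) (c , refl) (z , refl) = table g a b c z
  where
  table : ∀ (g a b c z : Fin 2) → (1ℤ ℤ.≤ + toℕ g → 1ℤ ℤ.≤ + toℕ a + (+ toℕ b + + toℕ c)) → _
  table = toWitness {a? = Fin.all? λ g → Fin.all? λ a → Fin.all? λ b → Fin.all? λ c → Fin.all? λ z →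
    ((1ℤ ℤ.≤? + toℕ g) →-dec (1ℤ ℤ.≤? + toℕ a + (+ toℕ b + + toℕ c))) →-dec
    ((+ toℕ g * + toℕ z) ℤ.≤?
     (only (+ toℕ g) (+ toℕ a) (+ toℕ b) (+ toℕ c) * + toℕ z + only (+ toℕ g) (+ toℕ b) (+ toℕ a) (+ toℕ c) * + toℕ z +
      (only (+ toℕ g) (+ toℕ c) (+ toℕ a) (+ toℕ b) * + toℕ z + (+ toℕ a * + toℕ b +
            (+ toℕ a * + toℕ c + + toℕ b * + toℕ c)))))} _

0≤bit : ∀ {x} → Bit x → 0ℤ ℤ.≤ x
0≤bit (i , refl) = +≤+ z≤n

0≤-difference : ∀ {a b} → a ℤ.≤ b → 0ℤ ℤ.≤ b + - a
0≤-difference = ℤ.i≤j⇒0≤j-i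

-- The counting arguments below add nonnegative slacks until all variables cancel; a ring identity
-- then leaves a negative constant.
negative-absurd : ∀ {A : Set} k {x} → x ≡ -[1+ k ] → 0ℤ ℤ.≤ x → A
negative-absurd k refl ()

sum-+₂ : ∀ {n} (f g h k : Vector ℤ n) → sum (λ i → f i + g i + (h i + k i)) ≡ sum f + sum g + (sum h + sum k)
sum-+₂ f g h k = trans (∑-distrib-+ (λ i → f i + g i) (λ i → h i + k i)) (cong₂ _+_ (∑-distrib-+ f g) (∑-distrib-+ h k))

module Adjacency {n} (G : Graph n) where
  open Graph G

  infix 4 _≃_ _≃?_

  -- Closed adjacency, because the aim is to show that it is an equivalence relation on each
  -- neighbourhood, with three classes.
  _≃_ : Fin n → Fin n → Set
  x ≃ y = x ≡ y ⊎ x ~ y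

  _≃?_ : ∀ x y → Dec (x ≃ y)
  x ≃? y = (x Fin.≟ y) ⊎-dec (x ~? y)

  ≃-refl : ∀ {x} → x ≃ x
  ≃-refl = inj₁ refl

  ≃-sym : ∀ {x y} → x ≃ y → y ≃ x
  ≃-sym (inj₁ x≡y) = inj₁ (sym x≡y)
  ≃-sym (inj₂ x~y) = inj₂ (sym~ x~y)

  A E : Matrix n
  A = adjacencyᶻ G
  E i j = A i j + I i j

  A-bit : ∀ x y → Bit (A x y)
  A-bit x y = go (x ~? y)
    where
    go : Dec (x ~ y) → Bit (A x y)
    go (yes x~y) = 1F , adjacent⇒1 G x~y
    go (no x≁y)  = 0F , nonadjacent⇒0 G x≁y

  E-one : ∀ {x y} → x ≃ y → E x y ≡ 1ℤ
  E-one {x} (inj₁ refl) = cong₂ _+_ (nonadjacent⇒0 G {x} {x} (irrefl refl)) (I-diag x)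
  E-one (inj₂ x~y)      = cong₂ _+_ (adjacent⇒1 G x~y) (I-off λ x≡y → irrefl x≡y x~y)

  E-zero : ∀ {x y} → ¬ x ≃ y → E x y ≡ 0ℤ
  E-zero x≄y = cong₂ _+_ (nonadjacent⇒0 G (x≄y ∘ inj₂)) (I-off (x≄y ∘ inj₁))

  E-bit : ∀ x y → Bit (E x y)
  E-bit x y = go (x ≃? y)
    where
    go : Dec (x ≃ y) → Bit (E x y)
    go (yes x≃y) = 1F , E-one x≃y
    go (no x≄y)  = 0F , E-zero x≄y

  -- The neighbourhood of v is a disjoint union of three cliques with no edges between them:
  -- transitivity makes the classes of `≃` cliques, and the three representatives meet each class
  -- exactly once.
  record LocalStructure (v : Fin n) : Set where
    field
      y₁ y₂ y₃    : Fin n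
      v~y₁        : v ~ y₁
      v~y₂        : v ~ y₂
      v~y₃        : v ~ y₃
      y₁≄y₂       : ¬ y₁ ≃ y₂
      y₁≄y₃       : ¬ y₁ ≃ y₃
      y₂≄y₃       : ¬ y₂ ≃ y₃
      dominating  : ∀ {u} → v ~ u → y₁ ≃ u ⊎ y₂ ≃ u ⊎ y₃ ≃ u
      transitive  : ∀ {x y z} → v ~ x → v ~ y → v ~ z → x ≃ y → y ≃ z → x ≃ z

module Local {n} (G : Graph n) (Q : ℤ) (v : Fin n)
  (100≤Q    : 0ℤ ℤ.≤ Q + - + 100)
  (degree   : sum (Adjacency.A G v) ≡ + 3 * Q + - + 3)
  (lower    : ∀ {y} → Graph._~_ G v y → 0ℤ ℤ.≤ sum (λ u → Adjacency.A G v u * Adjacency.E G y u) + - (Q + - + 12))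
  (upper    : ∀ {y} → Graph._~_ G v y → 0ℤ ℤ.≤ Q + + 1 + - sum (λ u → Adjacency.A G v u * Adjacency.E G y u))
  (common≤6 : ∀ {x y} → ¬ Adjacency._≃_ G x y → 0ℤ ℤ.≤ + 6 + - sum (λ u → Adjacency.E G x u * Adjacency.E G y u))
  (edges    : sum (λ y → Adjacency.A G v y * sum (λ u → Adjacency.A G v u * Adjacency.E G y u)) ≡ + 3 * (Q + - + 1) * (Q + - + 1))
  where
  open Graph G
  open Adjacency G

  D : Fin n → ℤ
  D y = sum λ u → A v u * E y u

  common : Fin n → Fin n → ℤ
  common x y = sum λ u → E x u * E y u

  adjacent-if : ∀ {u} → 1ℤ ℤ.≤ A v u → v ~ u
  adjacent-if {u} 1≤A = decidable-stable (v ~? u) λ v≁u → absurd (subst (1ℤ ℤ.≤_) (nonadjacent⇒0 G v≁u) 1≤A)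
    where
    absurd : ¬ 1ℤ ℤ.≤ 0ℤ
    absurd (+≤+ ())

  -- The closed neighbourhoods of a and b together hold at most 2(Q + 1) of the 3(Q - 1) neighbours
  -- of v. A finite search makes the argument by contradiction constructive.
  escape : ∀ {a b} → v ~ a → v ~ b → ∃[ u ] (v ~ u × ¬ a ≃ u × ¬ b ≃ u)
  escape {a} {b} v~a v~b = decidable-stable
    (Fin.any? λ u → (v ~? u) ×-dec ¬? (a ≃? u) ×-dec ¬? (b ≃? u)) λ none →
      let pointwise : ∀ u → A v u ℤ.≤ A v u * E a u + A v u * E b u
          pointwise u = bit-cover (A-bit v u) (E-bit a u) (E-bit b u) λ 1≤A → covered none u (adjacent-if 1≤A)
          bound : 0ℤ ℤ.≤ D a + D b + - (+ 3 * Q + - + 3)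
          bound = subst (λ s → 0ℤ ℤ.≤ s) (cong₂ (λ x y → x + - y) (∑-distrib-+ (λ u → A v u * E a u)
                (λ u → A v u * E b u)) degree)
            (0≤-difference (sum-mono pointwise))
      in negative-absurd 94 (lemma Q (D a) (D b)) (0≤+ (0≤+ bound (upper v~a)) (0≤+ (upper v~b) 100≤Q))
    where
    covered : ¬ (∃[ u ] (v ~ u × ¬ a ≃ u × ¬ b ≃ u)) → ∀ u → v ~ u → 1ℤ ℤ.≤ E a u + E b u
    covered none u v~u with a ≃? u | b ≃? u
    ... | yes a≃u | _       = subst (λ x → 1ℤ ℤ.≤ x + E b u) (sym (E-one a≃u)) (ℤ.+-mono-≤ (ℤ.≤-refl {1ℤ}) (0≤bit (E-bit b u)))
    ... | no _    | yes b≃u = subst (λ x → 1ℤ ℤ.≤ E a u + x) (sym (E-one b≃u)) (ℤ.+-mono-≤ (0≤bit (E-bit a u)) (ℤ.≤-refl {1ℤ}))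
    ... | no a≄u  | no b≄u  = contradiction (u , v~u , a≄u , b≄u) none
    lemma : ∀ Q a b → a + b + - (+ 3 * Q + - + 3) + (Q + + 1 + - a) + (Q + + 1 + - b + (Q + - + 100)) ≡ - + 95
    lemma = solve-∀

  neighbour : ∃[ u ] v ~ u
  neighbour = decidable-stable (Fin.any? (v ~?_)) λ none →
    let degree≡0 : + 3 * Q + - + 3 ≡ 0ℤ
        degree≡0 = trans (sym degree) (sum-zero λ u → nonadjacent⇒0 G λ v~u → none (u , v~u))
    in negative-absurd 296 (trans (lemma Q) (cong (λ s → s + - + 297) degree≡0)) (0≤+ 100≤Q (0≤* 2 100≤Q))
    where
    lemma : ∀ Q → Q + - + 100 + + 2 * (Q + - + 100) ≡ + 3 * Q + - + 3 + - + 297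
    lemma = solve-∀

  -- By Bonferroni a coclique of four would give 4(Q - 12) - 6 · 6 ≤ 3Q - 3, that is Q ≤ 81.
  noCoclique₄ : ∀ {a b c d} → v ~ a → v ~ b → v ~ c → v ~ d →
                ¬ a ≃ b → ¬ a ≃ c → ¬ a ≃ d → ¬ b ≃ c → ¬ b ≃ d → c ≃ d
  noCoclique₄ {a} {b} {c} {d} v~a v~b v~c v~d a≄b a≄c a≄d b≄c b≄d = decidable-stable (c ≃? d) λ c≄d →
    negative-absurd 18 (lemma Q (D a) (D b) (D c) (D d) (common a b) (common a c) (common a d) (common b c)
          (common b d) (common c d))
      (0≤+ (0≤+ bound (0≤+ (0≤+ (lower v~a) (lower v~b)) (0≤+ (lower v~c) (lower v~d))))
           (0≤+ (0≤+ (0≤+ (common≤6 a≄b) (common≤6 a≄c)) (0≤+ (common≤6 a≄d) (common≤6 b≄c)))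
                (0≤+ (0≤+ (common≤6 b≄d) (common≤6 c≄d)) 100≤Q)))
    where
    lhs rhs : Fin n → ℤ
    lhs u = A v u * E a u + A v u * E b u + (A v u * E c u + A v u * E d u)
    rhs u = A v u + ((E a u * E b u + E a u * E c u) + (E a u * E d u + E b u * E c u) + (E b u * E d u + E c u * E d u))
    sum-rhs : sum rhs ≡ (+ 3 * Q + - + 3) + ((common a b + common a c) + (common a d + common b c) + (common b d + common c d))
    sum-rhs = trans (∑-distrib-+ (A v) (λ u → (E a u * E b u + E a u * E c u) + (E a u * E d u + E b u * E c u) +
          (E b u * E d u + E c u * E d u)))
      (cong₂ _+_ degree (trans (∑-distrib-+ (λ u → (E a u * E b u + E a u * E c u) +
            (E a u * E d u + E b u * E c u)) (λ u → E b u * E d u + E c u * E d u))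
        (cong₂ _+_ (sum-+₂ (λ u → E a u * E b u) (λ u → E a u * E c u) (λ u → E a u * E d u) (λ u → E b u * E c u))
                   (∑-distrib-+ (λ u → E b u * E d u) (λ u → E c u * E d u)))))
    bound : 0ℤ ℤ.≤ (+ 3 * Q + - + 3) + ((common a b + common a c) + (common a d + common b c) + (common b d + common c d)) +
                 - (D a + D b + (D c + D d))
    bound = subst (0ℤ ℤ.≤_) (cong₂ (λ x y → x + - y) sum-rhs
        (sum-+₂ (λ u → A v u * E a u) (λ u → A v u * E b u) (λ u → A v u * E c u) (λ u → A v u * E d u)))
      (0≤-difference (sum-mono {f = lhs} {rhs} λ u →
        bit-bonferroni (A-bit v u) (E-bit a u) (E-bit b u) (E-bit c u) (E-bit d u)))
    lemma : ∀ Q a b c d ab ac ad bc bd cd →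
      (+ 3 * Q + - + 3) + ((ab + ac) + (ad + bc) + (bd + cd)) + - (a + b + (c + d)) +
        ((a + - (Q + - + 12) + (b + - (Q + - + 12))) + (c + - (Q + - + 12) + (d + - (Q + - + 12)))) +
        (((+ 6 + - ab + (+ 6 + - ac)) + (+ 6 + - ad + (+ 6 + - bc))) + ((+ 6 + - bd + (+ 6 + - cd)) + (Q + - + 100))) ≡ - + 19
    lemma = solve-∀

  module Block {a b c} (v~a : v ~ a) (v~b : v ~ b) (v~c : v ~ c)
               (a≄b : ¬ a ≃ b) (a≄c : ¬ a ≃ c) (b≄c : ¬ b ≃ c) where

    In : Fin n → Set
    In u = v ~ u × a ≃ u × ¬ b ≃ u × ¬ c ≃ u

    κ : Fin n → ℤ
    κ u = only (A v u) (E a u) (E b u) (E c u)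

    -- Otherwise b, c, u, w would be a coclique of four.
    In-clique : ∀ {u w} → In u → In w → u ≃ w
    In-clique (v~u , _ , b≄u , c≄u) (v~w , _ , b≄w , c≄w) = noCoclique₄ v~b v~c v~u v~w b≄c b≄u b≄w c≄u c≄w

    κ-cases : ∀ u → In u ⊎ κ u ≡ 0ℤ
    κ-cases u = go (v ~? u) (a ≃? u) (b ≃? u) (c ≃? u)
      where
      zero₁ : ∀ a b c → 0ℤ * (a * ((1ℤ + - b) * (1ℤ + - c))) ≡ 0ℤ
      zero₁ = solve-∀
      zero₂ : ∀ g b c → g * (0ℤ * ((1ℤ + - b) * (1ℤ + - c))) ≡ 0ℤ
      zero₂ = solve-∀
      zero₃ : ∀ g a c → g * (a * (0ℤ * (1ℤ + - c))) ≡ 0ℤ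
      zero₃ = solve-∀
      zero₄ : ∀ g a b → g * (a * ((1ℤ + - b) * 0ℤ)) ≡ 0ℤ
      zero₄ = solve-∀
      go : Dec (v ~ u) → Dec (a ≃ u) → Dec (b ≃ u) → Dec (c ≃ u) → In u ⊎ κ u ≡ 0ℤ
      go (no v≁u)  _         _         _         = inj₂ (trans (cong (λ g → only g (E a u) (E b u) (E c u))
            (nonadjacent⇒0 G v≁u)) (zero₁ (E a u) (E b u) (E c u)))
      go (yes _)   (no a≄u)  _         _         = inj₂ (trans (cong (λ x → only (A v u) x (E b u) (E c u))
            (E-zero a≄u)) (zero₂ (A v u) (E b u) (E c u)))
      go (yes _)   (yes _)   (yes b≃u) _         = inj₂ (trans (cong (λ x → only (A v u) (E a u) x (E c u))
            (E-one b≃u)) (zero₃ (A v u) (E a u) (E c u)))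
      go (yes _)   (yes _)   (no _)    (yes c≃u) = inj₂ (trans (cong (only (A v u) (E a u) (E b u)) (E-one c≃u))
            (zero₄ (A v u) (E a u) (E b u)))
      go (yes v~u) (yes a≃u) (no b≄u)  (no c≄u)  = inj₁ (v~u , a≃u , b≄u , c≄u)

    κ-bit : ∀ u → Bit (κ u)
    κ-bit u = bit-only (A-bit v u) (E-bit a u) (E-bit b u) (E-bit c u)

    members : Fin n → ℤ
    members z = sum λ u → κ u * E z u

    -- If z and w were not joined, the at least seven members of the block joined to z would all be
    -- common to z and w, against the bound 6.
    joined : ∀ {z w} → 0ℤ ℤ.≤ members z + - + 7 → (∀ {u} → In u → w ≃ u) → z ≃ w
    joined {z} {w} 7≤m all = decidable-stable (z ≃? w) λ z≄w →
      negative-absurd 0 (lemma (members z) (common z w)) (0≤+ (0≤+ 7≤m (0≤-difference (sum-mono pointwise))) (common≤6 z≄w))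
      where
      lemma : ∀ m c → m + - + 7 + (c + - m) + (+ 6 + - c) ≡ - + 1
      lemma = solve-∀
      table : ∀ {k e} → Bit k → Bit e → k * e ℤ.≤ e * 1ℤ
      table (k , refl) (e , refl) = go k e
        where
        go : ∀ (k e : Fin 2) → + toℕ k * + toℕ e ℤ.≤ + toℕ e * 1ℤ
        go = toWitness {a? = Fin.all? λ k → Fin.all? λ e → (+ toℕ k * + toℕ e) ℤ.≤? (+ toℕ e * 1ℤ)} _
      zeroed : ∀ {e f} → Bit e → Bit f → 0ℤ * e ℤ.≤ e * f
      zeroed (e , refl) (f , refl) = go e f
        where
        go : ∀ (e f : Fin 2) → 0ℤ * + toℕ e ℤ.≤ + toℕ e * + toℕ f
        go = toWitness {a? = Fin.all? λ e → Fin.all? λ f → (0ℤ * + toℕ e) ℤ.≤? (+ toℕ e * + toℕ f)} _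
      pointwise : ∀ u → κ u * E z u ℤ.≤ E z u * E w u
      pointwise u with κ-cases u
      ... | inj₁ in-u = subst (λ x → κ u * E z u ℤ.≤ E z u * x) (sym (E-one (all in-u))) (table (κ-bit u) (E-bit z u))
      ... | inj₂ κ≡0  = subst (λ k → k * E z u ℤ.≤ E z u * E w u) (sym κ≡0) (zeroed (E-bit z u) (E-bit w u))

    joined-In : ∀ {z w} → 0ℤ ℤ.≤ members z + - + 7 → In w → z ≃ w
    joined-In 7≤m in-w = joined 7≤m (In-clique in-w)

    -- Two rounds of `joined`: first w is joined to the whole block, and then z is joined to w.
    joined-both : ∀ {z w} → 0ℤ ℤ.≤ members z + - + 7 → 0ℤ ℤ.≤ members w + - + 7 → z ≃ w
    joined-both 7≤z 7≤w = joined 7≤z (joined-In 7≤w)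

  -- The partition of a neighbourhood into three cliques

  module Coclique {a b c} (v~a : v ~ a) (v~b : v ~ b) (v~c : v ~ c)
                  (a≄b : ¬ a ≃ b) (a≄c : ¬ a ≃ c) (b≄c : ¬ b ≃ c) where

    dominated : ∀ {u} → v ~ u → a ≃ u ⊎ b ≃ u ⊎ c ≃ u
    dominated {u} v~u with a ≃? u | b ≃? u
    ... | yes a≃u | _       = inj₁ a≃u
    ... | no _    | yes b≃u = inj₂ (inj₁ b≃u)
    ... | no a≄u  | no b≄u  = inj₂ (inj₂ (noCoclique₄ v~a v~b v~c v~u a≄b a≄c a≄u b≄c b≄u))

    module B₁ = Block v~a v~b v~c a≄b a≄c b≄c
    module B₂ = Block v~b v~a v~c (a≄b ∘ ≃-sym) b≄c a≄c
    module B₃ = Block v~c v~a v~b (a≄c ∘ ≃-sym) (b≄c ∘ ≃-sym) a≄b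

    large? : ∀ m → Dec (0ℤ ℤ.≤ m + - + 7)
    large? m = 0ℤ ℤ.≤? m + - + 7

    -- The first block with at least seven members joined to z. The value `2F` is a default,
    -- justified for neighbours of v by `third`; for other vertices the factors `A v _` in the sums
    -- below remove it.
    class : Fin n → Fin 3
    class z with large? (B₁.members z) | large? (B₂.members z)
    ... | yes _ | _     = 0F
    ... | no _  | yes _ = 1F
    ... | no _  | no _  = 2F

    small⇒≤6 : ∀ m → ¬ 0ℤ ℤ.≤ m + - + 7 → 0ℤ ℤ.≤ + 6 + - m
    small⇒≤6 m ¬7≤m = subst (0ℤ ℤ.≤_) (lemma m) (0≤-difference (ℤ.i<j⇒suc[i]≤j (ℤ.≰⇒> ¬7≤m)))
      where
      lemma : ∀ m → 0ℤ + - (1ℤ + (m + - + 7)) ≡ + 6 + - m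
      lemma = solve-∀

    -- With at most 6 members of each block joined to z, and at most 6 vertices in each of the three
    -- overlaps, `D z` would be at most 36, whereas it is at least Q - 12.
    third : ∀ {z} → v ~ z → ¬ 0ℤ ℤ.≤ B₁.members z + - + 7 → ¬ 0ℤ ℤ.≤ B₂.members z + - + 7 → 0ℤ ℤ.≤ B₃.members z + - + 7
    third {z} v~z small₁ small₂ = decidable-stable (large? (B₃.members z)) λ small₃ →
      negative-absurd 51 (lemma Q (D z) (B₁.members z) (B₂.members z) (B₃.members z) (common a b) (common a c) (common b c))
        (0≤+ (0≤+ bound (0≤+ (small⇒≤6 (B₁.members z) small₁) (0≤+ (small⇒≤6 (B₂.members z) small₂) (small⇒≤6
              (B₃.members z) small₃))))
             (0≤+ (0≤+ (common≤6 a≄b) (0≤+ (common≤6 a≄c) (common≤6 b≄c))) (0≤+ (lower v~z) 100≤Q)))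
      where
      covers : ∀ u → v ~ u → 1ℤ ℤ.≤ E a u + (E b u + E c u)
      covers u v~u with dominated v~u
      ... | inj₁ a≃u        = subst (λ x → 1ℤ ℤ.≤ x + (E b u + E c u)) (sym (E-one a≃u)) (ℤ.+-mono-≤ (ℤ.≤-refl {1ℤ})
            (0≤+ (0≤bit (E-bit b u)) (0≤bit (E-bit c u))))
      ... | inj₂ (inj₁ b≃u) = subst (λ x → 1ℤ ℤ.≤ E a u + (x + E c u)) (sym (E-one b≃u)) (ℤ.+-mono-≤ (0≤bit
            (E-bit a u)) (ℤ.+-mono-≤ (ℤ.≤-refl {1ℤ}) (0≤bit (E-bit c u))))
      ... | inj₂ (inj₂ c≃u) = subst (λ x → 1ℤ ℤ.≤ E a u + (E b u + x)) (sym (E-one c≃u)) (ℤ.+-mono-≤ (0≤bit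
            (E-bit a u)) (ℤ.+-mono-≤ (0≤bit (E-bit b u)) (ℤ.≤-refl {1ℤ})))
      bound : 0ℤ ℤ.≤ B₁.members z + B₂.members z + (B₃.members z + (common a b + (common a c + common b c))) + - D z
      bound = subst (0ℤ ℤ.≤_) (cong (_+ - D z)
          (trans (sum-+₂ (λ u → B₁.κ u * E z u) (λ u → B₂.κ u * E z u) (λ u → B₃.κ u * E z u) (λ u → E a u * E b u +
                (E a u * E c u + E b u * E c u)))
            (cong (λ s → B₁.members z + B₂.members z + (B₃.members z + s))
              (trans (∑-distrib-+ (λ u → E a u * E b u) (λ u → E a u * E c u + E b u * E c u))
                (+-congˡ (common a b) (∑-distrib-+ (λ u → E a u * E c u) (λ u → E b u * E c u)))))))
        (0≤-difference (sum-mono λ u → bit-pigeonhole (A-bit v u) (E-bit a u) (E-bit b u) (E-bit c u) (E-bit z u)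
          λ 1≤A → covers u (adjacent-if 1≤A)))
      lemma : ∀ Q d x y z ab ac bc → x + y + (z + (ab + (ac + bc))) + - d + (+ 6 + - x + (+ 6 + - y + (+ 6 + - z))) +
        ((+ 6 + - ab + (+ 6 + - ac + (+ 6 + - bc))) + (d + - (Q + - + 12) + (Q + - + 100))) ≡ - + 52
      lemma = solve-∀

    class-≃ : ∀ {y z} → v ~ y → v ~ z → class y ≡ class z → y ≃ z
    class-≃ {y} {z} v~y v~z eq with large? (B₁.members y) | large? (B₂.members y) | large? (B₁.members z) | large? (B₂.members z)
    ... | yes y₁ | _      | yes z₁ | _      = B₁.joined-both y₁ z₁
    ... | no _   | yes y₂ | no _   | yes z₂ = B₂.joined-both y₂ z₂
    ... | no ¬y₁ | no ¬y₂ | no ¬z₁ | no ¬z₂ = B₃.joined-both (third v~y ¬y₁ ¬y₂) (third v~z ¬z₁ ¬z₂)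
    ... | yes _  | _      | no _   | yes _  = contradiction eq λ ()
    ... | yes _  | _      | no _   | no _   = contradiction eq λ ()
    ... | no _   | yes _  | yes _  | _      = contradiction eq λ ()
    ... | no _   | yes _  | no _   | no _   = contradiction eq λ ()
    ... | no _   | no _   | yes _  | _      = contradiction eq λ ()
    ... | no _   | no _   | no _   | yes _  = contradiction eq λ ()

    same : Fin n → Fin n → ℤ
    same y z = I (class y) (class z)

    size : Fin 3 → ℤ
    size i = sum λ y → A v y * I (class y) i

    -- Neighbours of v in one class are always joined, by `class-≃`, so this is the indicator of an
    -- edge between two different classes. Its sum is known from `edges` and the class sizes.
    excess : Matrix n
    excess y z = A v y * A v z * E y z + - (A v y * A v z * same y z)

    0≤excess : ∀ y z → 0ℤ ℤ.≤ excess y z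
    0≤excess y z = go (v ~? y) (v ~? z)
      where
      g = A v y
      h = A v z
      lemma₁ : ∀ h e s → 0ℤ * h * e + - (0ℤ * h * s) ≡ 0ℤ
      lemma₁ = solve-∀
      lemma₂ : ∀ g e s → g * 0ℤ * e + - (g * 0ℤ * s) ≡ 0ℤ
      lemma₂ = solve-∀
      lemma₃ : ∀ g h e → g * h * e + - (g * h * 0ℤ) ≡ g * h * e
      lemma₃ = solve-∀
      lemma₄ : ∀ g h → g * h * 1ℤ + - (g * h * 1ℤ) ≡ 0ℤ
      lemma₄ = solve-∀
      product : ∀ {x y z} → Bit x → Bit y → Bit z → 0ℤ ℤ.≤ x * y * z
      product (x , refl) (y , refl) (z , refl) = table x y z
        where
        table : ∀ (x y z : Fin 2) → 0ℤ ℤ.≤ + toℕ x * + toℕ y * + toℕ z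
        table = toWitness {a? = Fin.all? λ x → Fin.all? λ y → Fin.all? λ z → 0ℤ ℤ.≤? (+ toℕ x * + toℕ y * + toℕ z)} _
      at : ∀ {x} → excess y z ≡ x → 0ℤ ℤ.≤ x → 0ℤ ℤ.≤ excess y z
      at eq = subst (0ℤ ℤ.≤_) (sym eq)
      same-case : v ~ y → v ~ z → Dec (class y ≡ class z) → 0ℤ ℤ.≤ excess y z
      same-case v~y v~z (yes eq) = at (trans (cong₂ (λ e s → g * h * e + - (g * h * s)) (E-one (class-≃ v~y v~z eq))
        (trans (cong (I (class y)) (sym eq)) (I-diag (class y)))) (lemma₄ g h)) (+≤+ z≤n)
      same-case v~y v~z (no neq) = at (trans (cong (λ s → g * h * E y z + - (g * h * s)) (I-off neq)) (lemma₃ g h (E y z)))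
        (product (A-bit v y) (A-bit v z) (E-bit y z))
      go : Dec (v ~ y) → Dec (v ~ z) → 0ℤ ℤ.≤ excess y z
      go (no v≁y) _          = at (trans (cong (λ g → g * h * E y z + - (g * h * same y z)) (nonadjacent⇒0 G v≁y))
            (lemma₁ h (E y z) (same y z))) (+≤+ z≤n)
      go (yes _)  (no v≁z)   = at (trans (cong (λ h → g * h * E y z + - (g * h * same y z)) (nonadjacent⇒0 G v≁z))
            (lemma₂ g (E y z) (same y z))) (+≤+ z≤n)
      go (yes v~y) (yes v~z) = same-case v~y v~z (class y Fin.≟ class z)

    open ≡-Reasoning

    sum-sizes : sum size ≡ + 3 * Q + - + 3
    sum-sizes = begin
      sum (λ i → sum λ y → A v y * I (class y) i)  ≡⟨ ∑-comm (λ i y → A v y * I (class y) i) ⟩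
      sum (λ y → sum λ i → A v y * I (class y) i)
        ≡⟨ sum-cong-≗ (λ y → trans (sum-cong-≗ λ i → ℤ.*-comm (A v y) (I (class y) i)) (sum-Iˡ (λ _ → A v y) (class y))) ⟩
      sum (A v)                                    ≡⟨ degree ⟩
      + 3 * Q + - + 3 ∎

    sum-same : sum₂ (λ y z → A v y * A v z * same y z) ≡ sum λ i → size i * size i
    sum-same = begin
      sum₂ (λ y z → A v y * A v z * same y z)
        ≡⟨ sum₂-cong (λ y z → trans (cong (A v y * A v z *_) (trans (sym (sum-Iˡ (λ i → I i (class z)) (class y)))
             (sum-cong-≗ λ i → cong (I (class y) i *_) (I-symmetric i (class z)))))
             (trans (*-distribˡ-sum (A v y * A v z) (λ i → I (class y) i * I (class z) i))
               (sum-cong-≗ λ i → lemma (A v y) (A v z) (I (class y) i) (I (class z) i)))) ⟩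
      sum₂ (λ y z → sum λ i → A v y * I (class y) i * (A v z * I (class z) i))
        ≡⟨ sum₂-sum (λ i y z → A v y * I (class y) i * (A v z * I (class z) i)) ⟩
      sum (λ i → sum₂ λ y z → A v y * I (class y) i * (A v z * I (class z) i))
        ≡⟨ sum-cong-≗ (λ i → trans (sum-cong-≗ λ y → sym (*-distribˡ-sum (A v y * I (class y) i) (λ z → A v z * I (class z) i)))
             (sym (*-distribʳ-sum (size i) (λ y → A v y * I (class y) i)))) ⟩
      sum (λ i → size i * size i) ∎
      where
      lemma : ∀ a b c d → a * b * (c * d) ≡ a * c * (b * d)
      lemma = solve-∀

    sum-E : sum₂ (λ y z → A v y * A v z * E y z) ≡ + 3 * (Q + - + 1) * (Q + - + 1)
    sum-E = trans (sum-cong-≗ λ y → trans (sum-cong-≗ λ z → ℤ.*-assoc (A v y) (A v z) (E y z))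
      (sym (*-distribˡ-sum (A v y) (λ z → A v z * E y z)))) edges

    -- Σ dᵢ = 3(q - 1) forces Σ dᵢ² ≥ 3(q - 1)², so the cliques already
    -- account for all edges between neighbours.
    sum-excess : sum₂ excess ℤ.≤ 0ℤ
    sum-excess = subst (ℤ._≤ 0ℤ) (sym eq) (ℤ.neg-mono-≤ (0≤+ (0≤square (size 0F + - t)) (0≤+ (0≤square
          (size 1F + - t)) (0≤square (size 2F + - t)))))
      where
      t = Q + - + 1
      minus : sum₂ (λ y z → - (A v y * A v z * same y z)) ≡ - sum₂ (λ y z → A v y * A v z * same y z)
      minus = trans (sum-cong-≗ λ y → neg-sum (λ z → A v y * A v z * same y z)) (neg-sum λ y → sum λ z → A v y * A v z * same y z)
      lemma : ∀ t a b c → + 3 * t * t + - (a * a + (b * b + (c * c + 0ℤ))) ≡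
        - ((a + - t) * (a + - t) + ((b + - t) * (b + - t) + (c + - t) * (c + - t))) + + 2 * t * (+ 3 * t + - (a + (b + (c + 0ℤ))))
      lemma = solve-∀
      cancel : ∀ Q x → x + + 2 * (Q + - + 1) * (+ 3 * (Q + - + 1) + - (+ 3 * Q + - + 3)) ≡ x
      cancel = solve-∀
      eq : sum₂ excess ≡ - ((size 0F + - t) * (size 0F + - t) + ((size 1F + - t) * (size 1F + - t) +
            (size 2F + - t) * (size 2F + - t)))
      eq = begin
        sum₂ excess
          ≡⟨ trans (sum₂-+ (λ y z → A v y * A v z * E y z) (λ y z → - (A v y * A v z * same y z)))
               (cong₂ _+_ sum-E (trans minus (cong -_ sum-same))) ⟩
        + 3 * t * t + - (sum λ i → size i * size i)
          ≡⟨ lemma t (size 0F) (size 1F) (size 2F) ⟩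
        - squares + + 2 * t * (+ 3 * t + - sum size)
          ≡⟨ cong (λ s → - squares + + 2 * t * (+ 3 * t + - s)) sum-sizes ⟩
        - squares + + 2 * t * (+ 3 * t + - (+ 3 * Q + - + 3))
          ≡⟨ cancel Q (- squares) ⟩
        - squares ∎
        where
        squares = (size 0F + - t) * (size 0F + - t) + ((size 1F + - t) * (size 1F + - t) + (size 2F + - t) * (size 2F + - t))

    excess≡0 : ∀ y z → excess y z ≡ 0ℤ
    excess≡0 y z = sum≤0⇒≡0 (excess y) (0≤excess y)
      (ℤ.≤-reflexive (sum≤0⇒≡0 (λ y → sum (excess y)) (λ y → 0≤sum (0≤excess y)) sum-excess y)) z

    -- An edge between different classes would have excess 1, but the excess vanishes everywhere.
    ≃-class : ∀ {y z} → v ~ y → v ~ z → y ≃ z → class y ≡ class z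
    ≃-class {y} {z} v~y v~z y≃z = decidable-stable (class y Fin.≟ class z) λ neq →
      1≢0 (trans (sym (value neq)) (excess≡0 y z))
      where
      1≢0 : 1ℤ ≢ 0ℤ
      1≢0 ()
      at : ∀ {g h e s} → A v y ≡ g → A v z ≡ h → E y z ≡ e → same y z ≡ s → excess y z ≡ g * h * e + - (g * h * s)
      at p q r t = cong₂ _+_ (cong₂ _*_ (cong₂ _*_ p q) r) (cong -_ (cong₂ _*_ (cong₂ _*_ p q) t))
      value : class y ≢ class z → excess y z ≡ 1ℤ
      value neq = at (adjacent⇒1 G v~y) (adjacent⇒1 G v~z) (E-one y≃z) (I-off neq)

    structure : LocalStructure v
    structure = record
      { y₁ = a ; y₂ = b ; y₃ = c ; v~y₁ = v~a ; v~y₂ = v~b ; v~y₃ = v~c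
      ; y₁≄y₂ = a≄b ; y₁≄y₃ = a≄c ; y₂≄y₃ = b≄c ; dominating = dominated
      -- On the neighbours of v, `≃` is now equality of `class`.
      ; transitive = λ v~x v~y v~z x≃y y≃z → class-≃ v~x v~z (trans (≃-class v~x v~y x≃y) (≃-class v~y v~z y≃z)) }

  localStructure : LocalStructure v
  localStructure =
    let (a , v~a) = neighbour
        (b , v~b , a≄b , _) = escape v~a v~a
        (c , v~c , a≄c , b≄c) = escape v~a v~b
    in Coclique.structure v~a v~b v~c a≄b a≄c b≄c

-- The hypergraph of lines

∣⁅x⁆∪p∣ : ∀ {n} (x : Fin n) (p : Subset n) → x ∉ p → ∣ ⁅ x ⁆ ∪ p ∣ ≡ suc ∣ p ∣
∣⁅x⁆∪p∣ zero    (inside  ∷ p) x∉p = contradiction here x∉p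
∣⁅x⁆∪p∣ zero    (outside ∷ p) x∉p = cong (suc ∘ ∣_∣) (Subset.∪-identityˡ p)
∣⁅x⁆∪p∣ (suc x) (inside  ∷ p) x∉p = cong suc (∣⁅x⁆∪p∣ x p (x∉p ∘ there))
∣⁅x⁆∪p∣ (suc x) (outside ∷ p) x∉p = ∣⁅x⁆∪p∣ x p (x∉p ∘ there)

∣⁅x,y,z⁆∣ : ∀ {n} {x y z : Fin n} → x ≢ y → x ≢ z → y ≢ z → ∣ ⁅ x ⁆ ∪ (⁅ y ⁆ ∪ ⁅ z ⁆) ∣ ≡ 3
∣⁅x,y,z⁆∣ {x = x} {y} {z} x≢y x≢z y≢z = trans (∣⁅x⁆∪p∣ x (⁅ y ⁆ ∪ ⁅ z ⁆) λ x∈ →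
    [ x≢y ∘ Subset.x∈⁅y⁆⇒x≡y y , x≢z ∘ Subset.x∈⁅y⁆⇒x≡y z ]′ (Subset.x∈p∪q⁻ ⁅ y ⁆ ⁅ z ⁆ x∈))
  (cong suc (trans (∣⁅x⁆∪p∣ y ⁅ z ⁆ (y≢z ∘ Subset.x∈⁅y⁆⇒x≡y z)) (cong suc (Subset.∣⁅x⁆∣≡1 z))))

module Lines {n} (G : Graph n) (local : ∀ v → Adjacency.LocalStructure G v) where
  open Graph G
  open Adjacency G
  open module L v = LocalStructure (local v)

  -- For v ~ y these are v, y and their common neighbours, which will turn out to be a clique
  -- determined by any of its edges.
  OnLine : Fin n → Fin n → Fin n → Set
  OnLine v y u = v ≃ u × y ≃ u

  onLine? : ∀ v y u → Dec (OnLine v y u)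
  onLine? v y u = (v ≃? u) ×-dec (y ≃? u)

  mark : Bool → Fin 2
  mark b = if b then 1F else 0F

  -- The line through v and y, encoded by its indicator function.
  line : Fin n → Fin n → Fin (2 ℕ.^ n)
  line v y = funToFin λ u → mark (does (onLine? v y u))

  line-≡⇒OnLine : ∀ {v y w z} → line v y ≡ line w z → ∀ {u} → OnLine v y u → OnLine w z u
  line-≡⇒OnLine {v} {y} {w} {z} eq {u} on = decidable-stable (onLine? w z u) λ off →
    contradiction (trans (sym (cong mark (dec-true (onLine? v y u) on))) (trans marks (cong mark (dec-false
          (onLine? w z u) off)))) λ ()
    where
    marks : mark (does (onLine? v y u)) ≡ mark (does (onLine? w z u))
    marks = trans (sym (Fin.finToFun-funToFin (λ u → mark (does (onLine? v y u))) u))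
      (trans (cong (λ c → finToFun c u) eq) (Fin.finToFun-funToFin (λ u → mark (does (onLine? w z u))) u))

  line-cong : ∀ {v y w z} → (∀ {u} → OnLine v y u → OnLine w z u) → (∀ {u} → OnLine w z u → OnLine v y u) →
              line v y ≡ line w z
  line-cong {v} {y} {w} {z} to from = funToFin-cong n λ u → cong mark (same (onLine? v y u) (onLine? w z u))
    where
    same : ∀ {u} (d : Dec (OnLine v y u)) (e : Dec (OnLine w z u)) → does d ≡ does e
    same (yes _)  (yes _)  = refl
    same (no _)   (no _)   = refl
    same (yes on) (no off) = contradiction (to on) off
    same (no off) (yes on) = contradiction (from on) off

  -- Local transitivity at v, through y, makes every line a clique.
  OnLine-≃ : ∀ {v y a b} → v ~ y → OnLine v y a → OnLine v y b → a ≃ b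
  OnLine-≃ v~y (inj₁ refl , _)  (v≃b , _)        = v≃b
  OnLine-≃ v~y (inj₂ v~a , _)   (inj₁ refl , _)  = inj₂ (sym~ v~a)
  OnLine-≃ {v} v~y (inj₂ v~a , y≃a) (inj₂ v~b , y≃b) = transitive v v~a v~y v~b (≃-sym y≃a) y≃b

  -- By `OnLine-≃` each point of the line vy is joined to a and b. Conversely v and y lie on the
  -- line ab, so each point of it is joined to them.
  line-unique : ∀ {v y a b} → v ~ y → OnLine v y a → OnLine v y b → a ~ b → line v y ≡ line a b
  line-unique v~y on-a on-b a~b = line-cong
    (λ on-u → OnLine-≃ v~y on-a on-u , OnLine-≃ v~y on-b on-u)
    (λ on-u → OnLine-≃ a~b (≃-sym (proj₁ on-a) , ≃-sym (proj₁ on-b)) on-u ,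
              OnLine-≃ a~b (≃-sym (proj₂ on-a) , ≃-sym (proj₂ on-b)) on-u)

  ℓ₁ ℓ₂ ℓ₃ : Fin n → Fin (2 ℕ.^ n)
  ℓ₁ v = line v (y₁ v)
  ℓ₂ v = line v (y₂ v)
  ℓ₃ v = line v (y₃ v)

  lines : Fin n → Subset (2 ℕ.^ n)
  lines v = ⁅ ℓ₁ v ⁆ ∪ (⁅ ℓ₂ v ⁆ ∪ ⁅ ℓ₃ v ⁆)

  line-≢ : ∀ {v y z} → v ~ y → ¬ y ≃ z → line v y ≢ line v z
  line-≢ v~y y≄z eq = y≄z (≃-sym (proj₂ (line-≡⇒OnLine eq (inj₂ v~y , ≃-refl))))

  ∈-lines⁻ : ∀ {v c} → c ∈ lines v → ∃[ y ] (v ~ y × c ≡ line v y)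
  ∈-lines⁻ {v} c∈ with Subset.x∈p∪q⁻ ⁅ ℓ₁ v ⁆ (⁅ ℓ₂ v ⁆ ∪ ⁅ ℓ₃ v ⁆) c∈
  ... | inj₁ c∈₁ = y₁ v , v~y₁ v , Subset.x∈⁅y⁆⇒x≡y (ℓ₁ v) c∈₁
  ... | inj₂ c∈′ with Subset.x∈p∪q⁻ ⁅ ℓ₂ v ⁆ ⁅ ℓ₃ v ⁆ c∈′
  ...   | inj₁ c∈₂ = y₂ v , v~y₂ v , Subset.x∈⁅y⁆⇒x≡y (ℓ₂ v) c∈₂
  ...   | inj₂ c∈₃ = y₃ v , v~y₃ v , Subset.x∈⁅y⁆⇒x≡y (ℓ₃ v) c∈₃

  ℓ₁∈ : ∀ v → ℓ₁ v ∈ lines v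
  ℓ₁∈ v = Subset.x∈p∪q⁺ (inj₁ (Subset.x∈⁅x⁆ (ℓ₁ v)))

  ℓ₂∈ : ∀ v → ℓ₂ v ∈ lines v
  ℓ₂∈ v = Subset.x∈p∪q⁺ {p = ⁅ ℓ₁ v ⁆} (inj₂ (Subset.x∈p∪q⁺ (inj₁ (Subset.x∈⁅x⁆ (ℓ₂ v)))))

  ℓ₃∈ : ∀ v → ℓ₃ v ∈ lines v
  ℓ₃∈ v = Subset.x∈p∪q⁺ {p = ⁅ ℓ₁ v ⁆} (inj₂ (Subset.x∈p∪q⁺ {p = ⁅ ℓ₂ v ⁆} (inj₂ (Subset.x∈⁅x⁆ (ℓ₃ v)))))

  -- Domination puts w on one of the three chosen lines through v, which `line-unique` identifies
  -- with the line vw.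
  line∈lines : ∀ {v w} → v ~ w → line v w ∈ lines v
  line∈lines {v} {w} v~w = [ via (v~y₁ v) (ℓ₁∈ v) , [ via (v~y₂ v) (ℓ₂∈ v) , via (v~y₃ v) (ℓ₃∈ v) ]′ ]′ (dominating v v~w)
    where
    via : ∀ {y} → v ~ y → line v y ∈ lines v → y ≃ w → line v w ∈ lines v
    via v~y ∈ y≃w = subst (_∈ lines v)
      (line-unique v~y (≃-refl , ≃-sym (inj₂ v~y)) (inj₂ v~w , y≃w) v~w) ∈

  line-sym : ∀ {v w} → v ~ w → line v w ≡ line w v
  line-sym v~w = line-unique v~w (inj₂ v~w , ≃-refl) (≃-refl , inj₂ (sym~ v~w)) (sym~ v~w)

  -- As a line through w, c contains w; as a line through v, all its points are joined or equal to
  -- v.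
  ∈-lines⇒≃ : ∀ {c v w} → c ∈ lines v → c ∈ lines w → v ≃ w
  ∈-lines⇒≃ c∈v c∈w with ∈-lines⁻ c∈v | ∈-lines⁻ c∈w
  ... | _ , _ , c≡ | _ , w~z , c≡′ = proj₁ (line-≡⇒OnLine (trans (sym c≡′) c≡) (≃-refl , ≃-sym (inj₂ w~z)))

  ∈-lines⇒≡line : ∀ {c v w} → v ~ w → c ∈ lines v → c ∈ lines w → c ≡ line v w
  ∈-lines⇒≡line v~w c∈v c∈w with ∈-lines⁻ c∈v | ∈-lines⁻ c∈w
  ... | _ , v~y , c≡ | _ , w~z , c≡′ = trans c≡ (line-unique v~y (≃-refl , ≃-sym (inj₂ v~y))
    (line-≡⇒OnLine (trans (sym c≡′) c≡) (≃-refl , ≃-sym (inj₂ w~z))) v~w)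

  -- The hypergraph is dual to the geometry of lines: its edges are the vertices of G and its points
  -- are lines. Linearity thus says that two lines share at most one vertex, or that two vertices
  -- share at most one line.
  linear : ∀ x y → x ≢ y → ∀ e e′ → x ∈ lines e → y ∈ lines e → x ∈ lines e′ → y ∈ lines e′ → e ≡ e′
  linear x y x≢y e e′ x∈e y∈e x∈e′ y∈e′ with ∈-lines⇒≃ x∈e x∈e′
  ... | inj₁ e≡e′ = e≡e′
  ... | inj₂ e~e′ = contradiction (trans (∈-lines⇒≡line e~e′ x∈e x∈e′) (sym (∈-lines⇒≡line e~e′ y∈e y∈e′))) x≢y

  ℓ₁≢ℓ₂ : ∀ v → ℓ₁ v ≢ ℓ₂ v
  ℓ₁≢ℓ₂ v = line-≢ (v~y₁ v) (y₁≄y₂ v)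

  hypergraph : Hypergraph
  hypergraph = record
    -- Every vertex set of G is a point of the hypergraph; those that are not lines lie in no edge.
    { order    = 2 ℕ.^ n
    ; size     = n
    ; edge     = lines
    -- Equal edges share two distinct lines, so linearity identifies their vertices.
    ; distinct = λ {e} {e′} eq → linear (ℓ₁ e) (ℓ₂ e) (ℓ₁≢ℓ₂ e) e e′ (ℓ₁∈ e) (ℓ₂∈ e)
                   (subst (ℓ₁ e ∈_) eq (ℓ₁∈ e)) (subst (ℓ₂ e ∈_) eq (ℓ₂∈ e))
    ; nonempty = λ e → ℓ₁ e , ℓ₁∈ e
    }

  uniform : Uniform hypergraph 3
  uniform v = ∣⁅x,y,z⁆∣ (ℓ₁≢ℓ₂ v) (line-≢ (v~y₁ v) (y₁≄y₃ v)) (line-≢ (v~y₂ v) (y₂≄y₃ v))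

  isomorphic : G ≅ intersectionGraph hypergraph
  isomorphic = ↔-id (Fin n) , λ i j → mk⇔
    (λ i~j → (λ i≡j → irrefl i≡j i~j) , line i j ,
      Subset.x∈p∩q⁺ (line∈lines i~j , subst (_∈ lines j) (sym (line-sym i~j)) (line∈lines (sym~ i~j))))
    (λ (i≢j , c , c∈) → let (c∈i , c∈j) = Subset.x∈p∩q⁻ (lines i) (lines j) c∈ in
      [ (λ i≡j → contradiction i≡j i≢j) , id ]′ (∈-lines⇒≃ c∈i c∈j))

theorem1p6 : ∃[ q′ ] (0 < q′ ×
    ((q : ℕ) → q′ ≤ q →
    (n : ℕ) (G : Graph n) → Cospectral G (Hamming 3 q) →
    Σ[ H ∈ Hypergraph ] (Linear H × Uniform H 3 × G ≅ intersectionGraph H)))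
-- The tightest count is `noCoclique₄`, which needs q > 81; `third` needs q > 48 and `-7≤P` needs q
-- ≥ 24.
theorem1p6 = 100 , s≤s z≤n , λ q 100≤q n G cospectral →
  let (n≡q³ , charPolys) = cospectral⇒charPoly G (Hamming 3 q) cospectral
  in conclude q 100≤q n G n≡q³ charPolys
  where
  conclude : ∀ q → 100 ≤ q → ∀ n (G : Graph n) → n ≡ q ℕ.^ 3 →
             (∀ z → IntegerMatrices.charPoly (adjacencyᶻ G) z ≡ IntegerMatrices.charPoly (adjacencyᶻ (Hamming 3 q)) z) →
             Σ[ H ∈ Hypergraph ] (Linear H × Uniform H 3 × G ≅ intersectionGraph H)
  conclude q 100≤q n G refl charPolys = hypergraph , linear , uniform , isomorphic
    where
    traces : ∀ m → trace (pow (shifted G) m) ≡ trace (pow (shifted (Hamming 3 q)) m)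
    traces = charPoly⇒traces (shifted G) (shifted (Hamming 3 q)) λ x →
      trans (charPoly-shifted G x) (trans (charPolys (x ℤ.+ ℤ.- + 3)) (sym (charPoly-shifted (Hamming 3 q) x)))
    module S = Spectral q (ℕ.≤-trans (ℕ.m≤m+n 24 76) 100≤q) G traces
    local : ∀ v → Adjacency.LocalStructure G v
    local v = Local.localStructure G (+ q) v (ℤ.i≤j⇒0≤j-i (+≤+ 100≤q)) (S.degree v)
      S.localDegree-lower S.localDegree-upper (λ x≄y → S.common≤6 (x≄y ∘ inj₁) (x≄y ∘ inj₂)) (S.localEdges v)
    open Lines G local
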